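{- For every non-trivial finite Abelian group $G$ there exist a positive constant $\delta$ and a family $(\mathbb{A}_n)_{n\ge1}$ of unsatisfiable instances of $3\mathrm{LIN}(G)$, where $\mathbb{A}_n$ has $\Theta(n)$ variables and $\Theta(n)$ equations, such that for every sufficiently large $n$ every Polynomial Calculus refutation over the reals of $\mathrm{EQ}(\mathbb{A}_n,\mathbb{B}(G,3))$ has degree at least $\delta n$.
   Context: For a finite Abelian group $G$, $\mathbb{B}(G,3)$ is the structure with domain $G$ having one ternary relation symbol for each distinct relation of the form $\{(g_1,g_2,g_3)\in G^3:z_1g_1+z_2g_2+z_3g_3=g\}$ ($g\in G$, $z_i\in\mathbb{Z}$), interpreted as that relation; $3\mathrm{LIN}(G)=\mathrm{CSP}(\mathbb{B}(G,3))$, whose instances are finite structures in this vocabulary (systems of linear equations over $G$, three variable positions per equation); an instance is unsatisfiable if it has no homomorphism to $\mathbb{B}(G,3)$. $\mathrm{EQ}(\mathbb{A},\mathbb{B})$ is the system of polynomial equations over variables $X(a,b)$ and twins $\bar X(a,b)$ ($a\in A,b\in B$): $\prod_{b\in B}\bar X(a,b)=0$ for $a\in A$; $X(a,b_0)X(a,b_1)=0$ for $a\in A$, $b_0\ne b_1$; $\prod_{i=1}^rX(a_i,b_i)=0$ for each relation symbol $R$ of arity $r$, $(a_1,\dots,a_r)\in R(\mathbb{A})$, $(b_1,\dots,b_r)\in B^r\setminus R(\mathbb{B})$. Polynomial Calculus over $\mathbb{R}$: derive equations from these and the axioms $X^2-X=0$, $\bar X^2-\bar X=0$, $X+\bar X-1=0$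 by $P=0,Q=0\vdash P+Q=0$, $P=0\vdash cP=0$ ($c\in\mathbb{R}$), $P=0\vdash YP=0$ ($Y$ a variable or twin); a refutation derives $1=0$; its degree is the maximum total degree of a polynomial in it. -}

module Defs where

open import Level using (Level; _⊔_) renaming (suc to lsuc; zero to lzero)
open import Data.Nat as ℕ using (ℕ; zero; suc; _<_; _≤_)
open import Data.Integer as ℤ using (ℤ; +_; -[1+_])
open import Data.Fin as Fin using (Fin; combine)
open import Data.Fin.Properties using () renaming (_≟_ to _≟ᶠ_)
open import Data.Vec as Vec using (Vec; tabulate; zipWith; replicate)
open import Data.Vec.Properties using (≡-dec)
open import Data.Nat.Properties using () renaming (_≟_ to _≟ℕ_)
open import Data.List as List using (List; []; _∷_; _++_; map; length; allFin; foldr)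
open import Data.List.Relation.Unary.All using (All)
open import Data.List.Relation.Unary.AllPairs using (AllPairs)
open import Data.Product using (Σ; _×_; _,_; ∃)
open import Data.Empty using (⊥)
open import Data.Sum using (_⊎_)
open import Relation.Nullary using (¬_; yes; no; Dec)
open import Data.List.Membership.Propositional using (_∈_)
open import Relation.Binary.PropositionalEquality using (_≡_; _≢_)
open import Algebra.Structures using (IsAbelianGroup; IsCommutativeRing)
open import Function.Bundles using (_⇔_)

record RealField (c ℓ : Level) : Set (lsuc (c ⊔ ℓ)) where
  infix  4 _≈_ _≤ᵣ_
  infixl 6 _+_
  infixl 7 _*_
  field
    Carrier : Set c
    _≈_     : Carrier → Carrier → Set ℓ
    _+_     : Carrier → Carrier → Carrier
    _*_     : Carrier → Carrier → Carrier
    -_      : Carrier → Carrier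
    0#      : Carrier
    1#      : Carrier
    isCommutativeRing : IsCommutativeRing _≈_ _+_ _*_ -_ 0# 1#
    0≉1     : ¬ (0# ≈ 1#)
    _⁻¹     : Carrier → Carrier
    ⁻¹-inverse : ∀ x → ¬ (x ≈ 0#) → (x * (x ⁻¹)) ≈ 1#
    _≤ᵣ_    : Carrier → Carrier → Set ℓ
    ≤-refl  : ∀ {x y} → x ≈ y → x ≤ᵣ y
    ≤-antisym : ∀ {x y} → x ≤ᵣ y → y ≤ᵣ x → x ≈ y
    ≤-trans : ∀ {x y z} → x ≤ᵣ y → y ≤ᵣ z → x ≤ᵣ z
    ≤-total : ∀ x y → (x ≤ᵣ y) ⊎ (y ≤ᵣ x)
    +-mono-≤ : ∀ {x y} z → x ≤ᵣ y → (x + z) ≤ᵣ (y + z)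
    *-nonneg : ∀ {x y} → 0# ≤ᵣ x → 0# ≤ᵣ y → 0# ≤ᵣ (x * y)
    sup     : ∀ (S : Carrier → Set (c ⊔ ℓ)) → (∃ S) →
              (∃ λ u → ∀ x → S x → x ≤ᵣ u) →
              ∃ λ s → (∀ x → S x → x ≤ᵣ s) × (∀ u → (∀ x → S x → x ≤ᵣ u) → s ≤ᵣ u)

record FinAbGroup : Set where
  field
    order : ℕ
    _∙_   : Fin order → Fin order → Fin order
    ε     : Fin order
    _⁻¹   : Fin order → Fin order
    isAbelianGroup : IsAbelianGroup _≡_ _∙_ ε _⁻¹

  natMul : ℕ → Fin order → Fin order
  natMul zero    g = ε
  natMul (suc k) g = g ∙ natMul k g

  zMul : ℤ → Fin order → Fin order
  zMul (+ k)      g = natMul k g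
  zMul -[1+ k ]   g = (natMul (suc k) g) ⁻¹

NonTrivial : FinAbGroup → Set
NonTrivial G = 2 ≤ FinAbGroup.order G

-- Instances of 3LIN(G).  A constraint  z₁x_{a₁}+z₂x_{a₂}+z₃x_{a₃}=g
-- puts the tuple (a₁,a₂,a₃) into the relation symbol
-- R_{z,g} = {(g₁,g₂,g₃) : z₁g₁+z₂g₂+z₃g₃ = g} of 𝔹(G,3).

module _ (G : FinAbGroup) where
  open FinAbGroup G

  InRel : ℤ → ℤ → ℤ → Fin order → Fin order → Fin order → Fin order → Set
  InRel z₁ z₂ z₃ g g₁ g₂ g₃ = (zMul z₁ g₁ ∙ zMul z₂ g₂) ∙ zMul z₃ g₃ ≡ g

  record Constraint (m : ℕ) : Set where
    constructor constraint
    field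
      z₁ z₂ z₃ : ℤ
      rhs      : Fin order
      a₁ a₂ a₃ : Fin m

  holds : ∀ {m} → Constraint m → Fin order → Fin order → Fin order → Set
  holds c = InRel z₁ z₂ z₃ rhs where open Constraint c

  -- two constraints are the same (relation symbol, tuple) pair
  SameAtom : ∀ {m} → Constraint m → Constraint m → Set
  SameAtom c d =
    (Constraint.a₁ c ≡ Constraint.a₁ d) × (Constraint.a₂ c ≡ Constraint.a₂ d) ×
    (Constraint.a₃ c ≡ Constraint.a₃ d) ×
    (∀ g₁ g₂ g₃ → holds c g₁ g₂ g₃ ⇔ holds d g₁ g₂ g₃)

  -- a finite structure in the vocabulary of 𝔹(G,3): domain Fin vars, and
  -- the list of atoms R(a₁,a₂,a₃) that hold in it
  record Instance : Set where
    field
      vars : ℕ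
      eqs  : List (Constraint vars)

  numVars : Instance → ℕ
  numVars = Instance.vars

  numEqs : Instance → ℕ
  numEqs I = length (Instance.eqs I)

  -- no atom is listed twice (so numEqs counts the tuples of the structure)
  Irredundant : Instance → Set
  Irredundant I = AllPairs (λ c d → ¬ SameAtom c d) (Instance.eqs I)

  Hom : Instance → Set
  Hom I = Σ (Fin (Instance.vars I) → Fin order) λ h →
            All (λ c → holds c (h (Constraint.a₁ c)) (h (Constraint.a₂ c)) (h (Constraint.a₃ c)))
                (Instance.eqs I)

  Unsatisfiable : Instance → Set
  Unsatisfiable I = ¬ Hom I

-- Polynomials over a field with variables indexed by Fin N, represented
-- as lists of terms (coefficient, exponent vector).  Two lists denote the
-- same polynomial iff all their coefficients agree.

module Poly {c ℓ : Level} (R : RealField c ℓ) (N : ℕ) where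
  open RealField R

  Mono : Set
  Mono = Vec ℕ N

  deg : Mono → ℕ
  deg = Vec.sum

  oneMono : Mono
  oneMono = replicate N 0

  unitMono : Fin N → Mono
  unitMono i = tabulate (λ j → isEq (i ≟ᶠ j))
    where
    isEq : ∀ {p} → Dec p → ℕ
    isEq (yes _) = 1
    isEq (no _)  = 0

  _·ₘ_ : Mono → Mono → Mono
  _·ₘ_ = zipWith ℕ._+_

  Polynomial : Set c
  Polynomial = List (Carrier × Mono)

  coeff : Polynomial → Mono → Carrier
  coeff []              μ = 0#
  coeff ((a , ν) ∷ ts)  μ with ≡-dec _≟ℕ_ ν μ
  ... | yes _ = a + coeff ts μ
  ... | no  _ = coeff ts μ

  DegLe : ℕ → Polynomial → Set ℓ
  DegLe d P = ∀ μ → d < deg μ → coeff P μ ≈ 0#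

  IsOne : Polynomial → Set ℓ
  IsOne P = (coeff P oneMono ≈ 1#) × (∀ μ → μ ≢ oneMono → coeff P μ ≈ 0#)

  monomial : Mono → Polynomial
  monomial μ = (1# , μ) ∷ []

  _⊕_ : Polynomial → Polynomial → Polynomial
  _⊕_ = _++_

  scale : Carrier → Polynomial → Polynomial
  scale a = map (λ { (b , μ) → (a * b , μ) })

  mulVar : Fin N → Polynomial → Polynomial
  mulVar i = map (λ { (b , μ) → (b , unitMono i ·ₘ μ) })

  -- Polynomial Calculus derivations in which every line has degree ≤ d,
  -- from a set of axioms Ax (the given equations P = 0 are written as P).
  data Deriv (Ax : Polynomial → Set ℓ) (d : ℕ) : Polynomial → Set (c ⊔ ℓ) where
    axiom : ∀ {P} → Ax P → DegLe d P → Deriv Ax d P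
    add   : ∀ {P Q} → Deriv Ax d P → Deriv Ax d Q → DegLe d (P ⊕ Q) → Deriv Ax d (P ⊕ Q)
    mulC  : ∀ {P} (a : Carrier) → Deriv Ax d P → DegLe d (scale a P) → Deriv Ax d (scale a P)
    mulY  : ∀ {P} (i : Fin N) → Deriv Ax d P → DegLe d (mulVar i P) → Deriv Ax d (mulVar i P)

  RefutationOfDeg : (Polynomial → Set ℓ) → ℕ → Set (c ⊔ ℓ)
  RefutationOfDeg Ax d = Σ Polynomial λ P → Deriv Ax d P × IsOne P

-- EQ(𝔸, 𝔹(G,3)) together with the Boolean axioms, as a set of polynomials.
-- Variable X(a,b) has index combine (combine a b) 0, its twin X̄(a,b)
-- has index combine (combine a b) 1.

module _ {c ℓ : Level} (R : RealField c ℓ) (G : FinAbGroup) (I : Instance G) where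
  open RealField R using (1#; -_)
  private
    m = Instance.vars I
    n = FinAbGroup.order G
    N = (m ℕ.* n) ℕ.* 2
  open Poly R N

  X X̄ : Fin m → Fin n → Fin N
  X  a b = combine (combine a b) Fin.zero
  X̄ a b = combine (combine a b) (Fin.suc Fin.zero)

  prodMono : List (Fin N) → Mono
  prodMono = foldr (λ i μ → unitMono i ·ₘ μ) oneMono

  data EQAx : Polynomial → Set ℓ where
    twinProd  : ∀ a → EQAx (monomial (prodMono (map (X̄ a) (allFin n))))
    atMostOne : ∀ a b₀ b₁ → b₀ ≢ b₁ → EQAx (monomial (prodMono (X a b₀ ∷ X a b₁ ∷ [])))
    relation  : ∀ (k : Constraint G m) → k ∈ Instance.eqs I →
                ∀ b₁ b₂ b₃ → ¬ holds G k b₁ b₂ b₃ →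
                EQAx (monomial (prodMono (X (Constraint.a₁ k) b₁ ∷ X (Constraint.a₂ k) b₂ ∷
                                          X (Constraint.a₃ k) b₃ ∷ [])))
    boolean   : ∀ (i : Fin N) → EQAx ((1# , prodMono (i ∷ i ∷ [])) ∷ (- 1# , unitMono i) ∷ [])
    twin      : ∀ a b → EQAx ((1# , unitMono (X a b)) ∷ (1# , unitMono (X̄ a b)) ∷
                              (- 1# , oneMono) ∷ [])

  PCRefutableInDeg : ℕ → Set (c ⊔ ℓ)
  PCRefutableInDeg d = RefutationOfDeg EQAx d

module Submission where

-- The instances are Tseitin systems on cubic bipartite graphs: out-vertices and in-vertices are both indexed
-- by Fin L, three permutations of Fin L give the edges, each edge is a variable, and the equation of a
-- vertex says that its three edges sum to its charge, which is h ≠ 0 at one out-vertex and 0 elsewhere.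
-- Summing over the out-vertices and over the in-vertices gives h = 0, so the system is unsatisfiable.
-- The graph consists of a cycle through L = 16σ · D positions, cut into 16σ blocks of length D, and of
-- D random permutations π i of the blocks, the i-th acting on the i-th positions; by counting, some choice
-- of the π i maps no set of ≥ σ blocks into a set of ≤ 15σ blocks.  Hence, if a combination F of the
-- equations over ℤ/p involves at most σ variables, then F is almost constant: up to a constant, few blocks
-- have a nonzero multiplier.
--
-- For the degree bound, let h have prime order p and substitute x_e = i h with i in ℤ/p.  For a function u
-- on ℤ/p of mean zero and an affine form α in at most d variables, pair a polynomial Q with
--   Σ_x Q(x) Σ_F u(α(x) + Σ_q F_q ℓ_q(x)),
-- where F runs over the combinations with few nonzero multipliers and the ℓ_q are the equations.  The Q of
-- degree ≤ d that pair to zero with all such α and u contain the axioms and are closed under the rules of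
-- Polynomial Calculus, because p [x_e = i] u(z) = Σ_j u(z + j (x_e − i)); but 1 is not among them.
-- Using such u instead of characters keeps everything over an ordered field.

open import Defs
open import Level using () renaming (zero to lzero)
open import Data.Bool using (Bool; true; false; not; _∧_; _∨_)
open import Data.Nat hiding (NonTrivial)
open import Data.Nat.Properties
import Data.Nat.Divisibility as ℕ∣
open import Data.Nat.Primality using (Prime; prime; Composite; composite; euclidsLemma)
open import Data.Nat.Tactic.RingSolver using (solve-∀)
open import Data.Integer as ℤ using (ℤ; +_; 0ℤ; 1ℤ)
import Data.Integer.Properties as ℤₚ
import Data.Integer.DivMod as ℤ/
open import Data.Integer.Divisibility.Signed as ℤ∣ using (divides)
open import Data.Integer.Tactic.RingSolver using () renaming (solve-∀ to ℤ-solve-∀)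
open import Data.Fin as Fin using (Fin; zero; suc; toℕ; fromℕ; fromℕ<; inject₁; punchIn; punchOut; combine; remQuot; splitAt; _↑ˡ_; _↑ʳ_)
import Data.Fin.Properties as Finₚ
import Data.Fin.Permutation as Perm
open Perm using (Permutation′; _⟨$⟩ʳ_; _⟨$⟩ˡ_)
open import Data.List as List using (List; []; _∷_; length; map; tabulate; allFin; cartesianProductWith; _++_)
import Data.List.Properties as Listₚ
open import Data.List.Membership.Propositional using (_∈_)
open import Data.List.Membership.Propositional.Properties using (∈-map⁺; ∈-allFin; ∈-tabulate⁻)
open import Data.List.Relation.Unary.Any using (here; there)
import Data.List.Relation.Unary.All.Properties as Allₚ
import Data.List.Relation.Unary.AllPairs.Properties as AllPairsₚ
open import Data.Vec as Vec using (Vec; []; _∷_; lookup; zipWith; replicate; _[_]≔_)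
import Data.Vec.Properties as Vecₚ
open Vecₚ using (lookup∘tabulate)
open import Data.Product using (Σ; _×_; _,_; ∃; proj₁; proj₂; uncurry)
open import Data.Sum using (_⊎_; inj₁; inj₂)
open import Data.Unit using (tt)
open import Data.Empty using (⊥-elim)
open import Function using (_∘_; case_of_)
open import Function.Definitions using (Injective)
open import Relation.Nullary
open import Relation.Nullary.Decidable using (toWitness; dec-true)
open import Relation.Binary.PropositionalEquality hiding (setoid)
open import Algebra.Bundles using (CommutativeMonoid; CommutativeRing)
open import Algebra.Structures using (IsAbelianGroup)
import Algebra.Properties.Semiring.Sum as SemiringSum
import Algebra.Properties.CommutativeMonoid.Sum as MonoidSum
import Algebra.Properties.Ring as RingProperties

-- Counting permutations

-- Three variables per equation force a cubic graph, but the union bound over pairs of sets works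
-- only with several hundred permutations. So every vertex of a random `D`-regular bipartite graph
-- is stretched into a block of `D` positions, each carrying one random edge, and the cycle ties the
-- block together.
--
-- The equations of the two sides are taken with opposite signs. A combination is then a colouring
-- of the vertices, its coefficient at an edge is the difference of the colours of the ends, and a
-- sparse combination is a colouring with few cut edges. Expansion leaves a gap: at most `4σ` or at
-- least `12σ` blocks are coloured nonzero. As twice the first bound stays below the second, the sum
-- of two light combinations is light again whenever it is sparse.
--
-- Without the restriction to light combinations the pairing would vanish identically, since no
-- point satisfies all equations. With it, 1 survives, while the sum over `F` can still be
-- translated: a term that crosses the boundary of lightness belongs to a form in many variables,
-- and polynomials of low degree do not see such forms.

module ΣN = SemiringSum +-*-semiring

ind : Bool → ℕ
ind true  = 1
ind false = 0

bit : {P : Set} → Dec P → ℕ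
bit (yes _) = 1
bit (no _)  = 0

bit-yes : {P : Set} (P? : Dec P) → P → bit P? ≡ 1
bit-yes (yes _) p = refl
bit-yes (no ¬p) p = contradiction p ¬p

bit-no : {P : Set} (P? : Dec P) → ¬ P → bit P? ≡ 0
bit-no (yes p) ¬p = contradiction p ¬p
bit-no (no _)  ¬p = refl

bit-≤ : {P : Set} (P? : Dec P) {a b : ℕ} → (P → a ≤ b) → bit P? * a ≤ b
bit-≤ (yes p) {a} h = subst (_≤ _) (sym (+-identityʳ a)) (h p)
bit-≤ (no _)      h = z≤n

# : ∀ {n} → (Fin n → Bool) → ℕ
# b = ΣN.sum (ind ∘ b)

sum-mono-≤ : ∀ {n} {f g : Fin n → ℕ} → (∀ i → f i ≤ g i) → ΣN.sum f ≤ ΣN.sum g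
sum-mono-≤ {zero}  h = z≤n
sum-mono-≤ {suc n} h = +-mono-≤ (h zero) (sum-mono-≤ (h ∘ suc))

sum-const : ∀ n c → ΣN.sum {n} (λ _ → c) ≡ n * c
sum-const zero    c = refl
sum-const (suc n) c = cong (λ z → c + z) (sum-const n c)

term≤sum : ∀ {n} (f : Fin n → ℕ) i → f i ≤ ΣN.sum f
term≤sum f zero    = m≤m+n _ _
term≤sum f (suc i) = ≤-trans (term≤sum (f ∘ suc) i) (m≤n+m _ _)

ind≤1 : ∀ b → ind b ≤ 1
ind≤1 true  = ≤-refl
ind≤1 false = z≤n

#≤n : ∀ {n} (b : Fin n → Bool) → # b ≤ n
#≤n {n} b = subst (# b ≤_) (trans (sum-const n 1) (*-identityʳ n)) (sum-mono-≤ (ind≤1 ∘ b))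

#+#not : ∀ {n} (b : Fin n → Bool) → # b + # (not ∘ b) ≡ n
#+#not {n} b = trans (sym (ΣN.∑-distrib-+ (ind ∘ b) (ind ∘ not ∘ b)))
  (trans (ΣN.sum-cong-≗ (λ i → lem (b i))) (trans (sum-const n 1) (*-identityʳ n)))
  where
  lem : ∀ x → ind x + ind (not x) ≡ 1
  lem true  = refl
  lem false = refl

-- Sums over lists and over tuples

∑L : ∀ {A : Set} → List A → (A → ℕ) → ℕ
∑L []       F = 0
∑L (x ∷ xs) F = F x + ∑L xs F

module _ {A : Set} where

  ∑L-mono : ∀ (xs : List A) {F G} → (∀ x → F x ≤ G x) → ∑L xs F ≤ ∑L xs G
  ∑L-mono []       h = z≤n
  ∑L-mono (x ∷ xs) h = +-mono-≤ (h x) (∑L-mono xs h)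

  ∑L-cong : ∀ (xs : List A) {F G} → (∀ x → F x ≡ G x) → ∑L xs F ≡ ∑L xs G
  ∑L-cong []       h = refl
  ∑L-cong (x ∷ xs) h = cong₂ _+_ (h x) (∑L-cong xs h)

  ∑L-const : ∀ (xs : List A) c → ∑L xs (λ _ → c) ≡ length xs * c
  ∑L-const []       c = refl
  ∑L-const (x ∷ xs) c = cong (λ z → c + z) (∑L-const xs c)

  ∑L-*ʳ : ∀ (xs : List A) F c → ∑L xs (λ x → F x * c) ≡ ∑L xs F * c
  ∑L-*ʳ []       F c = refl
  ∑L-*ʳ (x ∷ xs) F c = trans (cong (λ z → F x * c + z) (∑L-*ʳ xs F c)) (sym (*-distribʳ-+ c (F x) _))

  ∑L-*ˡ : ∀ (xs : List A) F c → ∑L xs (λ x → c * F x) ≡ c * ∑L xs F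
  ∑L-*ˡ xs F c = trans (∑L-cong xs (λ x → *-comm c (F x))) (trans (∑L-*ʳ xs F c) (*-comm _ c))

  ∑L-+ : ∀ (xs : List A) F G → ∑L xs (λ x → F x + G x) ≡ ∑L xs F + ∑L xs G
  ∑L-+ []       F G = refl
  ∑L-+ (x ∷ xs) F G = trans (cong (λ z → F x + G x + z) (∑L-+ xs F G)) (interchange (F x) (G x) _ _)
    where
    interchange : ∀ a b c d → a + b + (c + d) ≡ a + c + (b + d)
    interchange = solve-∀

  ∑L-++ : ∀ (xs ys : List A) F → ∑L (xs ++ ys) F ≡ ∑L xs F + ∑L ys F
  ∑L-++ []       ys F = refl
  ∑L-++ (x ∷ xs) ys F = trans (cong (λ z → F x + z) (∑L-++ xs ys F)) (sym (+-assoc (F x) _ _))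

  ∑L-tabulate : ∀ {n} (f : Fin n → A) F → ∑L (tabulate f) F ≡ ΣN.sum (F ∘ f)
  ∑L-tabulate {zero}  f F = refl
  ∑L-tabulate {suc n} f F = cong (λ z → F (f zero) + z) (∑L-tabulate (f ∘ suc) F)

  -- The first-moment method: natural numbers with average below 1 include a 0.
  ∑L<length⇒∃zero : ∀ (xs : List A) F → ∑L xs F < length xs → ∃ λ x → F x ≡ 0
  ∑L<length⇒∃zero (x ∷ xs) F lt with F x in eq
  ... | zero  = x , eq
  ... | suc k = ∑L<length⇒∃zero xs F (≤-trans (s≤s (m≤n+m _ k)) (s≤s⁻¹ lt))

∑L-map : ∀ {A B : Set} (f : A → B) xs F → ∑L (map f xs) F ≡ ∑L xs (F ∘ f)
∑L-map f []       F = refl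
∑L-map f (x ∷ xs) F = cong (λ z → F (f x) + z) (∑L-map f xs F)

∑L-comm : ∀ {A B : Set} (xs : List A) (ys : List B) (F : A → B → ℕ) →
          ∑L xs (λ x → ∑L ys (F x)) ≡ ∑L ys (λ y → ∑L xs (λ x → F x y))
∑L-comm []       ys F = sym (trans (∑L-const ys 0) (*-zeroʳ (length ys)))
∑L-comm (x ∷ xs) ys F = trans (cong (λ z → ∑L ys (F x) + z) (∑L-comm xs ys F)) (sym (∑L-+ ys (F x) _))

∑L-cartesianProductWith : ∀ {A B C : Set} (f : A → B → C) xs ys F →
  ∑L (cartesianProductWith f xs ys) F ≡ ∑L xs (λ x → ∑L ys (λ y → F (f x y)))
∑L-cartesianProductWith f []       ys F = refl
∑L-cartesianProductWith f (x ∷ xs) ys F =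
  trans (∑L-++ (map (f x) ys) _ F) (cong₂ _+_ (∑L-map (f x) ys F) (∑L-cartesianProductWith f xs ys F))

length≡∑L : ∀ {A : Set} (xs : List A) → length xs ≡ ∑L xs (λ _ → 1)
length≡∑L xs = sym (trans (∑L-const xs 1) (*-identityʳ _))

vectors : ∀ {A : Set} → List A → ∀ n → List (Vec A n)
vectors xs zero    = [] ∷ []
vectors xs (suc n) = cartesianProductWith _∷_ xs (vectors xs n)

∏ : ∀ {A : Set} → (A → ℕ) → ∀ {n} → Vec A n → ℕ
∏ F []      = 1
∏ F (x ∷ v) = F x * ∏ F v

-- Distributivity; in the union bound it expresses the independence of the `D` permutations.
∑L-∏ : ∀ {A : Set} (xs : List A) F n → ∑L (vectors xs n) (∏ F) ≡ ∑L xs F ^ n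
∑L-∏ xs F zero    = refl
∑L-∏ xs F (suc n) = begin
  ∑L (vectors xs (suc n)) (∏ F)                    ≡⟨ ∑L-cartesianProductWith _∷_ xs (vectors xs n) (∏ F) ⟩
  ∑L xs (λ x → ∑L (vectors xs n) (λ v → F x * ∏ F v)) ≡⟨ ∑L-cong xs (λ x → ∑L-*ˡ (vectors xs n) (∏ F) (F x)) ⟩
  ∑L xs (λ x → F x * ∑L (vectors xs n) (∏ F))      ≡⟨ ∑L-*ʳ xs F _ ⟩
  ∑L xs F * ∑L (vectors xs n) (∏ F)                ≡⟨ cong (∑L xs F *_) (∑L-∏ xs F n) ⟩
  ∑L xs F * ∑L xs F ^ n                            ∎
  where open ≡-Reasoning

∏-const-1 : ∀ {A : Set} {n} (v : Vec A n) → ∏ (λ _ → 1) v ≡ 1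
∏-const-1 []      = refl
∏-const-1 (x ∷ v) = trans (+-identityʳ _) (∏-const-1 v)

length-vectors : ∀ {A : Set} (xs : List A) n → length (vectors xs n) ≡ length xs ^ n
length-vectors xs n = begin
  length (vectors xs n)                    ≡⟨ length≡∑L (vectors xs n) ⟩
  ∑L (vectors xs n) (λ _ → 1)              ≡⟨ ∑L-cong (vectors xs n) (λ v → sym (∏-const-1 v)) ⟩
  ∑L (vectors xs n) (∏ (λ _ → 1))          ≡⟨ ∑L-∏ xs (λ _ → 1) n ⟩
  ∑L xs (λ _ → 1) ^ n                      ≡⟨ cong (_^ n) (sym (length≡∑L xs)) ⟩
  length xs ^ n                            ∎
  where open ≡-Reasoning

bools : List Bool
bools = true ∷ false ∷ []

term≤∑L-bools : ∀ F b → F b ≤ ∑L bools F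
term≤∑L-bools F true  = m≤m+n _ _
term≤∑L-bools F false = ≤-trans (m≤m+n _ 0) (m≤n+m _ (F true))

term≤∑L-subsets : ∀ {n} (F : Vec Bool n → ℕ) v → F v ≤ ∑L (vectors bools n) F
term≤∑L-subsets F []      = m≤m+n _ _
term≤∑L-subsets {suc n} F (b ∷ v) = subst (F (b ∷ v) ≤_)
  (sym (∑L-cartesianProductWith _∷_ bools (vectors bools n) F))
  (≤-trans (term≤∑L-subsets (λ w → F (b ∷ w)) v)
           (term≤∑L-bools (λ c → ∑L (vectors bools n) (λ w → F (c ∷ w))) b))

-- Permutations that map one set into another

permutations : ∀ n → List (Permutation′ n)
permutations zero    = Perm.id ∷ []
permutations (suc n) = cartesianProductWith (Perm.insert zero) (allFin (suc n)) (permutations n)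

∑-permutations : ∀ n F → ∑L (permutations (suc n)) F ≡
                 ΣN.sum (λ i → ∑L (permutations n) (λ π → F (Perm.insert zero i π)))
∑-permutations n F = trans (∑L-cartesianProductWith (Perm.insert zero) (allFin (suc n)) (permutations n) F)
                           (∑L-tabulate (λ i → i) (λ i → ∑L (permutations n) (λ π → F (Perm.insert zero i π))))

length-permutations : ∀ n → length (permutations n) ≡ n !
length-permutations n = trans (length≡∑L (permutations n)) (go n)
  where
  go : ∀ n → ∑L (permutations n) (λ _ → 1) ≡ n !
  go zero    = refl
  go (suc n) = trans (∑-permutations n _) (trans (ΣN.sum-cong-≗ {suc n} (λ _ → go n)) (sum-const (suc n) (n !)))

implies : Bool → Bool → ℕ
implies true  b = ind b
implies false b = 1

-- An indicator with values in ℕ, so that sums of it count and its product along a tuple is the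
-- indicator of the joint event.
inside : ∀ {n} → (Fin n → Bool) → (Fin n → Bool) → ℕ
inside {zero}  S U = 1
inside {suc n} S U = implies (S zero) (U zero) * inside (S ∘ suc) (U ∘ suc)

inside-cong : ∀ {n} (S : Fin n → Bool) {U U′} → (∀ i → U i ≡ U′ i) → inside S U ≡ inside S U′
inside-cong {zero}  S h = refl
inside-cong {suc n} S h = cong₂ (λ b k → implies (S zero) b * k) (h zero) (inside-cong (S ∘ suc) (h ∘ suc))

inside-⊆ : ∀ {n} (S U : Fin n → Bool) → (∀ i → S i ≡ true → U i ≡ true) → inside S U ≡ 1
inside-⊆ {zero}  S U h = refl
inside-⊆ {suc n} S U h = cong₂ _*_ (lem (S zero) (U zero) (h zero)) (inside-⊆ (S ∘ suc) (U ∘ suc) (h ∘ suc))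
  where
  lem : ∀ a b → (a ≡ true → b ≡ true) → implies a b ≡ 1
  lem true  b h = cong ind (h refl)
  lem false b h = refl

maps : ∀ {n} → (Fin n → Bool) → (Fin n → Bool) → Permutation′ n → ℕ
maps S T π = inside S (λ i → T (π ⟨$⟩ʳ i))

maps-insert : ∀ {n} (S T : Fin (suc n) → Bool) i π →
  maps S T (Perm.insert zero i π) ≡ implies (S zero) (T i) * maps (S ∘ suc) (T ∘ punchIn i) π
maps-insert S T i π = cong (implies (S zero) (T i) *_)
  (inside-cong (S ∘ suc) (λ k → cong T (Perm.insert-punchIn zero i π k)))

*-interchange : ∀ a b c d → a * b * (c * d) ≡ a * c * (b * d)
*-interchange = solve-∀

-- The falling factorial t(t-1)...(t-s+1). Truncation is harmless: for s > t a factor 0 occurs.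
fall : ℕ → ℕ → ℕ
fall t zero    = 1
fall t (suc s) = t * fall (t ∸ 1) s

-- Both sides are the product t(t-1)...(t-s), split off at its first or at its last factor.
fall-shift : ∀ t s → t * fall (t ∸ 1) s ≡ fall t s * (t ∸ s)
fall-shift t zero    = *-comm t 1
fall-shift t (suc s) = begin
  t * ((t ∸ 1) * fall (t ∸ 1 ∸ 1) s)  ≡⟨ cong (t *_) (fall-shift (t ∸ 1) s) ⟩
  t * (fall (t ∸ 1) s * (t ∸ 1 ∸ s))  ≡⟨ sym (*-assoc t (fall (t ∸ 1) s) _) ⟩
  t * fall (t ∸ 1) s * (t ∸ 1 ∸ s)    ≡⟨ cong (t * fall (t ∸ 1) s *_) (∸-+-assoc t 1 s) ⟩
  t * fall (t ∸ 1) s * (t ∸ suc s)    ∎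
  where open ≡-Reasoning

fall-< : ∀ t s → t < s → fall t s ≡ 0
fall-< zero    (suc s) lt = refl
fall-< (suc t) (suc s) lt = trans (cong (suc t *_) (fall-< t s (s≤s⁻¹ lt))) (*-zeroʳ (suc t))

fall-! : ∀ n s → s ≤ n → fall n s * (n ∸ s) ! ≡ n !
fall-! n       zero    le = +-identityʳ _
fall-! (suc n) (suc s) le = trans (*-assoc (suc n) (fall n s) _) (cong (suc n *_) (fall-! n s (s≤s⁻¹ le)))

#-punchIn : ∀ {n} (T : Fin (suc n) → Bool) i → # T ≡ ind (T i) + # (T ∘ punchIn i)
#-punchIn T i = ΣN.sum-remove {i = i} (ind ∘ T)

-- Fix the image of 0. If 0 lies in S, the image has t choices and leaves t-1 places for the rest.
-- Otherwise the t images inside T leave t-1 places and the others leave t; `fall-shift` collects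
-- both cases into `fall t s` times (t-s) + (n+1-t) = n+1-s.
count-maps : ∀ n (S T : Fin n → Bool) →
  ∑L (permutations n) (maps S T) ≡ fall (# T) (# S) * (n ∸ # S) !
count-maps zero    S T = refl
count-maps (suc n) S T = begin
  ∑L (permutations (suc n)) (maps S T)
    ≡⟨ ∑-permutations n (maps S T) ⟩
  ΣN.sum (λ i → ∑L (permutations n) (λ π → maps S T (Perm.insert zero i π)))
    ≡⟨ ΣN.sum-cong-≗ (λ i → trans (∑L-cong (permutations n) (maps-insert S T i))
         (trans (∑L-*ˡ (permutations n) _ (implies (S zero) (T i)))
                (cong (implies (S zero) (T i) *_) (count-maps n (S ∘ suc) (T ∘ punchIn i))))) ⟩
  ΣN.sum (λ i → implies (S zero) (T i) * (fall (# (T ∘ punchIn i)) s * (n ∸ s) !))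
    ≡⟨ step (S zero) ⟩
  fall (# T) (ind (S zero) + s) * (suc n ∸ (ind (S zero) + s)) ! ∎
  where
  open ≡-Reasoning
  s = # (S ∘ suc)
  t = # T

  t∖ : ∀ i → T i ≡ true → # (T ∘ punchIn i) ≡ t ∸ 1
  t∖ i eq = sym (cong (_∸ 1) (trans (#-punchIn T i) (cong (λ b → ind b + # (T ∘ punchIn i)) eq)))

  hit : ∀ i → ind (T i) * (fall (# (T ∘ punchIn i)) s * (n ∸ s) !) ≡ ind (T i) * (fall (t ∸ 1) s * (n ∸ s) !)
  hit i with T i in eq
  ... | true  = cong (λ k → 1 * (fall k s * (n ∸ s) !)) (t∖ i eq)
  ... | false = refl

  miss : ∀ i → 1 * (fall (# (T ∘ punchIn i)) s * (n ∸ s) !) ≡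
               (ind (T i) * fall (t ∸ 1) s + ind (not (T i)) * fall t s) * (n ∸ s) !
  miss i with T i in eq
  ... | true  = trans (*-identityˡ _) (cong (_* (n ∸ s) !)
                  (trans (cong (λ k → fall k s) (t∖ i eq)) (lem (fall (t ∸ 1) s))))
    where
    lem : ∀ a → a ≡ 1 * a + 0
    lem = solve-∀
  ... | false = trans (*-identityˡ _) (cong (_* (n ∸ s) !)
                  (trans (cong (λ k → fall k s)
                    (sym (trans (#-punchIn T i) (cong (λ b → ind b + # (T ∘ punchIn i)) eq))))
                    (sym (*-identityˡ _))))

  split : ∀ (a b : ℕ) → fall a s * (a ∸ s) + b * fall a s ≡ fall a s * ((a + b) ∸ s)
  split a b with s ≤? a
  ... | yes s≤a = trans (cong (λ z → fall a s * (a ∸ s) + z) (*-comm b (fall a s)))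
                    (trans (sym (*-distribˡ-+ (fall a s) (a ∸ s) b))
                      (cong (fall a s *_) (sym (trans (cong (_∸ s) (+-comm a b))
                        (trans (+-∸-assoc b s≤a) (+-comm b (a ∸ s)))))))
  -- Here `a ∸ s` is truncated, but its factor `fall a s` is 0.
  ... | no  s≰a rewrite fall-< a s (≰⇒> s≰a) = *-zeroʳ b

  sums : ∀ (g h : ℕ) → ΣN.sum (λ i → ind (T i) * g + ind (not (T i)) * h) ≡ t * g + # (not ∘ T) * h
  sums g h = trans (ΣN.∑-distrib-+ (λ i → ind (T i) * g) (λ i → ind (not (T i)) * h))
    (cong₂ _+_ (sym (ΣN.*-distribʳ-sum g (ind ∘ T))) (sym (ΣN.*-distribʳ-sum h (ind ∘ not ∘ T))))

  step : ∀ b → ΣN.sum (λ i → implies b (T i) * (fall (# (T ∘ punchIn i)) s * (n ∸ s) !)) ≡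
               fall t (ind b + s) * (suc n ∸ (ind b + s)) !
  step true = begin
    ΣN.sum (λ i → ind (T i) * (fall (# (T ∘ punchIn i)) s * (n ∸ s) !)) ≡⟨ ΣN.sum-cong-≗ hit ⟩
    ΣN.sum (λ i → ind (T i) * (fall (t ∸ 1) s * (n ∸ s) !))
      ≡⟨ sym (ΣN.*-distribʳ-sum (fall (t ∸ 1) s * (n ∸ s) !) (ind ∘ T)) ⟩
    t * (fall (t ∸ 1) s * (n ∸ s) !)   ≡⟨ sym (*-assoc t _ _) ⟩
    t * fall (t ∸ 1) s * (n ∸ s) !     ∎
  step false = begin
    ΣN.sum (λ i → 1 * (fall (# (T ∘ punchIn i)) s * (n ∸ s) !)) ≡⟨ ΣN.sum-cong-≗ miss ⟩
    ΣN.sum (λ i → (ind (T i) * fall (t ∸ 1) s + ind (not (T i)) * fall t s) * (n ∸ s) !)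
      ≡⟨ sym (ΣN.*-distribʳ-sum ((n ∸ s) !) (λ i → ind (T i) * fall (t ∸ 1) s + ind (not (T i)) * fall t s)) ⟩
    ΣN.sum (λ i → ind (T i) * fall (t ∸ 1) s + ind (not (T i)) * fall t s) * (n ∸ s) !
      ≡⟨ cong (_* (n ∸ s) !) (sums (fall (t ∸ 1) s) (fall t s)) ⟩
    (t * fall (t ∸ 1) s + # (not ∘ T) * fall t s) * (n ∸ s) !
      ≡⟨ cong (λ k → (k + # (not ∘ T) * fall t s) * (n ∸ s) !) (fall-shift t s) ⟩
    (fall t s * (t ∸ s) + # (not ∘ T) * fall t s) * (n ∸ s) !
      ≡⟨ cong (_* (n ∸ s) !) (trans (split t (# (not ∘ T))) (cong (λ k → fall t s * (k ∸ s)) (#+#not T))) ⟩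
    fall t s * (suc n ∸ s) * (n ∸ s) !  ≡⟨ *-assoc (fall t s) _ _ ⟩
    fall t s * ((suc n ∸ s) * (n ∸ s) !) ≡⟨ cong (fall t s *_) fact ⟩
    fall t s * (suc n ∸ s) ! ∎
    where
    fact : (suc n ∸ s) * (n ∸ s) ! ≡ (suc n ∸ s) !
    fact rewrite +-∸-assoc 1 (#≤n (S ∘ suc)) = refl

-- Factor by factor, (t-i)/(n-i) ≤ t/n ≤ M/N. The hypothesis t N ≤ n M survives lowering t and n by
-- one because M ≤ N.
fall-ratio : ∀ M N → M ≤ N → ∀ s t n → t * N ≤ n * M → fall t s * N ^ s ≤ fall n s * M ^ s
fall-ratio M N M≤N zero    t n le = ≤-refl
fall-ratio M N M≤N (suc s) t n le = begin
  t * fall (t ∸ 1) s * (N * N ^ s)     ≡⟨ *-interchange t (fall (t ∸ 1) s) N (N ^ s) ⟩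
  t * N * (fall (t ∸ 1) s * N ^ s)     ≤⟨ *-mono-≤ le (fall-ratio M N M≤N s (t ∸ 1) (n ∸ 1) le′) ⟩
  n * M * (fall (n ∸ 1) s * M ^ s)     ≡⟨ sym (*-interchange n (fall (n ∸ 1) s) M (M ^ s)) ⟩
  n * fall (n ∸ 1) s * (M * M ^ s)     ∎
  where
  open ≤-Reasoning
  le′ : (t ∸ 1) * N ≤ (n ∸ 1) * M
  le′ = subst₂ _≤_ (sym (*-distribʳ-∸ N t 1)) (sym (*-distribʳ-∸ M n 1))
          (∸-mono le (subst₂ _≤_ (sym (+-identityʳ M)) (sym (+-identityʳ N)) M≤N))

pow-swap : ∀ a b c → (a ^ b) ^ c ≡ (a ^ c) ^ b
pow-swap a b c = trans (^-*-assoc a b c) (trans (cong (a ^_) (*-comm b c)) (sym (^-*-assoc a c b)))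

^-distribʳ-* : ∀ a b n → (a * b) ^ n ≡ a ^ n * b ^ n
^-distribʳ-* a b zero    = refl
^-distribʳ-* a b (suc n) = trans (cong (a * b *_) (^-distribʳ-* a b n)) (*-interchange a b (a ^ n) (b ^ n))

∏≡1 : ∀ {A : Set} (F : A → ℕ) {n} (v : Vec A n) → (∀ i → F (Vec.lookup v i) ≡ 1) → ∏ F v ≡ 1
∏≡1 F []      h = refl
∏≡1 F (x ∷ v) h = cong₂ _*_ (h zero) (∏≡1 F v (h ∘ suc))

#-cong : ∀ {n} {b c : Fin n → Bool} → (∀ i → b i ≡ c i) → # b ≡ # c
#-cong h = ΣN.sum-cong-≗ (λ i → cong ind (h i))

-- There are 4^n pairs (S , T), and each is bad for at most a fraction (15/16)^(σD) of the D-tuples of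
-- permutations.  The variable b stands for 2^16, whose numeral must not be unfolded.
module Expander (D σ : ℕ) (1≤σ : 1 ≤ σ) (b : ℕ) (b≡2^16 : b ≡ 2 ^ 16) (large : (b * b) * 15 ^ D < 16 ^ D) where

  n : ℕ
  n = 16 * σ

  few-maps : ∀ (S T : Fin n → Bool) → σ ≤ # S → # T ≤ 15 * σ →
             ∑L (permutations n) (maps S T) * 16 ^ σ ≤ n ! * 15 ^ σ
  -- The ratio bound has exponent `s`, the size of S. Only σ of these factors are kept, so that the
  -- bound is the same for all S; the other `k` are absorbed by cancelling 16^k.
  few-maps S T σ≤s t≤15σ = *-cancelʳ-≤ _ _ (16 ^ k) {{m^n≢0 16 k}} (begin
    ∑L (permutations n) (maps S T) * 16 ^ σ * 16 ^ k   ≡⟨ *-assoc (∑L (permutations n) (maps S T)) _ _ ⟩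
    ∑L (permutations n) (maps S T) * (16 ^ σ * 16 ^ k) ≡⟨ cong₂ _*_ (count-maps n S T) (sym (pow 16)) ⟩
    fall t s * (n ∸ s) ! * 16 ^ s                      ≡⟨ swap (fall t s) _ _ ⟩
    fall t s * 16 ^ s * (n ∸ s) !                      ≤⟨ *-monoˡ-≤ _ (fall-ratio 15 16 (n≤1+n 15) s t n t16≤15n) ⟩
    fall n s * 15 ^ s * (n ∸ s) !                      ≡⟨ swap (fall n s) _ _ ⟩
    fall n s * (n ∸ s) ! * 15 ^ s                      ≡⟨ cong₂ _*_ (fall-! n s (#≤n S)) (pow 15) ⟩
    n ! * (15 ^ σ * 15 ^ k)                            ≤⟨ *-monoʳ-≤ (n !) (*-monoʳ-≤ (15 ^ σ) (^-monoˡ-≤ k (n≤1+n 15))) ⟩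
    n ! * (15 ^ σ * 16 ^ k)                            ≡⟨ sym (*-assoc (n !) _ _) ⟩
    n ! * 15 ^ σ * 16 ^ k                              ∎)
    where
    open ≤-Reasoning
    s = # S
    t = # T
    k = s ∸ σ
    pow : ∀ m → m ^ s ≡ m ^ σ * m ^ k
    pow m = trans (cong (m ^_) (sym (m+[n∸m]≡n σ≤s))) (^-distribˡ-+-* m σ k)
    swap : ∀ a b c → a * b * c ≡ a * c * b
    swap = solve-∀
    t16≤15n : t * 16 ≤ n * 15
    t16≤15n = ≤-trans (*-monoˡ-≤ 16 t≤15σ) (≤-reflexive (lem σ))
      where
      lem : ∀ σ → 15 * σ * 16 ≡ 16 * σ * 15
      lem = solve-∀

  subsets : List (Vec Bool n)
  subsets = vectors bools n

  tuples : List (Vec (Permutation′ n) D)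
  tuples = vectors (permutations n) D

  size? : ∀ (S T : Vec Bool n) → Dec (σ ≤ # (Vec.lookup S) × # (Vec.lookup T) ≤ 15 * σ)
  size? S T = σ ≤? # (Vec.lookup S) ×-dec # (Vec.lookup T) ≤? 15 * σ

  size : Vec Bool n → Vec Bool n → ℕ
  size S T = bit (size? S T)

  mapsᵥ : Vec Bool n → Vec Bool n → Permutation′ n → ℕ
  mapsᵥ S T = maps (Vec.lookup S) (Vec.lookup T)

  bad : Vec (Permutation′ n) D → ℕ
  bad πs = ∑L subsets (λ S → ∑L subsets (λ T → size S T * ∏ (mapsᵥ S T) πs))

  bound : ∀ S T → ∑L tuples (λ πs → size S T * ∏ (mapsᵥ S T) πs) * (16 ^ σ) ^ D ≤ (n ! * 15 ^ σ) ^ D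
  bound S T = begin
    ∑L tuples (λ πs → size S T * ∏ (mapsᵥ S T) πs) * W ≡⟨ cong (_* W) (∑L-*ˡ tuples (∏ (mapsᵥ S T)) (size S T)) ⟩
    size S T * ∑L tuples (∏ (mapsᵥ S T)) * W            ≡⟨ *-assoc (size S T) _ W ⟩
    size S T * (∑L tuples (∏ (mapsᵥ S T)) * W)          ≤⟨ bit-≤ (size? S T) big ⟩
    (n ! * 15 ^ σ) ^ D                                  ∎
    where
    open ≤-Reasoning
    W = (16 ^ σ) ^ D
    K = ∑L (permutations n) (mapsᵥ S T)
    big : σ ≤ # (Vec.lookup S) × # (Vec.lookup T) ≤ 15 * σ → ∑L tuples (∏ (mapsᵥ S T)) * W ≤ (n ! * 15 ^ σ) ^ D
    big (σ≤s , t≤) = begin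
      ∑L tuples (∏ (mapsᵥ S T)) * W ≡⟨ cong (_* W) (∑L-∏ (permutations n) (mapsᵥ S T) D) ⟩
      K ^ D * W                     ≡⟨ sym (^-distribʳ-* K (16 ^ σ) D) ⟩
      (K * 16 ^ σ) ^ D              ≤⟨ ^-monoˡ-≤ D (few-maps _ _ σ≤s t≤) ⟩
      (n ! * 15 ^ σ) ^ D            ∎

  total : ∑L tuples bad * (16 ^ σ) ^ D ≤ 2 ^ n * (2 ^ n * (n ! * 15 ^ σ) ^ D)
  total = begin
    ∑L tuples bad * W
      ≡⟨ cong (_* W) (∑L-comm tuples subsets (λ πs S → ∑L subsets (λ T → size S T * ∏ (mapsᵥ S T) πs))) ⟩
    ∑L subsets (λ S → ∑L tuples (λ πs → ∑L subsets (λ T → size S T * ∏ (mapsᵥ S T) πs))) * W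
      ≡⟨ sym (∑L-*ʳ subsets _ W) ⟩
    ∑L subsets (λ S → ∑L tuples (λ πs → ∑L subsets (λ T → size S T * ∏ (mapsᵥ S T) πs)) * W)
      ≡⟨ ∑L-cong subsets (λ S → cong (_* W) (∑L-comm tuples subsets (λ πs T → size S T * ∏ (mapsᵥ S T) πs))) ⟩
    ∑L subsets (λ S → ∑L subsets (λ T → ∑L tuples (λ πs → size S T * ∏ (mapsᵥ S T) πs)) * W)
      ≤⟨ ∑L-mono subsets (λ S → ≤-trans (≤-reflexive (sym (∑L-*ʳ subsets _ W))) (∑L-mono subsets (bound S))) ⟩
    ∑L subsets (λ S → ∑L subsets (λ T → (n ! * 15 ^ σ) ^ D))
      ≡⟨ ∑L-cong subsets (λ _ → ∑L-const subsets _) ⟩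
    ∑L subsets (λ S → length subsets * (n ! * 15 ^ σ) ^ D)
      ≡⟨ ∑L-const subsets _ ⟩
    length subsets * (length subsets * (n ! * 15 ^ σ) ^ D)
      ≡⟨ cong (λ l → l * (l * (n ! * 15 ^ σ) ^ D)) (length-vectors bools n) ⟩
    2 ^ n * (2 ^ n * (n ! * 15 ^ σ) ^ D) ∎
    where
    open ≤-Reasoning
    W = (16 ^ σ) ^ D

  few-bad : ∑L tuples bad < length tuples
  few-bad = subst (∑L tuples bad <_)
    (sym (trans (length-vectors (permutations n) D) (cong (_^ D) (length-permutations n))))
    (*-cancelʳ-< ((16 ^ σ) ^ D) (∑L tuples bad) ((n !) ^ D) (begin-strict
    ∑L tuples bad * (16 ^ σ) ^ D             ≤⟨ total ⟩
    2 ^ n * (2 ^ n * (n ! * 15 ^ σ) ^ D)     ≡⟨ cong (λ k → 2 ^ n * (2 ^ n * k)) (^-distribʳ-* (n !) (15 ^ σ) D) ⟩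
    2 ^ n * (2 ^ n * ((n !) ^ D * (15 ^ σ) ^ D)) ≡⟨ rearrange (2 ^ n) ((n !) ^ D) _ ⟩
    (n !) ^ D * (2 ^ n * 2 ^ n * (15 ^ σ) ^ D)
      ≡⟨ cong (λ k → (n !) ^ D * k) powers ⟩
    (n !) ^ D * ((b * b) * 15 ^ D) ^ σ
      <⟨ *-monoʳ-< ((n !) ^ D) {{m^n≢0 (n !) D {{n !≢0}}}} (^-monoˡ-< σ {{>-nonZero 1≤σ}} large) ⟩
    (n !) ^ D * (16 ^ D) ^ σ                 ≡⟨ cong ((n !) ^ D *_) (pow-swap 16 D σ) ⟩
    (n !) ^ D * (16 ^ σ) ^ D                 ∎))
    where
    open ≤-Reasoning
    rearrange : ∀ a b c → a * (a * (b * c)) ≡ b * (a * a * c)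
    rearrange = solve-∀
    -- Since n = 16σ, the number of pairs is a σ-th power too, and `large` only has to be raised to
    -- the power σ.
    powers : 2 ^ n * 2 ^ n * (15 ^ σ) ^ D ≡ ((b * b) * 15 ^ D) ^ σ
    powers = sym (trans (^-distribʳ-* (b * b) (15 ^ D) σ)
      (cong₂ _*_ (trans (^-distribʳ-* b b σ) (cong₂ _*_ b^σ b^σ)) (pow-swap 15 D σ)))
      where
      b^σ : b ^ σ ≡ 2 ^ n
      b^σ = trans (cong (_^ σ) b≡2^16) (^-*-assoc 2 16 σ)

  expander : Σ (Fin D → Permutation′ n) λ π → ∀ (S T : Fin n → Bool) → σ ≤ # S → # T ≤ 15 * σ →
             ¬ (∀ i v → S v ≡ true → T (π i ⟨$⟩ʳ v) ≡ true)
  expander with ∑L<length⇒∃zero tuples bad few-bad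
  ... | πs , bad≡0 = Vec.lookup πs , good
    where
    good : ∀ S T → σ ≤ # S → # T ≤ 15 * σ → ¬ (∀ i v → S v ≡ true → T (Vec.lookup πs i ⟨$⟩ʳ v) ≡ true)
    -- A pair against the claim would contribute a term 1 to a sum that is 0.
    good S T σ≤s t≤ incl = 1+n≰n (begin
      1                                                         ≡⟨ sym (cong₂ _*_ size≡1 maps≡1) ⟩
      size S′ T′ * ∏ (mapsᵥ S′ T′) πs                           ≤⟨ term≤∑L-subsets (λ T → size S′ T * ∏ (mapsᵥ S′ T) πs) T′ ⟩
      ∑L subsets (λ T → size S′ T * ∏ (mapsᵥ S′ T) πs)          ≤⟨ term≤∑L-subsets (λ S → ∑L subsets (λ T → size S T * ∏ (mapsᵥ S T) πs)) S′ ⟩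
      bad πs                                                    ≡⟨ bad≡0 ⟩
      0                                                         ∎)
      where
      open ≤-Reasoning
      S′ T′ : Vec Bool n
      S′ = Vec.tabulate S
      T′ = Vec.tabulate T
      size≡1 : size S′ T′ ≡ 1
      size≡1 = bit-yes (size? S′ T′) (subst (σ ≤_) (sym (#-cong (lookup∘tabulate S))) σ≤s ,
                                      subst (_≤ 15 * σ) (sym (#-cong (lookup∘tabulate T))) t≤)
      maps≡1 : ∏ (mapsᵥ S′ T′) πs ≡ 1
      maps≡1 = ∏≡1 (mapsᵥ S′ T′) πs (λ i → inside-⊆ _ _ (λ v Sv →
        trans (lookup∘tabulate T _) (incl i v (trans (sym (lookup∘tabulate S v)) Sv))))

-- The graph

module CombineSum {c ℓ} (M : CommutativeMonoid c ℓ) where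
  open CommutativeMonoid M renaming (_∙_ to _⊹_)
  open MonoidSum M

  sum-↑ : ∀ m n (f : Fin (m + n) → Carrier) → sum f ≈ sum (λ i → f (i ↑ˡ n)) ⊹ sum (λ j → f (m ↑ʳ j))
  sum-↑ zero    n f = CommutativeMonoid.sym M (identityˡ _)
  sum-↑ (suc m) n f = CommutativeMonoid.trans M (∙-congˡ (sum-↑ m n (f ∘ suc)))
                        (CommutativeMonoid.sym M (assoc _ _ _))

  sum-combine : ∀ m n (f : Fin (m * n) → Carrier) → sum f ≈ sum (λ i → sum (λ j → f (combine {m} {n} i j)))
  sum-combine zero    n f = CommutativeMonoid.refl M
  sum-combine (suc m) n f = CommutativeMonoid.trans M (sum-↑ n (m * n) f)
                              (∙-congˡ (sum-combine m n (f ∘ (n ↑ʳ_))))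

module ΣN⁺ = CombineSum +-0-commutativeMonoid

punchIn-fromℕ : ∀ n (k : Fin n) → punchIn (fromℕ n) k ≡ inject₁ k
punchIn-fromℕ (suc n) zero    = refl
punchIn-fromℕ (suc n) (suc k) = cong suc (punchIn-fromℕ n k)

-- The last position goes to 0; removing the last argument and the value 0 leaves the identity,
-- which therefore moves every other position up by one.
cycle : ∀ n → Permutation′ n
cycle zero    = Perm.id
cycle (suc n) = Perm.insert (fromℕ n) zero Perm.id

cycle-suc : ∀ n (q q′ : Fin n) → toℕ q′ ≡ suc (toℕ q) → cycle n ⟨$⟩ʳ q ≡ q′
cycle-suc (suc n) q (suc k) eq = trans
  (cong (cycle (suc n) ⟨$⟩ʳ_) (trans (Finₚ.toℕ-injective (trans (sym (suc-injective eq)) (sym (Finₚ.toℕ-inject₁ k))))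
                                     (sym (punchIn-fromℕ n k))))
  (Perm.insert-punchIn (fromℕ n) zero Perm.id k)

blockwise : ∀ {k D} → (Fin D → Permutation′ k) → Permutation′ (k * D)
blockwise {k} {D} π = Perm.permutation (act (λ i → π i ⟨$⟩ʳ_)) (act (λ i → π i ⟨$⟩ˡ_))
  (act-inverse (λ i → π i ⟨$⟩ʳ_) (λ i → π i ⟨$⟩ˡ_) (λ i v → Perm.inverseʳ (π i)))
  (act-inverse (λ i → π i ⟨$⟩ˡ_) (λ i → π i ⟨$⟩ʳ_) (λ i v → Perm.inverseˡ (π i)))
  where
  move : (Fin D → Fin k → Fin k) → Fin k × Fin D → Fin (k * D)
  move f (v , i) = combine (f i v) i

  act : (Fin D → Fin k → Fin k) → Fin (k * D) → Fin (k * D)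
  act f q = move f (remQuot {k} D q)

  act-inverse : ∀ f g → (∀ i v → f i (g i v) ≡ v) → ∀ q → act f (act g q) ≡ q
  act-inverse f g h q = begin
    move f (remQuot {k} D (combine (g i v) i))  ≡⟨ cong (move f) (Finₚ.remQuot-combine {k} {D} (g i v) i) ⟩
    combine (f i (g i v)) i                     ≡⟨ cong (λ w → combine w i) (h i v) ⟩
    combine v i                                 ≡⟨ Finₚ.combine-remQuot {k} D q ⟩
    q                                           ∎
    where
    open ≡-Reasoning
    v = proj₁ (remQuot {k} D q)
    i = proj₂ (remQuot {k} D q)

blockwise-combine : ∀ {k D} (π : Fin D → Permutation′ k) v i →
                    blockwise π ⟨$⟩ʳ combine v i ≡ combine (π i ⟨$⟩ʳ v) i
blockwise-combine {k} {D} π v i =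
  cong (λ (w , j) → combine (π j ⟨$⟩ʳ w) j) (Finₚ.remQuot-combine {k} {D} v i)

constant : ∀ {A : Set} {n} (φ : Fin n → A) → (∀ q q′ → toℕ q′ ≡ suc (toℕ q) → φ q′ ≡ φ q) → ∀ q q′ → φ q ≡ φ q′
constant {n = suc n} φ step q q′ = trans (go φ step q) (sym (go φ step q′))
  where
  go : ∀ {A : Set} {n} (φ : Fin (suc n) → A) → (∀ q q′ → toℕ q′ ≡ suc (toℕ q) → φ q′ ≡ φ q) → ∀ q → φ q ≡ φ zero
  go         φ step zero    = refl
  go {n = suc n} φ step (suc q) = trans (go (φ ∘ suc) (λ q q′ eq → step (suc q) (suc q′) (cong suc eq)) q)
                                        (step zero (suc zero) refl)

nonzero : ∀ {n} → Fin n → Bool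
nonzero zero    = false
nonzero (suc _) = true

module Graph (σ D′ : ℕ) (1≤σ : 1 ≤ σ) (π : Fin (suc D′) → Permutation′ (16 * σ))
  (expands : ∀ (S T : Fin (16 * σ) → Bool) → σ ≤ # S → # T ≤ 15 * σ →
             ¬ (∀ i v → S v ≡ true → T (π i ⟨$⟩ʳ v) ≡ true)) where

  D k L : ℕ
  D = suc D′
  k = 16 * σ
  L = k * D

  -- Identity edges join the out-vertex and the in-vertex of one position, cycle edges lead to the
  -- next position; together they form a Hamiltonian cycle. The third permutation carries the
  -- expander.
  τ : Fin 3 → Permutation′ L
  τ zero          = Perm.id
  τ (suc zero)    = cycle L
  τ (suc (suc _)) = blockwise π

  main : Fin k → Fin L
  main v = combine v zero

  module Colouring {p : ℕ} (F G : Fin L → Fin p) where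

    broken : Fin 3 → Fin L → ℕ
    broken i q = bit (¬? (F q Finₚ.≟ G (τ i ⟨$⟩ʳ q)))

    cut : ℕ
    cut = ΣN.sum (λ i → ΣN.sum (broken i))

    blockCut : Fin k → ℕ
    blockCut v = ΣN.sum (λ i → ΣN.sum (λ j → broken i (combine {k} {D} v j)))

    ∑blockCut : ΣN.sum blockCut ≡ cut
    ∑blockCut = trans (ΣN.∑-comm {k} {3} (λ v i → ΣN.sum (λ j → broken i (combine {k} {D} v j))))
                      (ΣN.sum-cong-≗ (λ i → sym (ΣN⁺.sum-combine k D (broken i))))

    unbroken : ∀ i q → broken i q ≤ 0 → F q ≡ G (τ i ⟨$⟩ʳ q)
    unbroken i q le with F q Finₚ.≟ G (τ i ⟨$⟩ʳ q)
    ... | yes eq = eq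

    good : Fin k → Bool
    good v = does (blockCut v ≟ 0)

    bad≤cut : # (not ∘ good) ≤ cut
    bad≤cut = ≤-trans (sum-mono-≤ (λ v → lem (blockCut v))) (≤-reflexive ∑blockCut)
      where
      lem : ∀ m → ind (not (does (m ≟ 0))) ≤ m
      lem zero    = z≤n
      lem (suc m) = s≤s z≤n

    module Block {v} (gv : good v ≡ true) where

      blockCut≡0 : blockCut v ≡ 0
      blockCut≡0 = zero? (blockCut v) gv
        where
        zero? : ∀ m → does (m ≟ 0) ≡ true → m ≡ 0
        zero? zero _ = refl

      uncut : ∀ i j → F (combine v j) ≡ G (τ i ⟨$⟩ʳ combine v j)
      uncut i j = unbroken i (combine v j) (≤-trans (term≤sum (λ j → broken i (combine {k} {D} v j)) j)
        (≤-trans (term≤sum (λ i → ΣN.sum (λ j → broken i (combine {k} {D} v j))) i) (≤-reflexive blockCut≡0)))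

      -- Go from a position to the next along a cycle edge and return from the in-vertex along an
      -- identity edge. Both edges start at out-vertices of the block, so neither is broken.
      blockConstant : ∀ j → F (combine v j) ≡ F (main v)
      blockConstant j = constant (λ j → F (combine v j)) step j zero
        where
        step : ∀ j j′ → toℕ j′ ≡ suc (toℕ j) → F (combine v j′) ≡ F (combine v j)
        step j j′ eq = trans (uncut zero j′) (trans
          (cong G (sym (cycle-suc L (combine v j) (combine v j′) next)))
          (sym (uncut (suc zero) j)))
          where
          next : toℕ (combine v j′) ≡ suc (toℕ (combine v j))
          next = trans (Finₚ.toℕ-combine v j′) (trans (cong (λ z → D * toℕ v + z) eq)
                   (trans (+-suc (D * toℕ v) (toℕ j)) (cong suc (sym (Finₚ.toℕ-combine v j)))))

    module Small (cut≤σ : cut ≤ σ) where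

      bad≤σ : # (not ∘ good) ≤ σ
      bad≤σ = ≤-trans bad≤cut cut≤σ

      -- Expansion is applied to S, the good blocks of U, and T, which is U together with the bad
      -- blocks, since nothing is known about the colour of a bad image. At most σ blocks are bad,
      -- so a size of U from 2σ to 14σ would give S at least σ and T at most 15σ elements.
      dichotomy : ∀ (β : Fin p → Bool) → # (β ∘ F ∘ main) < 2 * σ ⊎ 14 * σ < # (β ∘ F ∘ main)
      dichotomy β with # (β ∘ F ∘ main) <? 2 * σ | 14 * σ <? # (β ∘ F ∘ main)
      ... | yes lt | _      = inj₁ lt
      ... | no _   | yes gt = inj₂ gt
      ... | no ≮   | no ≯   = ⊥-elim (expands S T σ≤S T≤15σ closed)
        where
        U S T : Fin k → Bool
        U = β ∘ F ∘ main
        S v = good v ∧ U v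
        T v = not (good v) ∨ U v

        σ≤S : σ ≤ # S
        σ≤S = +-cancelʳ-≤ σ σ (# S) (begin
          σ + σ                  ≡⟨ cong (λ z → σ + z) (sym (+-identityʳ σ)) ⟩
          2 * σ                  ≤⟨ ≮⇒≥ ≮ ⟩
          # U                    ≤⟨ sum-mono-≤ (λ v → lem (good v) (U v)) ⟩
          ΣN.sum (λ v → ind (S v) + ind (not (good v))) ≡⟨ ΣN.∑-distrib-+ (ind ∘ S) (ind ∘ not ∘ good) ⟩
          # S + # (not ∘ good)   ≤⟨ +-monoʳ-≤ (# S) bad≤σ ⟩
          # S + σ                ∎)
          where
          open ≤-Reasoning
          lem : ∀ a b → ind b ≤ ind (a ∧ b) + ind (not a)
          lem true  b = m≤m+n _ _
          lem false b = ind≤1 b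

        T≤15σ : # T ≤ 15 * σ
        T≤15σ = begin
          # T                    ≤⟨ sum-mono-≤ (λ v → lem (good v) (U v)) ⟩
          ΣN.sum (λ v → ind (not (good v)) + ind (U v)) ≡⟨ ΣN.∑-distrib-+ (ind ∘ not ∘ good) (ind ∘ U) ⟩
          # (not ∘ good) + # U   ≤⟨ +-mono-≤ bad≤σ (≮⇒≥ ≯) ⟩
          15 * σ                 ∎
          where
          open ≤-Reasoning
          lem : ∀ a b → ind (not a ∨ b) ≤ ind (not a) + ind b
          lem true  b = ≤-refl
          lem false b = m≤m+n 1 _

        closed : ∀ i v → S v ≡ true → T (π i ⟨$⟩ʳ v) ≡ true
        closed i v Sv with good v in gv | U v in Uv
        ... | true | true with good (π i ⟨$⟩ʳ v) in gw
        ...   | false = refl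
        ...   | true  = trans (cong β (sym same)) Uv
          where
          w = π i ⟨$⟩ʳ v
          -- The path runs inside block v to its i-th position, over the random edge to the i-th
          -- position of w, back along the identity edge there, and inside w to its main position.
          same : F (main v) ≡ F (main w)
          same = trans (sym (Block.blockConstant gv i)) (trans (Block.uncut gv (suc (suc zero)) i)
            (trans (cong G (blockwise-combine π v i)) (trans (sym (Block.uncut gw zero i)) (Block.blockConstant gw i))))

      below : ℕ → Fin p → Bool
      below c x = toℕ x <ᵇ c

      is : ℕ → Fin p → Bool
      is c x = toℕ x ≡ᵇ c

      below-suc : ∀ c → # (below (suc c) ∘ F ∘ main) ≤ # (below c ∘ F ∘ main) + # (is c ∘ F ∘ main)
      below-suc c = ≤-trans (sum-mono-≤ (λ v → lem (toℕ (F (main v))) c))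
        (≤-reflexive (ΣN.∑-distrib-+ (ind ∘ below c ∘ F ∘ main) (ind ∘ is c ∘ F ∘ main)))
        where
        lem : ∀ x c → ind (x <ᵇ suc c) ≤ ind (x <ᵇ c) + ind (x ≡ᵇ c)
        lem zero    zero    = ≤-refl
        lem zero    (suc c) = ≤-refl
        lem (suc x) zero    = z≤n
        lem (suc x) (suc c) = lem x c

      -- As c grows, the count of colours below c jumps at some c from less than 2σ to more than 14σ.
      majority-below : ∀ c → # (below c ∘ F ∘ main) < 2 * σ ⊎ ∃ λ c′ → 12 * σ ≤ # (is c′ ∘ F ∘ main)
      majority-below zero    = inj₁ (subst (_< 2 * σ) (sym (trans (sum-const k 0) (*-zeroʳ k))) (*-mono-≤ {1} {2} (s≤s z≤n) 1≤σ))
      majority-below (suc c) with majority-below c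
      ... | inj₂ found = inj₂ found
      ... | inj₁ lt with dichotomy (below (suc c))
      ...   | inj₁ lt′ = inj₁ lt′
      ...   | inj₂ gt  = inj₂ (c , +-cancelˡ-≤ (2 * σ) _ _ (begin
        2 * σ + 12 * σ                                        ≡⟨ sym (*-distribʳ-+ σ 2 12) ⟩
        14 * σ                                                ≤⟨ <⇒≤ gt ⟩
        # (below (suc c) ∘ F ∘ main)                          ≤⟨ below-suc c ⟩
        # (below c ∘ F ∘ main) + # (is c ∘ F ∘ main)          ≤⟨ +-monoˡ-≤ _ (<⇒≤ lt) ⟩
        2 * σ + # (is c ∘ F ∘ main)                           ∎))
        where open ≤-Reasoning

      majority : ∃ λ c → 12 * σ ≤ # (is c ∘ F ∘ main)
      majority with majority-below p
      ... | inj₂ found = found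
      ... | inj₁ lt    = ⊥-elim (<⇒≱ lt (begin
        2 * σ                    ≤⟨ *-monoˡ-≤ σ (s≤s (s≤s (z≤n {14}))) ⟩
        k                        ≡⟨ sym (*-identityʳ k) ⟩
        k * 1                    ≡⟨ sym (sum-const k 1) ⟩
        ΣN.sum {k} (λ _ → 1)     ≤⟨ sum-mono-≤ (λ v → ≤-reflexive (sym (lem (F (main v))))) ⟩
        # (below p ∘ F ∘ main)   ∎))
        where
        open ≤-Reasoning
        lem : ∀ x → ind (toℕ x <ᵇ p) ≡ 1
        lem x = cong ind (dec-true (toℕ x <? p) (Finₚ.toℕ<n x))

      -- At least 12σ of the 16σ blocks share the majority colour, and the two cases are whether
      -- that colour is 0. The factor 3 between the bounds is the room for adding two light
      -- combinations.
      gap : # (nonzero ∘ F ∘ main) ≤ 4 * σ ⊎ 3 * (4 * σ) ≤ # (nonzero ∘ F ∘ main)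
      gap with majority
      ... | zero , maj = inj₁ (+-cancelʳ-≤ (12 * σ) _ _ (begin
        # (nonzero ∘ F ∘ main) + 12 * σ                  ≤⟨ +-monoʳ-≤ _ maj ⟩
        # (nonzero ∘ F ∘ main) + # (is 0 ∘ F ∘ main)     ≡⟨ cong (λ z → # (nonzero ∘ F ∘ main) + z) (#-cong (λ v → lem (F (main v)))) ⟩
        # (nonzero ∘ F ∘ main) + # (not ∘ nonzero ∘ F ∘ main) ≡⟨ #+#not (nonzero ∘ F ∘ main) ⟩
        16 * σ                                           ≡⟨ *-distribʳ-+ σ 4 12 ⟩
        4 * σ + 12 * σ                                   ∎))
        where
        open ≤-Reasoning
        lem : ∀ {p} (x : Fin p) → (toℕ x ≡ᵇ 0) ≡ not (nonzero x)
        lem zero    = refl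
        lem (suc x) = refl
      ... | suc c , maj = inj₂ (≤-trans (≤-reflexive (sym (*-assoc 3 4 σ)))
        (≤-trans maj (sum-mono-≤ (λ v → lem (F (main v))))))
        where
        lem : ∀ {p} (x : Fin p) → ind (toℕ x ≡ᵇ suc c) ≤ ind (nonzero x)
        lem zero    = z≤n
        lem (suc x) = ind≤1 _

    module Uncut (cut≤0 : cut ≤ 0) (light : # (nonzero ∘ F ∘ main) ≤ suc (4 * σ)) where

      uncut : ∀ i q → F q ≡ G (τ i ⟨$⟩ʳ q)
      uncut i q = unbroken i q (≤-trans (term≤sum (broken i) q) (≤-trans (term≤sum (λ i → ΣN.sum (broken i)) i) cut≤0))

      F-constant : ∀ q q′ → F q ≡ F q′
      F-constant = constant F (λ q q′ eq → trans (uncut zero q′)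
        (trans (cong G (sym (cycle-suc L q q′ eq))) (sym (uncut (suc zero) q))))

      1+4σ<16σ : suc (4 * σ) < 16 * σ
      1+4σ<16σ = ≤-trans (+-monoˡ-≤ (4 * σ) (*-monoʳ-≤ 2 1≤σ))
        (≤-trans (≤-reflexive (sym (*-distribʳ-+ σ 2 4))) (*-monoˡ-≤ σ (m≤m+n 6 10)))

      F-zero : ∀ q → nonzero (F q) ≡ false
      F-zero q with nonzero (F q) in eq
      ... | false = refl
      ... | true  = ⊥-elim (<⇒≱ 1+4σ<16σ (begin
        k                       ≡⟨ sym (*-identityʳ k) ⟩
        k * 1                   ≡⟨ sym (sum-const k 1) ⟩
        ΣN.sum {k} (λ _ → 1)    ≤⟨ sum-mono-≤ (λ v → ≤-reflexive (cong ind (trans (sym eq) (cong nonzero (F-constant q (main v)))))) ⟩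
        # (nonzero ∘ F ∘ main)  ≤⟨ light ⟩
        suc (4 * σ)             ∎))
        where open ≤-Reasoning

      G-zero : ∀ q → nonzero (G q) ≡ false
      G-zero q = trans (cong nonzero (sym (uncut zero q))) (F-zero q)

-- Integers modulo a prime

module ΣZ = SemiringSum ℤₚ.+-*-semiring

injective⇒permutation : ∀ {n} (g : Fin n → Fin n) → Injective _≡_ _≡_ g → Σ (Permutation′ n) λ π → ∀ i → π ⟨$⟩ʳ i ≡ g i
injective⇒permutation {n} g inj = Perm.permutation g g⁻¹ g∘g⁻¹ (λ x → inj (g∘g⁻¹ (g x))) , λ _ → refl
  where
  surjective : ∀ {n} (g : Fin n → Fin n) → Injective _≡_ _≡_ g → ∀ y → ∃ λ x → g x ≡ y
  surjective {suc n} g inj y with Finₚ.any? (λ x → g x Finₚ.≟ y)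
  ... | yes found = found
  ... | no  none  = ⊥-elim (1+n≰n (Finₚ.injective⇒≤ {f = λ x → punchOut (miss x)}
                      (λ {a} {b} eq → inj (Finₚ.punchOut-injective (miss a) (miss b) eq))))
    where
    miss : ∀ x → y ≢ g x
    miss x eq = none (x , sym eq)

  g⁻¹ : Fin n → Fin n
  g⁻¹ y = proj₁ (surjective g inj y)
  g∘g⁻¹ : ∀ y → g (g⁻¹ y) ≡ y
  g∘g⁻¹ y = proj₂ (surjective g inj y)

module Residue (p′ : ℕ) (prime : Prime (suc (suc p′))) where

  p : ℕ
  p = suc (suc p′)

  P : ℤ
  P = + p

  infix 4 _≡ₚ_
  -- A record, so that both sides can be inferred from the type; the divisibility alone shows only
  -- their difference.
  record _≡ₚ_ (a b : ℤ) : Set where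
    constructor mod
    field dividesDifference : P ℤ∣.∣ a ℤ.- b

  ⟦_⟧ : Fin p → ℤ
  ⟦ j ⟧ = + toℕ j

  ≡⇒≡ₚ : ∀ {a b} → a ≡ b → a ≡ₚ b
  ≡⇒≡ₚ {a} refl = mod (divides 0ℤ (ℤₚ.+-inverseʳ a))

  ≡ₚ-sym : ∀ {a b} → a ≡ₚ b → b ≡ₚ a
  ≡ₚ-sym {a} {b} (mod d) = mod (subst (P ℤ∣.∣_) (lem a b) (ℤ∣.∣m⇒∣-m d))
    where
    lem : ∀ a b → ℤ.- (a ℤ.- b) ≡ b ℤ.- a
    lem = ℤ-solve-∀

  ≡ₚ-trans : ∀ {a b c} → a ≡ₚ b → b ≡ₚ c → a ≡ₚ c
  ≡ₚ-trans {a} {b} {c} (mod d) (mod e) = mod (subst (P ℤ∣.∣_) (lem a b c) (ℤ∣.∣m∣n⇒∣m+n d e))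
    where
    lem : ∀ a b c → (a ℤ.- b) ℤ.+ (b ℤ.- c) ≡ a ℤ.- c
    lem = ℤ-solve-∀

  ≡ₚ-+ : ∀ {a b c d} → a ≡ₚ b → c ≡ₚ d → a ℤ.+ c ≡ₚ b ℤ.+ d
  ≡ₚ-+ {a} {b} {c} {d} (mod e) (mod f) = mod (subst (P ℤ∣.∣_) (lem a b c d) (ℤ∣.∣m∣n⇒∣m+n e f))
    where
    lem : ∀ a b c d → (a ℤ.- b) ℤ.+ (c ℤ.- d) ≡ (a ℤ.+ c) ℤ.- (b ℤ.+ d)
    lem = ℤ-solve-∀

  ≡ₚ-*ʳ : ∀ {a b} c → a ≡ₚ b → a ℤ.* c ≡ₚ b ℤ.* c
  ≡ₚ-*ʳ {a} {b} c (mod e) = mod (subst (P ℤ∣.∣_) (lem a b c) (ℤ∣.∣m⇒∣m*n c e))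
    where
    lem : ∀ a b c → (a ℤ.- b) ℤ.* c ≡ a ℤ.* c ℤ.- b ℤ.* c
    lem = ℤ-solve-∀

  ∣-resp-≡ₚ : ∀ {a b} → a ≡ₚ b → P ℤ∣.∣ b → P ℤ∣.∣ a
  ∣-resp-≡ₚ {a} {b} (mod d) e = subst (P ℤ∣.∣_) (lem a b) (ℤ∣.∣m∣n⇒∣m+n d e)
    where
    lem : ∀ a b → (a ℤ.- b) ℤ.+ b ≡ a
    lem = ℤ-solve-∀

  ⟦⟧-injective : ∀ {i j} → ⟦ i ⟧ ≡ₚ ⟦ j ⟧ → i ≡ j
  ⟦⟧-injective {i} {j} (mod d) = Finₚ.toℕ-injective (ℤₚ.+-injective (ℤₚ.i-j≡0⇒i≡j ⟦ i ⟧ ⟦ j ⟧ (ℤₚ.∣i∣≡0⇒i≡0 (small _ lt (ℤ∣.∣⇒∣ᵤ d)))))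
    where
    small : ∀ m → m < p → p ℕ∣.∣ m → m ≡ 0
    small zero    _  _   = refl
    small (suc m) lt dvd = ⊥-elim (ℕ∣.>⇒∤ lt dvd)
    lt : ℤ.∣ ⟦ i ⟧ ℤ.- ⟦ j ⟧ ∣ < p
    lt = ≤-<-trans (≤-reflexive (cong ℤ.∣_∣ (ℤₚ.m-n≡m⊖n (toℕ i) (toℕ j))))
           (≤-<-trans (ℤₚ.∣m⊝n∣≤m⊔n (toℕ i) (toℕ j)) (⊔-lub (Finₚ.toℕ<n i) (Finₚ.toℕ<n j)))

  euclid : ∀ a b → P ℤ∣.∣ a ℤ.* b → P ℤ∣.∣ a ⊎ P ℤ∣.∣ b
  euclid a b d with euclidsLemma ℤ.∣ a ∣ ℤ.∣ b ∣ prime (subst (p ℕ∣.∣_) (ℤₚ.abs-* a b) (ℤ∣.∣⇒∣ᵤ d))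
  ... | inj₁ e = inj₁ (ℤ∣.∣ᵤ⇒∣ e)
  ... | inj₂ e = inj₂ (ℤ∣.∣ᵤ⇒∣ e)

  residue : ℤ → Fin p
  residue z = fromℕ< (ℤ/.n%ℕd<d z p)

  residue-≡ₚ : ∀ z → z ≡ₚ ⟦ residue z ⟧
  residue-≡ₚ z = mod (divides (z ℤ./ℕ p) (begin
    z ℤ.- ⟦ residue z ⟧                  ≡⟨ cong (λ k → z ℤ.- + k) (Finₚ.toℕ-fromℕ< _) ⟩
    z ℤ.- r                              ≡⟨ cong (ℤ._- r) (ℤ/.a≡a%ℕn+[a/ℕn]*n z p) ⟩
    r ℤ.+ (z ℤ./ℕ p) ℤ.* P ℤ.- r      ≡⟨ lem r _ ⟩
    (z ℤ./ℕ p) ℤ.* P                  ∎))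
    where
    open ≡-Reasoning
    r = + (z ℤ.%ℕ p)
    lem : ∀ a b → a ℤ.+ b ℤ.- a ≡ b
    lem = ℤ-solve-∀

  step : ℤ → ℤ → Fin p → Fin p
  step s t j = residue (s ℤ.+ ⟦ j ⟧ ℤ.* t)

  step-≡ₚ : ∀ s t j → s ℤ.+ ⟦ j ⟧ ℤ.* t ≡ₚ ⟦ step s t j ⟧
  step-≡ₚ s t j = residue-≡ₚ (s ℤ.+ ⟦ j ⟧ ℤ.* t)

  step-injective : ∀ s t → ¬ P ℤ∣.∣ t → Injective _≡_ _≡_ (step s t)
  step-injective s t p∤t {i} {j} eq = cancel (euclid (⟦ i ⟧ ℤ.- ⟦ j ⟧) t (subst (P ℤ∣.∣_) (lem s t ⟦ i ⟧ ⟦ j ⟧) (_≡ₚ_.dividesDifference same)))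
    where
    lem : ∀ s t a b → (s ℤ.+ a ℤ.* t) ℤ.- (s ℤ.+ b ℤ.* t) ≡ (a ℤ.- b) ℤ.* t
    lem = ℤ-solve-∀
    same : s ℤ.+ ⟦ i ⟧ ℤ.* t ≡ₚ s ℤ.+ ⟦ j ⟧ ℤ.* t
    same = ≡ₚ-trans (step-≡ₚ s t i) (≡ₚ-trans {b = ⟦ step s t j ⟧} (≡⇒≡ₚ (cong ⟦_⟧ eq)) (≡ₚ-sym (step-≡ₚ s t j)))
    cancel : P ℤ∣.∣ ⟦ i ⟧ ℤ.- ⟦ j ⟧ ⊎ P ℤ∣.∣ t → i ≡ j
    cancel (inj₁ d) = ⟦⟧-injective (mod d)
    cancel (inj₂ d) = ⊥-elim (p∤t d)

  -- Primality makes the step cancellable. The progression is packaged as a permutation of the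
  -- residues, the form in which a sum can be reindexed.
  progression : ∀ s t → ¬ P ℤ∣.∣ t → Σ (Permutation′ p) λ π → ∀ j → s ℤ.+ ⟦ j ⟧ ℤ.* t ≡ₚ ⟦ π ⟨$⟩ʳ j ⟧
  progression s t p∤t = proj₁ π , λ j → subst (λ k → s ℤ.+ ⟦ j ⟧ ℤ.* t ≡ₚ ⟦ k ⟧) (sym (proj₂ π j)) (step-≡ₚ s t j)
    where
    π = injective⇒permutation (step s t) (step-injective s t p∤t)

  p∤1 : ¬ P ℤ∣.∣ 1ℤ
  p∤1 d with ℕ∣.∣1⇒≡1 (ℤ∣.∣⇒∣ᵤ d)
  ... | ()

  -- Addition modulo p is read off from progressions of step 1, so that every translation comes with
  -- its inverse.
  translation : Fin p → Permutation′ p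
  translation i = proj₁ (progression ⟦ i ⟧ 1ℤ p∤1)

  infixl 6 _⊕ₚ_
  _⊕ₚ_ : Fin p → Fin p → Fin p
  i ⊕ₚ j = translation i ⟨$⟩ʳ j

  ⊕ₚ-≡ₚ : ∀ i j → ⟦ i ⊕ₚ j ⟧ ≡ₚ ⟦ i ⟧ ℤ.+ ⟦ j ⟧
  ⊕ₚ-≡ₚ i j = ≡ₚ-sym (subst (λ z → ⟦ i ⟧ ℤ.+ z ≡ₚ ⟦ i ⊕ₚ j ⟧) (ℤₚ.*-identityʳ ⟦ j ⟧)
                (proj₂ (progression ⟦ i ⟧ 1ℤ p∤1) j))

  infixl 6 _⊕ᵛ_
  _⊕ᵛ_ : ∀ {n} → Vec (Fin p) n → Vec (Fin p) n → Vec (Fin p) n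
  _⊕ᵛ_ = zipWith _⊕ₚ_

  dot : ∀ {n} → (Fin n → ℤ) → Vec (Fin p) n → ℤ
  dot ψ x = ΣZ.sum (λ e → ψ e ℤ.* ⟦ lookup x e ⟧)

  dot-+ : ∀ {n} (ψ φ : Fin n → ℤ) x → dot (λ e → ψ e ℤ.+ φ e) x ≡ dot ψ x ℤ.+ dot φ x
  dot-+ ψ φ x = trans (ΣZ.sum-cong-≗ (λ e → ℤₚ.*-distribʳ-+ ⟦ lookup x e ⟧ (ψ e) (φ e)))
                      (ΣZ.∑-distrib-+ (λ e → ψ e ℤ.* ⟦ lookup x e ⟧) (λ e → φ e ℤ.* ⟦ lookup x e ⟧))

  single : ∀ {n} → Fin n → ℤ → Fin n → ℤ
  single zero    t zero    = t
  single zero    t (suc _) = 0ℤ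
  single (suc e) t zero    = 0ℤ
  single (suc e) t (suc i) = single e t i

  dot-zeroˡ : ∀ {n} (x : Vec (Fin p) n) → dot (λ _ → 0ℤ) x ≡ 0ℤ
  dot-zeroˡ []      = refl
  dot-zeroˡ (j ∷ x) = trans (ℤₚ.+-identityˡ _) (dot-zeroˡ x)

  dot-single : ∀ {n} (e : Fin n) t x → dot (single e t) x ≡ t ℤ.* ⟦ lookup x e ⟧
  dot-single zero t (j ∷ x) = trans (cong (λ z → t ℤ.* ⟦ j ⟧ ℤ.+ z) (dot-zeroˡ x)) (ℤₚ.+-identityʳ _)
  dot-single (suc e) t (j ∷ x) = trans (ℤₚ.+-identityˡ _) (dot-single e t x)

  p∤? : ∀ z → Dec (¬ P ℤ∣.∣ z)
  p∤? z = ¬? (P ℤ∣.∣? z)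

  weight : ∀ {n} → (Fin n → ℤ) → ℕ
  weight ψ = ΣN.sum (λ e → bit (p∤? (ψ e)))

  bit-mono : ∀ {A B : Set} (A? : Dec A) (B? : Dec B) → (A → B) → bit A? ≤ bit B?
  bit-mono (yes a) B? f = ≤-reflexive (sym (bit-yes B? (f a)))
  bit-mono (no _)  B? f = z≤n

  weight-cong : ∀ {n} {ψ φ : Fin n → ℤ} → (∀ e → ψ e ≡ₚ φ e) → weight ψ ≤ weight φ
  weight-cong {ψ = ψ} {φ} h = sum-mono-≤ (λ e → bit-mono (p∤? (ψ e)) (p∤? (φ e)) (λ ∤ d → ∤ (∣-resp-≡ₚ (h e) d)))

  weight-+ : ∀ {n} (ψ φ : Fin n → ℤ) → weight (λ e → ψ e ℤ.+ φ e) ≤ weight ψ + weight φ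
  weight-+ ψ φ = ≤-trans (sum-mono-≤ (λ e → lem (ψ e) (φ e)))
    (≤-reflexive (ΣN.∑-distrib-+ (λ e → bit (p∤? (ψ e))) (λ e → bit (p∤? (φ e)))))
    where
    lem : ∀ a b → bit (p∤? (a ℤ.+ b)) ≤ bit (p∤? a) + bit (p∤? b)
    lem a b with P ℤ∣.∣? a | P ℤ∣.∣? b
    ... | no _  | _     = ≤-trans (bit-mono (p∤? (a ℤ.+ b)) (yes tt) (λ _ → tt)) (m≤m+n 1 _)
    ... | yes d | no _  = bit-mono (p∤? (a ℤ.+ b)) (yes tt) (λ _ → tt)
    ... | yes d | yes e = ≤-reflexive (bit-no (p∤? (a ℤ.+ b)) (λ ∤ → ∤ (ℤ∣.∣m∣n⇒∣m+n d e)))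

  weight-neg : ∀ {n} (ψ : Fin n → ℤ) → weight (λ e → ℤ.- ψ e) ≤ weight ψ
  weight-neg ψ = sum-mono-≤ (λ e → bit-mono (p∤? (ℤ.- ψ e)) (p∤? (ψ e)) (λ ∤ d → ∤ (ℤ∣.∣m⇒∣-m d)))

  weight-zero : ∀ n → weight {n} (λ _ → 0ℤ) ≤ 0
  weight-zero zero    = z≤n
  weight-zero (suc n) = +-mono-≤ (≤-reflexive (bit-no (p∤? 0ℤ) (λ ∤ → ∤ (divides 0ℤ refl)))) (weight-zero n)

  weight-single : ∀ {n} (e : Fin n) t → weight (single e t) ≤ 1
  weight-single {suc n} zero t = +-mono-≤ (bit-mono (p∤? t) (yes tt) (λ _ → tt)) (weight-zero n)
  weight-single (suc e) t = +-mono-≤ (≤-reflexive (bit-no (p∤? 0ℤ) (λ ∤ → ∤ (divides 0ℤ refl)))) (weight-single e t)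

  weight>0 : ∀ {n} (ψ : Fin n → ℤ) → 0 < weight ψ → ∃ λ e → ¬ P ℤ∣.∣ ψ e
  weight>0 {suc n} ψ lt with p∤? (ψ zero)
  ... | yes ∤ = zero , ∤
  ... | no _  with weight>0 (ψ ∘ suc) lt
  ...   | e , ∤ = suc e , ∤

  module _ {m : ℕ} where

    -- Where x_e = i the tilt changes nothing; elsewhere it runs with j through a progression of
    -- nonzero step. Summing a mean-zero function over j thus cuts out the points with x_e = i,
    -- while the form gains or loses at most one variable.
    tilt : (Vec (Fin p) m → ℤ) → Fin m → Fin p → Fin p → Vec (Fin p) m → ℤ
    tilt θ e i j x = θ x ℤ.+ ⟦ j ⟧ ℤ.* (⟦ lookup x e ⟧ ℤ.- ⟦ i ⟧)

    affine : (Fin m → ℤ) → ℤ → Vec (Fin p) m → ℤ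
    affine a c x = dot a x ℤ.+ c

    tilt-affine : ∀ a c e i j x → tilt (affine a c) e i j x ≡
                  affine (λ e′ → a e′ ℤ.+ single e ⟦ j ⟧ e′) (c ℤ.- ⟦ j ⟧ ℤ.* ⟦ i ⟧) x
    tilt-affine a c e i j x = begin
      dot a x ℤ.+ c ℤ.+ ⟦ j ⟧ ℤ.* (⟦ lookup x e ⟧ ℤ.- ⟦ i ⟧)
        ≡⟨ lem (dot a x) c ⟦ j ⟧ ⟦ lookup x e ⟧ ⟦ i ⟧ ⟩
      dot a x ℤ.+ ⟦ j ⟧ ℤ.* ⟦ lookup x e ⟧ ℤ.+ (c ℤ.- ⟦ j ⟧ ℤ.* ⟦ i ⟧)
        ≡⟨ cong (ℤ._+ (c ℤ.- ⟦ j ⟧ ℤ.* ⟦ i ⟧)) (sym (trans (dot-+ a (single e ⟦ j ⟧) x)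
             (cong (λ z → dot a x ℤ.+ z) (dot-single e ⟦ j ⟧ x)))) ⟩
      dot (λ e′ → a e′ ℤ.+ single e ⟦ j ⟧ e′) x ℤ.+ (c ℤ.- ⟦ j ⟧ ℤ.* ⟦ i ⟧) ∎
      where
      open ≡-Reasoning
      lem : ∀ d c j x i → d ℤ.+ c ℤ.+ j ℤ.* (x ℤ.- i) ≡ d ℤ.+ j ℤ.* x ℤ.+ (c ℤ.- j ℤ.* i)
      lem = ℤ-solve-∀

    weight-tilt : ∀ (a : Fin m → ℤ) e j → weight a ≤ suc (weight (λ e′ → a e′ ℤ.+ single e ⟦ j ⟧ e′))
    weight-tilt a e j = begin
      weight a                               ≤⟨ weight-cong (λ e′ → ≡⇒≡ₚ (lem (a e′) (single e ⟦ j ⟧ e′))) ⟩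
      weight (λ e′ → a⁺ e′ ℤ.+ ℤ.- single e ⟦ j ⟧ e′) ≤⟨ weight-+ a⁺ (λ e′ → ℤ.- single e ⟦ j ⟧ e′) ⟩
      weight a⁺ + weight (λ e′ → ℤ.- single e ⟦ j ⟧ e′) ≤⟨ +-monoʳ-≤ (weight a⁺) (≤-trans (weight-neg (single e ⟦ j ⟧)) (weight-single e ⟦ j ⟧)) ⟩
      weight a⁺ + 1                          ≡⟨ +-comm (weight a⁺) 1 ⟩
      suc (weight a⁺)                        ∎
      where
      open ≤-Reasoning
      a⁺ : Fin m → ℤ
      a⁺ e′ = a e′ ℤ.+ single e ⟦ j ⟧ e′
      lem : ∀ a b → a ≡ (a ℤ.+ b) ℤ.+ ℤ.- b
      lem = ℤ-solve-∀

    weight-tilt-≤ : ∀ (a : Fin m → ℤ) e j → weight (λ e′ → a e′ ℤ.+ single e ⟦ j ⟧ e′) ≤ suc (weight a)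
    weight-tilt-≤ a e j = ≤-trans (weight-+ a (single e ⟦ j ⟧))
      (≤-trans (+-monoʳ-≤ (weight a) (weight-single e ⟦ j ⟧)) (≤-reflexive (+-comm (weight a) 1)))

  weight-cancel : ∀ {n} (a b : Fin n → ℤ) → weight b ≤ weight (λ e → a e ℤ.+ b e) + weight a
  weight-cancel a b = ≤-trans (weight-cong (λ e → ≡⇒≡ₚ (lem (a e) (b e))))
    (≤-trans (weight-+ (λ e → a e ℤ.+ b e) (λ e → ℤ.- a e)) (+-monoʳ-≤ _ (weight-neg a)))
    where
    lem : ∀ a b → b ≡ (a ℤ.+ b) ℤ.+ ℤ.- a
    lem = ℤ-solve-∀

  dot-zero : ∀ {n} (y : Fin n → ℤ) → dot y (replicate n zero) ≡ 0ℤ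
  dot-zero {zero}  y = refl
  dot-zero {suc n} y = trans (cong₂ ℤ._+_ (ℤₚ.*-zeroʳ (y zero)) (dot-zero (y ∘ suc))) refl

  dot-update : ∀ {n} (y : Fin n → ℤ) F v j → dot y (F [ v ]≔ j) ≡ dot y (F [ v ]≔ zero) ℤ.+ ⟦ j ⟧ ℤ.* y v
  dot-update y (i ∷ F) zero    j = lem (y zero) ⟦ j ⟧ (dot (y ∘ suc) F)
    where
    lem : ∀ y j d → y ℤ.* j ℤ.+ d ≡ y ℤ.* 0ℤ ℤ.+ d ℤ.+ j ℤ.* y
    lem = ℤ-solve-∀
  dot-update y (i ∷ F) (suc v) j = trans (cong (λ z → y zero ℤ.* ⟦ i ⟧ ℤ.+ z) (dot-update (y ∘ suc) F v j))
                                         (sym (ℤₚ.+-assoc (y zero ℤ.* ⟦ i ⟧) _ _))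

  dot-⊕ : ∀ {n} (y : Fin n → ℤ) F G → dot y (F ⊕ᵛ G) ≡ₚ dot y F ℤ.+ dot y G
  dot-⊕ y []      []      = ≡⇒≡ₚ refl
  dot-⊕ y (i ∷ F) (j ∷ G) = ≡ₚ-trans (≡ₚ-+ head (dot-⊕ (y ∘ suc) F G))
                                     (≡⇒≡ₚ (lem (y zero) ⟦ i ⟧ ⟦ j ⟧ (dot (y ∘ suc) F) (dot (y ∘ suc) G)))
    where
    lem : ∀ y i j a b → (i ℤ.+ j) ℤ.* y ℤ.+ (a ℤ.+ b) ≡ (y ℤ.* i ℤ.+ a) ℤ.+ (y ℤ.* j ℤ.+ b)
    lem = ℤ-solve-∀
    head : y zero ℤ.* ⟦ i ⊕ₚ j ⟧ ≡ₚ (⟦ i ⟧ ℤ.+ ⟦ j ⟧) ℤ.* y zero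
    head = ≡ₚ-trans (≡⇒≡ₚ (ℤₚ.*-comm (y zero) _)) (≡ₚ-*ʳ (y zero) (⊕ₚ-≡ₚ i j))

  -- A system of affine forms ℓ q over ℤ/p. The F-combination of the forms has coefficient vector δ F,
  -- and wt is a size of combinations with a gap: a sparse δ F forces wt F < s or wt F > 2s.
  record System : Set where
    field
      m rows : ℕ
      ℓ      : Fin rows → Vec (Fin p) m → ℤ
      δ      : Vec (Fin p) rows → Fin m → ℤ
      ρ      : Vec (Fin p) rows → ℤ
      adjoint : ∀ F x → dot (λ q → ℓ q x) F ≡ affine (δ F) (ρ F) x
      δ-⊕    : ∀ F G e → δ (F ⊕ᵛ G) e ≡ₚ δ F e ℤ.+ δ G e
      wt     : Vec (Fin p) rows → ℕ
      s g    : ℕ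
      1≤s    : 1 ≤ s
      gap    : ∀ F → weight (δ F) ≤ g → suc (wt F) ≤ s ⊎ s + s < wt F
      wt-update : ∀ F v j → wt (F [ v ]≔ j) ≤ suc (wt F)
      wt-⊕   : ∀ F G → wt (F ⊕ᵛ G) ≤ wt F + wt G
      wt-⊕⁻  : ∀ F G → wt G ≤ wt F + wt (F ⊕ᵛ G)
      wt-zero : wt (replicate rows zero) ≤ s
      rigid  : ∀ F → wt F ≤ s → weight (δ F) ≤ 0 → F ≡ replicate rows zero

-- Sums over an ordered field

module Field (R : RealField lzero lzero) where

  commutativeRing : CommutativeRing lzero lzero
  commutativeRing = record { isCommutativeRing = RealField.isCommutativeRing R }

  open RealField R public using (_≤ᵣ_)
  open CommutativeRing commutativeRing public
    using (Carrier; _≈_; 0#; 1#; setoid; reflexive; semiring; ring)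
    renaming (_+_ to infixl 6 _⊞_; _*_ to infixl 7 _⊠_; -_ to infix 8 ⊟_;
              refl to reflᴿ; sym to symᴿ; trans to transᴿ;
              +-cong to ⊞-cong; +-congˡ to ⊞-congˡ; +-congʳ to ⊞-congʳ; +-assoc to ⊞-assoc; +-comm to ⊞-comm;
              +-identityˡ to ⊞-identityˡ; +-identityʳ to ⊞-identityʳ;
              *-congˡ to ⊠-congˡ; *-congʳ to ⊠-congʳ; *-assoc to ⊠-assoc; *-comm to ⊠-comm;
              *-identityˡ to ⊠-identityˡ; *-identityʳ to ⊠-identityʳ; zeroˡ to ⊠-zeroˡ; zeroʳ to ⊠-zeroʳ;
              distribˡ to ⊠-distribˡ-⊞; distribʳ to ⊠-distribʳ-⊞;
              -‿inverseˡ to ⊟-inverseˡ; -‿inverseʳ to ⊟-inverseʳ; -‿cong to ⊟-cong)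
  open RingProperties ring public using ()
    renaming (-‿distribˡ-* to ⊟-distribˡ-⊠; -‿involutive to ⊟-involutive; -‿+-comm to ⊟-+-comm)
  open SemiringSum semiring public using (sum; sum-cong-≋; *-distribˡ-sum; *-distribʳ-sum; ∑-comm; ∑-distrib-+; ∑-permute; sum-replicate-zero)
  open import Relation.Binary.Reasoning.Setoid setoid public

  private module R = RealField R

  -- If 1 ≤ 0, then -1 is nonnegative, and so is its square 1.
  0≤1 : 0# ≤ᵣ 1#
  0≤1 with R.≤-total 0# 1#
  ... | inj₁ le = le
  ... | inj₂ ge = R.≤-trans (R.*-nonneg 0≤-1 0≤-1) (R.≤-refl (transᴿ (symᴿ (⊟-distribˡ-⊠ 1# (⊟ 1#)))
                    (transᴿ (⊟-cong (⊠-identityˡ (⊟ 1#))) (⊟-involutive 1#))))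
    where
    0≤-1 : 0# ≤ᵣ ⊟ 1#
    0≤-1 = R.≤-trans (R.≤-refl (symᴿ (⊟-inverseʳ 1#)))
             (R.≤-trans (R.+-mono-≤ (⊟ 1#) ge) (R.≤-refl (⊞-identityˡ (⊟ 1#))))

  ≥1⇒≉0 : ∀ {x} → 1# ≤ᵣ x → ¬ (x ≈ 0#)
  ≥1⇒≉0 1≤x x≈0 = R.0≉1 (R.≤-antisym 0≤1 (R.≤-trans 1≤x (R.≤-refl x≈0)))

  sum≥1 : ∀ n {f : Fin (suc n) → Carrier} → (∀ i → 1# ≤ᵣ f i) → 1# ≤ᵣ sum f
  sum≥1 zero    {f} h = R.≤-trans (h zero) (R.≤-refl (symᴿ (⊞-identityʳ (f zero))))
  sum≥1 (suc n) {f} h = R.≤-trans (sum≥1 n (h ∘ suc)) (R.≤-trans (R.≤-refl (symᴿ (⊞-identityˡ _)))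
                          (R.+-mono-≤ _ (R.≤-trans 0≤1 (h zero))))

  sum-zero : ∀ {n} {f : Fin n → Carrier} → (∀ i → f i ≈ 0#) → sum f ≈ 0#
  sum-zero {n} h = transᴿ (sum-cong-≋ h) (sum-replicate-zero n)

  ⊟-zero : ⊟ 0# ≈ 0#
  ⊟-zero = transᴿ (symᴿ (⊞-identityˡ _)) (⊟-inverseʳ 0#)

  sum-neg : ∀ n (f : Fin n → Carrier) → sum (λ i → ⊟ f i) ≈ ⊟ sum f
  sum-neg zero    f = symᴿ ⊟-zero
  sum-neg (suc n) f = transᴿ (⊞-congˡ (sum-neg n (f ∘ suc))) (⊟-+-comm (f zero) _)

  sum-only : ∀ {n} {f : Fin n → Carrier} i → (∀ j → j ≢ i → f j ≈ 0#) → sum f ≈ f i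
  sum-only {f = f} zero    h = transᴿ (⊞-congˡ (sum-zero (λ j → h (suc j) (λ ())))) (⊞-identityʳ (f zero))
  sum-only {f = f} (suc i) h = transᴿ (⊞-congʳ (h zero (λ ()))) (transᴿ (⊞-identityˡ _)
    (sum-only i (λ j j≢i → h (suc j) (j≢i ∘ Finₚ.suc-injective))))

  -- Characteristic zero, obtained from the order: a sum of n+1 ones is at least 1, hence
  -- invertible. The Fourier identities are stated p-fold instead of with averages, and this removes
  -- the factor.
  replicate-cancel : ∀ n {x} → sum {suc n} (λ _ → x) ≈ 0# → x ≈ 0#
  replicate-cancel n {x} eq = begin
    x                             ≈⟨ ⊠-identityʳ x ⟨
    x ⊠ 1#                        ≈⟨ ⊠-congˡ (R.⁻¹-inverse k (≥1⇒≉0 (sum≥1 n (λ _ → R.≤-refl reflᴿ)))) ⟨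
    x ⊠ (k ⊠ (R._⁻¹ k))           ≈⟨ ⊠-assoc x k _ ⟨
    x ⊠ k ⊠ (R._⁻¹ k)             ≈⟨ ⊠-congʳ (*-distribˡ-sum x (λ (_ : Fin (suc n)) → 1#)) ⟩
    sum {suc n} (λ _ → x ⊠ 1#) ⊠ (R._⁻¹ k) ≈⟨ ⊠-congʳ (transᴿ (sum-cong-≋ {suc n} (λ _ → ⊠-identityʳ x)) eq) ⟩
    0# ⊠ (R._⁻¹ k)                ≈⟨ ⊠-zeroˡ _ ⟩
    0#                            ∎
    where
    k = sum {suc n} (λ _ → 1#)

  bitR : {A : Set} → Dec A → Carrier
  bitR (yes _) = 1#
  bitR (no _)  = 0#

  bitR-yes : {A : Set} (A? : Dec A) → A → bitR A? ≈ 1#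
  bitR-yes (yes _) a = reflᴿ
  bitR-yes (no ¬a) a = contradiction a ¬a

  bitR-no : {A : Set} (A? : Dec A) → ¬ A → bitR A? ≈ 0#
  bitR-no (yes a) ¬a = contradiction a ¬a
  bitR-no (no _)  ¬a = reflᴿ

  bitR-zero : {A : Set} (A? : Dec A) {x : Carrier} → (A → x ≈ 0#) → bitR A? ⊠ x ≈ 0#
  bitR-zero (yes a) {x} h = transᴿ (⊠-identityˡ x) (h a)
  bitR-zero (no _)  {x} h = ⊠-zeroˡ x

  -- Two truncations may be exchanged where the summand vanishes or where they agree; this carries
  -- the condition of lightness through a reindexing.
  bitR-transfer : {A B : Set} (A? : Dec A) (B? : Dec B) {x y : Carrier} → x ≈ y →
                  x ≈ 0# ⊎ ((A → B) × (B → A)) → bitR A? ⊠ x ≈ bitR B? ⊠ y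
  bitR-transfer A? B? x≈y (inj₁ x≈0) =
    transᴿ (bitR-zero A? (λ _ → x≈0)) (symᴿ (bitR-zero B? (λ _ → transᴿ (symᴿ x≈y) x≈0)))
  bitR-transfer (yes a) (yes b) x≈y (inj₂ (f , g)) = ⊠-congˡ x≈y
  bitR-transfer (yes a) (no ¬b) x≈y (inj₂ (f , g)) = contradiction (f a) ¬b
  bitR-transfer (no ¬a) (yes b) x≈y (inj₂ (f , g)) = contradiction (g b) ¬a
  bitR-transfer (no ¬a) (no ¬b) x≈y (inj₂ (f , g)) = ⊠-congˡ x≈y

  module VectorSum (p : ℕ) where

    ΣV : ∀ n → (Vec (Fin p) n → Carrier) → Carrier
    ΣV zero    H = H []
    ΣV (suc n) H = sum (λ j → ΣV n (λ v → H (j ∷ v)))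

    ΣV-cong : ∀ n {H K} → (∀ v → H v ≈ K v) → ΣV n H ≈ ΣV n K
    ΣV-cong zero    h = h []
    ΣV-cong (suc n) h = sum-cong-≋ (λ j → ΣV-cong n (λ v → h (j ∷ v)))

    ΣV-zero : ∀ n {H} → (∀ v → H v ≈ 0#) → ΣV n H ≈ 0#
    ΣV-zero zero    h = h []
    ΣV-zero (suc n) h = sum-zero (λ j → ΣV-zero n (λ v → h (j ∷ v)))

    ΣV-+ : ∀ n H K → ΣV n (λ v → H v ⊞ K v) ≈ ΣV n H ⊞ ΣV n K
    ΣV-+ zero    H K = reflᴿ
    ΣV-+ (suc n) H K = transᴿ (sum-cong-≋ (λ j → ΣV-+ n (λ v → H (j ∷ v)) (λ v → K (j ∷ v)))) (∑-distrib-+ {p} (λ j → ΣV n (λ v → H (j ∷ v))) (λ j → ΣV n (λ v → K (j ∷ v))))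

    ΣV-*ˡ : ∀ n c H → ΣV n (λ v → c ⊠ H v) ≈ c ⊠ ΣV n H
    ΣV-*ˡ zero    c H = reflᴿ
    ΣV-*ˡ (suc n) c H = transᴿ (sum-cong-≋ (λ j → ΣV-*ˡ n c (λ v → H (j ∷ v)))) (symᴿ (*-distribˡ-sum {p} c (λ j → ΣV n (λ v → H (j ∷ v)))))

    ΣV-sum : ∀ n {k} (H : Fin k → Vec (Fin p) n → Carrier) →
             ΣV n (λ v → sum (λ i → H i v)) ≈ sum (λ i → ΣV n (H i))
    ΣV-sum zero    H = reflᴿ
    ΣV-sum (suc n) {k} H = transᴿ (sum-cong-≋ (λ j → ΣV-sum n (λ i v → H i (j ∷ v)))) (∑-comm {p} {k} (λ j i → ΣV n (λ v → H i (j ∷ v))))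

    -- Both sides count every vector p times: on the right, once for each value of the entry that
    -- was overwritten.
    resample : ∀ n (i : Fin n) H → sum {p} (λ _ → ΣV n H) ≈ ΣV n (λ v → sum (λ j → H (v [ i ]≔ j)))
    resample (suc n) zero    H = sum-cong-≋ {p} (λ _ → symᴿ (ΣV-sum n (λ j v → H (j ∷ v))))
    resample (suc n) (suc i) H = transᴿ (∑-comm {p} {p} (λ _ j → ΣV n (λ v → H (j ∷ v))))
      (sum-cong-≋ (λ j → resample n i (λ v → H (j ∷ v))))

    ΣV-translate : ∀ (π : Fin p → Permutation′ p) n (w : Vec (Fin p) n) H →
      ΣV n H ≈ ΣV n (λ v → H (zipWith (λ i j → π i ⟨$⟩ʳ j) w v))
    ΣV-translate π zero    []      H = reflᴿ
    ΣV-translate π (suc n) (i ∷ w) H = transᴿ (∑-permute (λ j → ΣV n (λ v → H (j ∷ v))) (π i))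
      (sum-cong-≋ (λ j → ΣV-translate π n w (λ v → H ((π i ⟨$⟩ʳ j) ∷ v))))

  module _ (p′ : ℕ) where
    open VectorSum (suc p′)

    ΣV-only-zero : ∀ n H → (∀ v → v ≢ replicate n zero → H v ≈ 0#) → ΣV n H ≈ H (replicate n zero)
    ΣV-only-zero zero    H h = reflᴿ
    ΣV-only-zero (suc n) H h = transᴿ
      (sum-only {f = λ j → ΣV n (λ v → H (j ∷ v))} zero
        (λ j j≢0 → ΣV-zero n (λ v → h (j ∷ v) (λ eq → j≢0 (Vecₚ.∷-injectiveˡ eq)))))
      (ΣV-only-zero n (λ v → H (zero ∷ v)) (λ v v≢ → h (zero ∷ v) (λ eq → v≢ (Vecₚ.∷-injectiveʳ eq))))

    ΣV≥1 : ∀ n H → (∀ v → 1# ≤ᵣ H v) → 1# ≤ᵣ ΣV n H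
    ΣV≥1 zero    H h = h []
    ΣV≥1 (suc n) H h = sum≥1 p′ (λ j → ΣV≥1 n (λ v → H (j ∷ v)) (λ v → h (j ∷ v)))

-- A finite search, because `null-suc` has to decide whether some light combination makes the form
-- sparse.
searchVec : ∀ {p} n {A : Vec (Fin p) n → Set} → (∀ v → Dec (A v)) → Dec (∃ A)
searchVec zero    A? with A? []
... | yes a = yes ([] , a)
... | no ¬a = no λ { ([] , a) → ¬a a }
searchVec (suc n) A? with Finₚ.any? (λ j → searchVec n (λ v → A? (j ∷ v)))
... | yes (j , v , a) = yes (j ∷ v , a)
... | no none         = no λ { (j ∷ v , a) → none (j , v , a) }

-- Evaluation of polynomials and linear functionals on them

module Evaluation (R : RealField lzero lzero) where
  open Field R

  power : Carrier → ℕ → Carrier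
  power a zero    = 1#
  power a (suc k) = a ⊠ power a k

  evalMono : ∀ {n} → (Fin n → Carrier) → Vec ℕ n → Carrier
  evalMono v []      = 1#
  evalMono v (k ∷ μ) = power (v zero) k ⊠ evalMono (v ∘ suc) μ

  evalMono-one : ∀ n (v : Fin n → Carrier) → evalMono v (replicate n 0) ≈ 1#
  evalMono-one zero    v = reflᴿ
  evalMono-one (suc n) v = transᴿ (⊠-identityˡ _) (evalMono-one n (v ∘ suc))

  evalMono-+ : ∀ {n} (v : Fin n → Carrier) i ν μ → lookup ν i ≡ 1 → (∀ j → j ≢ i → lookup ν j ≡ 0) →
               evalMono v (zipWith _+_ ν μ) ≈ v i ⊠ evalMono v μ
  evalMono-+ v zero (k ∷ ν) (l ∷ μ) refl h =
    transᴿ (⊠-congˡ (reflexive (cong (evalMono (v ∘ suc)) (zeros ν μ (λ j → h (suc j) (λ ())))))) (⊠-assoc _ _ _)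
    where
    zeros : ∀ {n} (ν μ : Vec ℕ n) → (∀ j → lookup ν j ≡ 0) → zipWith _+_ ν μ ≡ μ
    zeros []      []      h = refl
    zeros (k ∷ ν) (l ∷ μ) h = cong₂ _∷_ (cong (_+ l) (h zero)) (zeros ν μ (h ∘ suc))
  evalMono-+ v (suc i) (k ∷ ν) (l ∷ μ) eq h rewrite h zero (λ ()) = begin
    power (v zero) l ⊠ evalMono (v ∘ suc) (zipWith _+_ ν μ)
      ≈⟨ ⊠-congˡ (evalMono-+ (v ∘ suc) i ν μ eq (λ j j≢i → h (suc j) (j≢i ∘ Finₚ.suc-injective))) ⟩
    power (v zero) l ⊠ (v (suc i) ⊠ evalMono (v ∘ suc) μ) ≈⟨ ⊠-assoc _ _ _ ⟨
    power (v zero) l ⊠ v (suc i) ⊠ evalMono (v ∘ suc) μ   ≈⟨ ⊠-congʳ (⊠-comm _ _) ⟩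
    v (suc i) ⊠ power (v zero) l ⊠ evalMono (v ∘ suc) μ   ≈⟨ ⊠-assoc _ _ _ ⟩
    v (suc i) ⊠ (power (v zero) l ⊠ evalMono (v ∘ suc) μ) ∎

  module Functional (N : ℕ) where
    open Poly R N

    -- The exponents in `unitMono` come from a helper local to it; pairing an unsolved function with
    -- `refl` gives them a name.
    unitExponent : ∀ i → Σ (Fin N → ℕ) λ f → unitMono i ≡ Vec.tabulate f
    unitExponent i = _ , refl

    unitExponent-≡ : ∀ i → proj₁ (unitExponent i) i ≡ 1
    unitExponent-≡ i with i Finₚ.≟ i
    ... | yes _ = refl
    ... | no ≢  = contradiction refl ≢

    unitExponent-≢ : ∀ i j → j ≢ i → proj₁ (unitExponent i) j ≡ 0
    unitExponent-≢ i j j≢i with i Finₚ.≟ j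
    ... | yes i≡j = contradiction (sym i≡j) j≢i
    ... | no _    = refl

    evalMono-unit : ∀ (v : Fin N → Carrier) i μ → evalMono v (unitMono i ·ₘ μ) ≈ v i ⊠ evalMono v μ
    evalMono-unit v i μ = evalMono-+ v i (unitMono i) μ
      (trans (Vecₚ.lookup∘tabulate (proj₁ (unitExponent i)) i) (unitExponent-≡ i))
      (λ j j≢i → trans (Vecₚ.lookup∘tabulate (proj₁ (unitExponent i)) j) (unitExponent-≢ i j j≢i))

    lin : (Mono → Carrier) → Polynomial → Carrier
    lin Λ []            = 0#
    lin Λ ((a , μ) ∷ P) = a ⊠ Λ μ ⊞ lin Λ P

    lin-cong : ∀ {Λ Λ′} P → (∀ μ → Λ μ ≈ Λ′ μ) → lin Λ P ≈ lin Λ′ P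
    lin-cong []            h = reflᴿ
    lin-cong ((a , μ) ∷ P) h = ⊞-cong (⊠-congˡ (h μ)) (lin-cong P h)

    lin-++ : ∀ Λ P Q → lin Λ (P ++ Q) ≈ lin Λ P ⊞ lin Λ Q
    lin-++ Λ []            Q = symᴿ (⊞-identityˡ _)
    lin-++ Λ ((a , μ) ∷ P) Q = transᴿ (⊞-congˡ (lin-++ Λ P Q)) (symᴿ (⊞-assoc _ _ _))

    lin-scale : ∀ Λ a P → lin Λ (scale a P) ≈ a ⊠ lin Λ P
    lin-scale Λ a []            = symᴿ (⊠-zeroʳ a)
    lin-scale Λ a ((b , μ) ∷ P) = transᴿ (⊞-cong (⊠-assoc a b (Λ μ)) (lin-scale Λ a P)) (symᴿ (⊠-distribˡ-⊞ a _ _))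

    lin-mulVar : ∀ Λ i P → lin Λ (mulVar i P) ≡ lin (λ μ → Λ (unitMono i ·ₘ μ)) P
    lin-mulVar Λ i []            = refl
    lin-mulVar Λ i ((a , μ) ∷ P) = cong (a ⊠ Λ (unitMono i ·ₘ μ) ⊞_) (lin-mulVar Λ i P)

    lin-⊠ : ∀ c Λ P → lin (λ μ → c ⊠ Λ μ) P ≈ c ⊠ lin Λ P
    lin-⊠ c Λ []            = symᴿ (⊠-zeroʳ c)
    lin-⊠ c Λ ((a , μ) ∷ P) = transᴿ (⊞-cong swap (lin-⊠ c Λ P)) (symᴿ (⊠-distribˡ-⊞ c _ _))
      where
      swap : a ⊠ (c ⊠ Λ μ) ≈ c ⊠ (a ⊠ Λ μ)
      swap = transᴿ (symᴿ (⊠-assoc a c _)) (transᴿ (⊠-congʳ (⊠-comm a c)) (⊠-assoc c a _))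

    _≟ᴹ_ : (ν μ : Mono) → Dec (ν ≡ μ)
    _≟ᴹ_ = Vecₚ.≡-dec _≟_

    -- A list may repeat a monomial with cancelling coefficients, and degree bounds speak only of
    -- total coefficients. So all occurrences of a monomial have to be collected before its
    -- contribution can be judged.
    remove : Mono → Polynomial → Polynomial
    remove ν []            = []
    remove ν ((a , μ) ∷ P) with μ ≟ᴹ ν
    ... | yes _ = remove ν P
    ... | no _  = (a , μ) ∷ remove ν P

    lin-remove : ∀ Λ ν P → lin Λ P ≈ coeff P ν ⊠ Λ ν ⊞ lin Λ (remove ν P)
    lin-remove Λ ν []            = symᴿ (transᴿ (⊞-identityʳ _) (⊠-zeroˡ _))
    lin-remove Λ ν ((a , μ) ∷ P) with μ ≟ᴹ ν
    ... | yes refl = begin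
      a ⊠ Λ ν ⊞ lin Λ P                                      ≈⟨ ⊞-congˡ (lin-remove Λ ν P) ⟩
      a ⊠ Λ ν ⊞ (coeff P ν ⊠ Λ ν ⊞ lin Λ (remove ν P))       ≈⟨ ⊞-assoc _ _ _ ⟨
      a ⊠ Λ ν ⊞ coeff P ν ⊠ Λ ν ⊞ lin Λ (remove ν P)         ≈⟨ ⊞-congʳ (⊠-distribʳ-⊞ _ _ _) ⟨
      (a ⊞ coeff P ν) ⊠ Λ ν ⊞ lin Λ (remove ν P)             ∎
    ... | no _ = begin
      a ⊠ Λ μ ⊞ lin Λ P                                      ≈⟨ ⊞-congˡ (lin-remove Λ ν P) ⟩
      a ⊠ Λ μ ⊞ (coeff P ν ⊠ Λ ν ⊞ lin Λ (remove ν P))       ≈⟨ ⊞-assoc _ _ _ ⟨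
      a ⊠ Λ μ ⊞ coeff P ν ⊠ Λ ν ⊞ lin Λ (remove ν P)         ≈⟨ ⊞-congʳ (⊞-comm _ _) ⟩
      coeff P ν ⊠ Λ ν ⊞ a ⊠ Λ μ ⊞ lin Λ (remove ν P)         ≈⟨ ⊞-assoc _ _ _ ⟩
      coeff P ν ⊠ Λ ν ⊞ (a ⊠ Λ μ ⊞ lin Λ (remove ν P))       ∎

    coeff-remove-≡ : ∀ ν P → coeff (remove ν P) ν ≈ 0#
    coeff-remove-≡ ν []            = reflᴿ
    coeff-remove-≡ ν ((a , μ) ∷ P) with μ ≟ᴹ ν in eq
    ... | yes _ = coeff-remove-≡ ν P
    ... | no _  rewrite eq = coeff-remove-≡ ν P

    coeff-remove-≢ : ∀ ν P μ → ν ≢ μ → coeff (remove ν P) μ ≈ coeff P μ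
    coeff-remove-≢ ν []            μ ν≢μ = reflᴿ
    coeff-remove-≢ ν ((a , κ) ∷ P) μ ν≢μ with κ ≟ᴹ ν
    coeff-remove-≢ ν ((a , κ) ∷ P) μ ν≢μ | yes refl with κ ≟ᴹ μ
    ... | yes κ≡μ = contradiction κ≡μ ν≢μ
    ... | no _    = coeff-remove-≢ ν P μ ν≢μ
    coeff-remove-≢ ν ((a , κ) ∷ P) μ ν≢μ | no _ with κ ≟ᴹ μ
    ... | yes _ = ⊞-congˡ (coeff-remove-≢ ν P μ ν≢μ)
    ... | no _  = coeff-remove-≢ ν P μ ν≢μ

    length-remove : ∀ ν P → length (remove ν P) ≤ length P
    length-remove ν []            = z≤n
    length-remove ν ((a , μ) ∷ P) with μ ≟ᴹ ν
    ... | yes _ = m≤n⇒m≤1+n (length-remove ν P)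
    ... | no _  = s≤s (length-remove ν P)

    length-remove-head : ∀ a ν P → length (remove ν ((a , ν) ∷ P)) ≤ length P
    length-remove-head a ν P with ν ≟ᴹ ν
    ... | yes _ = length-remove ν P
    ... | no ≢  = contradiction refl ≢

    lin-vanish : ∀ Λ P → (∀ μ → coeff P μ ≈ 0# ⊎ Λ μ ≈ 0#) → lin Λ P ≈ 0#
    lin-vanish Λ P = go (length P) P ≤-refl
      where
      -- `remove` returns a shorter list that is not a subterm, so the recursion is on a bound for
      -- the length.
      go : ∀ k P → length P ≤ k → (∀ μ → coeff P μ ≈ 0# ⊎ Λ μ ≈ 0#) → lin Λ P ≈ 0#
      go k       []              le h = reflᴿ
      go (suc k) Q@((a , ν) ∷ P) le h = begin
        lin Λ Q                                  ≈⟨ lin-remove Λ ν Q ⟩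
        coeff Q ν ⊠ Λ ν ⊞ lin Λ (remove ν Q)     ≈⟨ ⊞-cong (product (h ν)) (go k (remove ν Q) shorter h′) ⟩
        0# ⊞ 0#                                  ≈⟨ ⊞-identityˡ 0# ⟩
        0#                                       ∎
        where
        product : ∀ {x y} → x ≈ 0# ⊎ y ≈ 0# → x ⊠ y ≈ 0#
        product (inj₁ x≈0) = transᴿ (⊠-congʳ x≈0) (⊠-zeroˡ _)
        product (inj₂ y≈0) = transᴿ (⊠-congˡ y≈0) (⊠-zeroʳ _)
        shorter : length (remove ν Q) ≤ k
        shorter = ≤-trans (length-remove-head a ν P) (s≤s⁻¹ le)
        h′ : ∀ μ → coeff (remove ν Q) μ ≈ 0# ⊎ Λ μ ≈ 0#
        h′ μ with ν ≟ᴹ μ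
        ... | yes refl = inj₁ (coeff-remove-≡ ν Q)
        ... | no ν≢μ with h μ
        ...   | inj₁ c≈0 = inj₁ (transᴿ (coeff-remove-≢ ν Q μ ν≢μ) c≈0)
        ...   | inj₂ Λ≈0 = inj₂ Λ≈0

    lin-one : ∀ Λ P → IsOne P → lin Λ P ≈ Λ oneMono
    lin-one Λ P (c≈1 , c≈0) = begin
      lin Λ P                                              ≈⟨ lin-remove Λ oneMono P ⟩
      coeff P oneMono ⊠ Λ oneMono ⊞ lin Λ (remove oneMono P)
        ≈⟨ ⊞-cong (transᴿ (⊠-congʳ c≈1) (⊠-identityˡ _)) (lin-vanish Λ (remove oneMono P) (inj₁ ∘ rest)) ⟩
      Λ oneMono ⊞ 0#                                       ≈⟨ ⊞-identityʳ _ ⟩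
      Λ oneMono                                            ∎
      where
      rest : ∀ μ → coeff (remove oneMono P) μ ≈ 0#
      rest μ with oneMono ≟ᴹ μ
      ... | yes refl = coeff-remove-≡ oneMono P
      ... | no ≢     = transᴿ (coeff-remove-≢ oneMono P μ ≢) (c≈0 μ (≢ ∘ sym))

-- The Polynomial Calculus lower bound

module Kernel (R : RealField lzero lzero) (p′ : ℕ) (prime : Prime (suc (suc p′))) where
  open Field R
  open Residue p′ prime
  open VectorSum p

  -- Plays the part of a nontrivial character of ℤ/p; mean zero says that the trivial character is
  -- absent.
  record Wave (u : ℤ → Carrier) : Set where
    field
      periodic : ∀ {a b} → a ≡ₚ b → u a ≈ u b
      mean     : sum (λ j → u ⟦ j ⟧) ≈ 0#

    progression-sum : ∀ s {t} → ¬ P ℤ∣.∣ t → sum (λ j → u (s ℤ.+ ⟦ j ⟧ ℤ.* t)) ≈ 0#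
    progression-sum s {t} p∤t = begin
      sum (λ j → u (s ℤ.+ ⟦ j ⟧ ℤ.* t))      ≈⟨ sum-cong-≋ (λ j → periodic (proj₂ (progression s t p∤t) j)) ⟩
      sum (λ j → u ⟦ π ⟨$⟩ʳ j ⟧)             ≈⟨ ∑-permute (λ j → u ⟦ j ⟧) π ⟨
      sum (λ j → u ⟦ j ⟧)                    ≈⟨ mean ⟩
      0#                                     ∎
      where
      π = proj₁ (progression s t p∤t)

    cong-u : ∀ {a b} → a ≡ b → u a ≈ u b
    cong-u eq = reflexive (cong u eq)

  -- The pulse at 0 minus the pulse at 1, a mean-zero function with value 1 at 0.
  pulse : ℤ → Carrier
  pulse z = bitR (P ℤ∣.∣? z) ⊞ ⊟ bitR (P ℤ∣.∣? (z ℤ.- 1ℤ))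

  pulse-wave : Wave pulse
  pulse-wave = record { periodic = periodic ; mean = mean }
    where
    bitR-cong : ∀ {a b} → a ≡ₚ b → bitR (P ℤ∣.∣? a) ≈ bitR (P ℤ∣.∣? b)
    bitR-cong {a} {b} a≡b with P ℤ∣.∣? b
    ... | yes d = bitR-yes (P ℤ∣.∣? a) (∣-resp-≡ₚ a≡b d)
    ... | no ∤  = bitR-no (P ℤ∣.∣? a) (λ d → ∤ (∣-resp-≡ₚ (≡ₚ-sym a≡b) d))

    periodic : ∀ {a b} → a ≡ₚ b → pulse a ≈ pulse b
    periodic a≡b = ⊞-cong (bitR-cong a≡b) (⊟-cong (bitR-cong (≡ₚ-+ a≡b (≡⇒≡ₚ refl))))

    only : ∀ (i : Fin p) → sum (λ j → bitR (P ℤ∣.∣? (⟦ j ⟧ ℤ.- ⟦ i ⟧))) ≈ 1#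
    only i = transᴿ (sum-only i (λ j j≢i → bitR-no (P ℤ∣.∣? _) (λ d → j≢i (⟦⟧-injective (mod d)))))
      (bitR-yes (P ℤ∣.∣? _) (_≡ₚ_.dividesDifference (≡⇒≡ₚ {⟦ i ⟧} refl)))

    mean : sum (λ j → pulse ⟦ j ⟧) ≈ 0#
    mean = begin
      sum (λ j → pulse ⟦ j ⟧)
        ≈⟨ ∑-distrib-+ {p} (λ j → bitR (P ℤ∣.∣? ⟦ j ⟧)) (λ j → ⊟ bitR (P ℤ∣.∣? (⟦ j ⟧ ℤ.- 1ℤ))) ⟩
      sum (λ j → bitR (P ℤ∣.∣? ⟦ j ⟧)) ⊞ sum (λ j → ⊟ bitR (P ℤ∣.∣? (⟦ j ⟧ ℤ.- 1ℤ)))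
        ≈⟨ ⊞-cong (sum-cong-≋ {p} (λ j → reflexive (cong (λ z → bitR (P ℤ∣.∣? z)) (sym (ℤₚ.+-identityʳ ⟦ j ⟧)))))
                  (sum-neg p (λ j → bitR (P ℤ∣.∣? (⟦ j ⟧ ℤ.- 1ℤ)))) ⟩
      sum (λ j → bitR (P ℤ∣.∣? (⟦ j ⟧ ℤ.- ⟦ zero ⟧))) ⊞ ⊟ sum (λ j → bitR (P ℤ∣.∣? (⟦ j ⟧ ℤ.- ⟦ suc zero ⟧)))
        ≈⟨ ⊞-cong (only zero) (⊟-cong (only (suc zero))) ⟩
      1# ⊞ ⊟ 1#  ≈⟨ ⊟-inverseʳ 1# ⟩
      0#         ∎

  pulse-0 : pulse 0ℤ ≈ 1#
  pulse-0 = transᴿ (⊞-cong (bitR-yes (P ℤ∣.∣? 0ℤ) (divides 0ℤ refl))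
    (transᴿ (⊟-cong (bitR-no (P ℤ∣.∣? (0ℤ ℤ.- 1ℤ)) (λ d → p∤1 (ℤ∣.∣m⇒∣-m d)))) ⊟-zero)) (⊞-identityʳ 1#)

  module _ {m : ℕ} where

    Point : Set
    Point = Vec (Fin p) m

    -- For a character u and an affine form θ this would be a Fourier coefficient of φ.
    I : (Point → Carrier) → (Point → ℤ) → (ℤ → Carrier) → Carrier
    I φ θ u = ΣV m (λ x → φ x ⊠ u (θ x))

    I-congˡ : ∀ {φ φ′} θ u → (∀ x → φ x ≈ φ′ x) → I φ θ u ≈ I φ′ θ u
    I-congˡ θ u h = ΣV-cong m (λ x → ⊠-congʳ (h x))

    I-congʳ : ∀ φ θ θ′ {u} → Wave u → (∀ x → θ x ≡ₚ θ′ x) → I φ θ u ≈ I φ θ′ u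
    I-congʳ φ θ θ′ wave h = ΣV-cong m (λ x → ⊠-congˡ (Wave.periodic wave (h x)))

    I-zero : ∀ {φ} θ u → (∀ x → φ x ≈ 0#) → I φ θ u ≈ 0#
    I-zero θ u h = ΣV-zero m (λ x → transᴿ (⊠-congʳ (h x)) (⊠-zeroˡ _))

    I-⊞ : ∀ φ ψ θ u → I (λ x → φ x ⊞ ψ x) θ u ≈ I φ θ u ⊞ I ψ θ u
    I-⊞ φ ψ θ u = transᴿ (ΣV-cong m (λ x → ⊠-distribʳ-⊞ (u (θ x)) (φ x) (ψ x)))
                         (ΣV-+ m (λ x → φ x ⊠ u (θ x)) (λ x → ψ x ⊠ u (θ x)))

    I-⊠ : ∀ c φ θ u → I (λ x → c ⊠ φ x) θ u ≈ c ⊠ I φ θ u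
    I-⊠ c φ θ u = transᴿ (ΣV-cong m (λ x → ⊠-assoc c (φ x) _)) (ΣV-*ˡ m c (λ x → φ x ⊠ u (θ x)))

    table : Fin m → (Fin p → Carrier) → (Point → Carrier) → Point → Carrier
    table e w φ x = w (lookup x e) ⊠ φ x

    -- The Fourier expansion of a function of one coordinate. At a point x, the inner sum for i =
    -- x_e has p equal terms, and for any other i it runs over a full progression and vanishes.
    spread : ∀ e w φ θ {u} → Wave u →
      sum {p} (λ _ → I (table e w φ) θ u) ≈ sum (λ i → w i ⊠ sum (λ j → I φ (tilt θ e i j) u))
    spread e w φ θ {u} wave = begin
      sum {p} (λ _ → I (table e w φ) θ u)
        ≈⟨ ΣV-sum m {p} (λ _ x → table e w φ x ⊠ u (θ x)) ⟨
      ΣV m (λ x → sum {p} (λ _ → table e w φ x ⊠ u (θ x)))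
        ≈⟨ ΣV-cong m pointwise ⟩
      ΣV m (λ x → sum (λ i → w i ⊠ sum (λ j → φ x ⊠ u (tilt θ e i j x))))
        ≈⟨ ΣV-sum m {p} (λ i x → w i ⊠ sum (λ j → φ x ⊠ u (tilt θ e i j x))) ⟩
      sum (λ i → ΣV m (λ x → w i ⊠ sum (λ j → φ x ⊠ u (tilt θ e i j x))))
        ≈⟨ sum-cong-≋ {p} (λ i → transᴿ (ΣV-*ˡ m (w i) (λ x → sum (λ j → φ x ⊠ u (tilt θ e i j x))))
             (⊠-congˡ (ΣV-sum m {p} (λ j x → φ x ⊠ u (tilt θ e i j x))))) ⟩
      sum (λ i → w i ⊠ sum (λ j → I φ (tilt θ e i j) u)) ∎
      where
      pointwise : ∀ x → sum {p} (λ _ → table e w φ x ⊠ u (θ x)) ≈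
                        sum (λ i → w i ⊠ sum (λ j → φ x ⊠ u (tilt θ e i j x)))
      pointwise x = begin
        sum {p} (λ _ → w i₀ ⊠ φ x ⊠ u (θ x))              ≈⟨ sum-cong-≋ {p} (λ _ → ⊠-assoc (w i₀) (φ x) (u (θ x))) ⟩
        sum {p} (λ _ → w i₀ ⊠ (φ x ⊠ u (θ x)))            ≈⟨ *-distribˡ-sum {p} (w i₀) (λ _ → φ x ⊠ u (θ x)) ⟨
        w i₀ ⊠ sum {p} (λ _ → φ x ⊠ u (θ x))
          ≈⟨ ⊠-congˡ (sum-cong-≋ {p} (λ j → ⊠-congˡ {φ x} (Wave.cong-u wave (lem (θ x) ⟦ j ⟧ ⟦ i₀ ⟧)))) ⟩
        w i₀ ⊠ sum (λ j → φ x ⊠ u (tilt θ e i₀ j x))      ≈⟨ sum-only {f = term} i₀ others ⟨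
        sum term                                           ∎
        where
        i₀ = lookup x e
        term : Fin p → Carrier
        term i = w i ⊠ sum (λ j → φ x ⊠ u (tilt θ e i j x))
        lem : ∀ t j i → t ≡ t ℤ.+ j ℤ.* (i ℤ.- i)
        lem = ℤ-solve-∀
        others : ∀ i → i ≢ i₀ → term i ≈ 0#
        others i i≢i₀ = begin
          w i ⊠ sum (λ j → φ x ⊠ u (tilt θ e i j x))
            ≈⟨ ⊠-congˡ (*-distribˡ-sum {p} (φ x) (λ j → u (tilt θ e i j x))) ⟨
          w i ⊠ (φ x ⊠ sum (λ j → u (tilt θ e i j x)))
            ≈⟨ ⊠-congˡ (⊠-congˡ (Wave.progression-sum wave (θ x) (λ d → i≢i₀ (sym (⟦⟧-injective (mod d)))))) ⟩
          w i ⊠ (φ x ⊠ 0#)   ≈⟨ ⊠-congˡ (⊠-zeroʳ _) ⟩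
          w i ⊠ 0#           ≈⟨ ⊠-zeroʳ _ ⟩
          0#                 ∎

    spread-zero : ∀ (w : Fin p → Carrier) (X : Fin p → Fin p → Carrier) → (∀ i j → X i j ≈ 0#) →
                  sum (λ i → w i ⊠ sum (X i)) ≈ 0#
    spread-zero w X h = sum-zero {p} (λ i → transᴿ (⊠-congˡ {w i} (sum-zero (h i))) (⊠-zeroʳ _))

    -- Fourier degree at most k, expressed without roots of unity.
    Junta : ℕ → (Point → Carrier) → Set
    Junta k φ = ∀ a c {u} → Wave u → k < weight a → I φ (affine a c) u ≈ 0#

    junta-cong : ∀ {k φ φ′} → (∀ x → φ x ≈ φ′ x) → Junta k φ → Junta k φ′
    junta-cong h J a c {u} wave lt = transᴿ (I-congˡ (affine a c) u (λ x → symᴿ (h x))) (J a c wave lt)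

    -- `spread` reduces to tilted forms, and tilting removes at most one variable, so more than k of
    -- them remain.
    junta-table : ∀ {k φ} e w → Junta k φ → Junta (suc k) (table e w φ)
    junta-table {k} {φ} e w J a c {u} wave lt = replicate-cancel (suc p′)
      (transᴿ (spread e w φ (affine a c) wave) (spread-zero w _ (λ i j →
        transᴿ (I-congʳ φ (tilt (affine a c) e i j) (affine (λ e′ → a e′ ℤ.+ single e ⟦ j ⟧ e′) (c ℤ.- ⟦ j ⟧ ℤ.* ⟦ i ⟧))
                        wave (λ x → ≡⇒≡ₚ (tilt-affine a c e i j x)))
               (J (λ e′ → a e′ ℤ.+ single e ⟦ j ⟧ e′) (c ℤ.- ⟦ j ⟧ ℤ.* ⟦ i ⟧) wave (s≤s⁻¹ (≤-trans lt (weight-tilt a e j)))))))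

  -- Sum first over a coordinate whose coefficient is nonzero modulo p: the form then runs through a
  -- progression.
  junta-one : ∀ {m} → Junta {m} 0 (λ _ → 1#)
  junta-one {m} a c {u} wave lt = transᴿ (ΣV-cong m (λ x → ⊠-identityˡ _)) (vanish m a c (proj₁ nz) (proj₂ nz))
    where
    nz = weight>0 a lt
    vanish : ∀ m a c (e : Fin m) → ¬ P ℤ∣.∣ a e → ΣV m (λ x → u (affine a c x)) ≈ 0#
    vanish (suc m) a c zero ∤ = begin
      sum (λ j → ΣV m (λ x → u (affine a c (j ∷ x))))   ≈⟨ ΣV-sum m {p} (λ j x → u (affine a c (j ∷ x))) ⟨
      ΣV m (λ x → sum (λ j → u (affine a c (j ∷ x))))
        ≈⟨ ΣV-zero m (λ x → transᴿ (sum-cong-≋ {p} (λ j → Wave.cong-u wave (lem (a zero) ⟦ j ⟧ (dot (a ∘ suc) x) c)))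
             (Wave.progression-sum wave (dot (a ∘ suc) x ℤ.+ c) ∤)) ⟩
      0# ∎
      where
      lem : ∀ a j d c → a ℤ.* j ℤ.+ d ℤ.+ c ≡ d ℤ.+ c ℤ.+ j ℤ.* a
      lem = ℤ-solve-∀
    vanish (suc m) a c (suc e) ∤ = sum-zero (λ j → transᴿ
      (ΣV-cong m (λ x → Wave.cong-u wave (lem (a zero ℤ.* ⟦ j ⟧) (dot (a ∘ suc) x) c)))
      (vanish m (a ∘ suc) (a zero ℤ.* ⟦ j ⟧ ℤ.+ c) e ∤))
      where
      lem : ∀ b d c → b ℤ.+ d ℤ.+ c ≡ d ℤ.+ (b ℤ.+ c)
      lem = ℤ-solve-∀

  module _ {m : ℕ} where
    open Evaluation R

    junta-power : ∀ {k φ} e w (t : ℕ) → Junta {m} k φ → Junta (t + k) (λ x → power (w (lookup x e)) t ⊠ φ x)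
    junta-power {k} {φ} e w zero    J = junta-cong (λ x → symᴿ (⊠-identityˡ (φ x))) J
    junta-power e w (suc t) J = junta-cong (λ x → symᴿ (⊠-assoc _ _ _)) (junta-table e w (junta-power e w t J))

    junta-evalMono : ∀ {n} (edge : Fin n → Fin m) (w : Fin n → Fin p → Carrier) μ →
      Junta (Vec.sum μ) (λ x → evalMono (λ i → w i (lookup x (edge i))) μ)
    junta-evalMono edge w []      = junta-one
    junta-evalMono edge w (k ∷ μ) = junta-power (edge zero) (w zero) k (junta-evalMono (edge ∘ suc) (w ∘ suc) μ)

-- The pairing with light combinations

module LowerBound (R : RealField lzero lzero) (p′ : ℕ) (prime : Prime (suc (suc p′)))
                  (sys : Residue.System p′ prime) where
  open Field R
  open Residue p′ prime
  open VectorSum p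
  open Kernel R p′ prime
  open System sys

  Ψ : Vec (Fin p) rows → Vec (Fin p) m → ℤ
  Ψ F x = dot (λ q → ℓ q x) F

  phase : (Vec (Fin p) m → ℤ) → Vec (Fin p) rows → Vec (Fin p) m → ℤ
  phase α F x = α x ℤ.+ Ψ F x

  light? : ∀ F → Dec (wt F ≤ s)
  light? F = wt F ≤? s

  summand : (Vec (Fin p) m → Carrier) → (Vec (Fin p) m → ℤ) → (ℤ → Carrier) → Vec (Fin p) rows → Carrier
  summand φ α u F = bitR (light? F) ⊠ I φ (phase α F) u

  -- Over all F, the summands at a point x that violates some row would cancel, as the multiplier of
  -- that row varies. The light F form a truncation of this projection onto the solutions, in the
  -- manner of a pseudo-expectation.
  𝓛 : (Vec (Fin p) m → Carrier) → (Vec (Fin p) m → ℤ) → (ℤ → Carrier) → Carrier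
  𝓛 φ α u = ΣV rows (summand φ α u)

  record Affine (k : ℕ) (α : Vec (Fin p) m → ℤ) : Set where
    constructor mkAffine
    field
      a     : Fin m → ℤ
      c     : ℤ
      light : weight a ≤ k
      form  : ∀ x → α x ≡ affine a c x

  Null : ℕ → (Vec (Fin p) m → Carrier) → Set
  Null k φ = ∀ {α} → Affine k α → ∀ {u} → Wave u → 𝓛 φ α u ≈ 0#

  phase-affine : ∀ α a c → (∀ x → α x ≡ affine a c x) → ∀ F x →
                 phase α F x ≡ affine (λ e → a e ℤ.+ δ F e) (c ℤ.+ ρ F) x
  phase-affine α a c form F x = trans (cong₂ ℤ._+_ (form x) (adjoint F x))
    (trans (lem (dot a x) c (dot (δ F) x) (ρ F)) (cong (ℤ._+ (c ℤ.+ ρ F)) (sym (dot-+ a (δ F) x))))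
    where
    lem : ∀ a c d r → a ℤ.+ c ℤ.+ (d ℤ.+ r) ≡ a ℤ.+ d ℤ.+ (c ℤ.+ r)
    lem = ℤ-solve-∀

  junta-phase : ∀ {k φ α a c u} → Junta k φ → (∀ x → α x ≡ affine a c x) → Wave u → ∀ F →
                k < weight (λ e → a e ℤ.+ δ F e) → I φ (phase α F) u ≈ 0#
  junta-phase {φ = φ} {α} {a} {c} J form wave F lt =
    transᴿ (I-congʳ φ (phase α F) (affine (λ e → a e ℤ.+ δ F e) (c ℤ.+ ρ F)) wave (λ x → ≡⇒≡ₚ (phase-affine α a c form F x)))
           (J (λ e → a e ℤ.+ δ F e) (c ℤ.+ ρ F) wave lt)

  -- The gap improves a bound 2s to one strictly below s. The factor 2 serves sums of two light
  -- combinations, the strictness a change of one multiplier.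
  light-if : ∀ F → weight (δ F) ≤ g → wt F ≤ s + s → suc (wt F) ≤ s
  light-if F sparse wt≤2s with gap F sparse
  ... | inj₁ le = le
  ... | inj₂ gt = ⊥-elim (<⇒≱ gt wt≤2s)

  null-cong : ∀ {k φ φ′} → (∀ x → φ x ≈ φ′ x) → Null k φ → Null k φ′
  null-cong h N {α} aff {u} wave =
    transᴿ (ΣV-cong rows (λ F → ⊠-congˡ (I-congˡ (phase α F) u (λ x → symᴿ (h x))))) (N aff wave)

  null-zero : ∀ {k φ} → (∀ x → φ x ≈ 0#) → Null k φ
  null-zero h {α} aff {u} wave = ΣV-zero rows (λ F → transᴿ (⊠-congˡ (I-zero (phase α F) u h)) (⊠-zeroʳ _))

  null-⊞ : ∀ {k φ ψ} → Null k φ → Null k ψ → Null k (λ x → φ x ⊞ ψ x)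
  null-⊞ {k} {φ} {ψ} M N {α} aff {u} wave = begin
    𝓛 (λ x → φ x ⊞ ψ x) α u
      ≈⟨ ΣV-cong rows (λ F → transᴿ (⊠-congˡ (I-⊞ φ ψ (phase α F) u)) (⊠-distribˡ-⊞ _ _ _)) ⟩
    ΣV rows (λ F → summand φ α u F ⊞ summand ψ α u F)  ≈⟨ ΣV-+ rows (summand φ α u) (summand ψ α u) ⟩
    𝓛 φ α u ⊞ 𝓛 ψ α u                                  ≈⟨ ⊞-cong (M aff wave) (N aff wave) ⟩
    0# ⊞ 0#                                            ≈⟨ ⊞-identityˡ 0# ⟩
    0#                                                 ∎

  null-⊠ : ∀ {k φ} c → Null k φ → Null k (λ x → c ⊠ φ x)
  null-⊠ {k} {φ} c N {α} aff {u} wave = begin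
    𝓛 (λ x → c ⊠ φ x) α u
      ≈⟨ ΣV-cong rows (λ F → transᴿ (⊠-congˡ (I-⊠ c φ (phase α F) u)) (swap (bitR (light? F)) c (I φ (phase α F) u))) ⟩
    ΣV rows (λ F → c ⊠ summand φ α u F)      ≈⟨ ΣV-*ˡ rows c (summand φ α u) ⟩
    c ⊠ 𝓛 φ α u                              ≈⟨ ⊠-congˡ (N aff wave) ⟩
    c ⊠ 0#                                   ≈⟨ ⊠-zeroʳ c ⟩
    0#                                       ∎
    where
    swap : ∀ b c i → b ⊠ (c ⊠ i) ≈ c ⊠ (b ⊠ i)
    swap b c i = transᴿ (symᴿ (⊠-assoc b c i)) (transᴿ (⊠-congʳ (⊠-comm b c)) (⊠-assoc c b i))

  tilt-Affine : ∀ {k α} → Affine k α → ∀ e i j → Affine (suc k) (tilt α e i j)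
  tilt-Affine {k} {α} (mkAffine a c light form) e i j =
    mkAffine (λ e′ → a e′ ℤ.+ single e ⟦ j ⟧ e′) (c ℤ.- ⟦ j ⟧ ℤ.* ⟦ i ⟧)
      (≤-trans (weight-tilt-≤ a e j) (s≤s light))
      (λ x → trans (cong (ℤ._+ ⟦ j ⟧ ℤ.* (⟦ lookup x e ⟧ ℤ.- ⟦ i ⟧)) (form x)) (tilt-affine a c e i j x))

  -- `spread` trades the factor w for tilts of α, which have at most one variable more; hence one
  -- level of `Null` is lost.
  null-table : ∀ {k φ} e w → Null (suc k) φ → Null k (table e w φ)
  null-table {k} {φ} e w N {α} aff {u} wave = replicate-cancel (suc p′) (begin
    sum {p} (λ _ → 𝓛 (table e w φ) α u)
      ≈⟨ ΣV-sum rows {p} (λ _ → summand (table e w φ) α u) ⟨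
    ΣV rows (λ F → sum {p} (λ _ → summand (table e w φ) α u F))
      ≈⟨ ΣV-cong rows termwise ⟩
    ΣV rows (λ F → sum (λ i → w i ⊠ sum (λ j → summand φ (tilt α e i j) u F)))
      ≈⟨ ΣV-sum rows {p} (λ i F → w i ⊠ sum (λ j → summand φ (tilt α e i j) u F)) ⟩
    sum (λ i → ΣV rows (λ F → w i ⊠ sum (λ j → summand φ (tilt α e i j) u F)))
      ≈⟨ sum-cong-≋ {p} (λ i → transᴿ (ΣV-*ˡ rows (w i) (λ F → sum (λ j → summand φ (tilt α e i j) u F)))
           (⊠-congˡ (ΣV-sum rows {p} (λ j → summand φ (tilt α e i j) u)))) ⟩
    sum (λ i → w i ⊠ sum (λ j → 𝓛 φ (tilt α e i j) u))
      ≈⟨ spread-zero {m} w (λ i j → 𝓛 φ (tilt α e i j) u) (λ i j → N (tilt-Affine aff e i j) wave) ⟩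
    0# ∎)
    where
    termwise : ∀ F → sum {p} (λ _ → summand (table e w φ) α u F) ≈
                     sum (λ i → w i ⊠ sum (λ j → summand φ (tilt α e i j) u F))
    termwise F = begin
      sum {p} (λ _ → χ ⊠ I (table e w φ) (phase α F) u)     ≈⟨ *-distribˡ-sum {p} χ (λ _ → I (table e w φ) (phase α F) u) ⟨
      χ ⊠ sum {p} (λ _ → I (table e w φ) (phase α F) u)     ≈⟨ ⊠-congˡ (spread e w φ (phase α F) wave) ⟩
      χ ⊠ sum (λ i → w i ⊠ sum (λ j → I φ (tilt (phase α F) e i j) u))
        ≈⟨ *-distribˡ-sum {p} χ (λ i → w i ⊠ sum (λ j → I φ (tilt (phase α F) e i j) u)) ⟩
      sum (λ i → χ ⊠ (w i ⊠ sum (λ j → I φ (tilt (phase α F) e i j) u)))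
        ≈⟨ sum-cong-≋ {p} inner ⟩
      sum (λ i → w i ⊠ sum (λ j → summand φ (tilt α e i j) u F)) ∎
      where
      χ = bitR (light? F)
      lem : ∀ a t b → a ℤ.+ b ℤ.+ t ≡ a ℤ.+ t ℤ.+ b
      lem = ℤ-solve-∀
      inner : ∀ i → χ ⊠ (w i ⊠ sum (λ j → I φ (tilt (phase α F) e i j) u)) ≈
                    w i ⊠ sum (λ j → summand φ (tilt α e i j) u F)
      inner i = begin
        χ ⊠ (w i ⊠ S)     ≈⟨ ⊠-assoc χ (w i) S ⟨
        χ ⊠ w i ⊠ S       ≈⟨ ⊠-congʳ (⊠-comm χ (w i)) ⟩
        w i ⊠ χ ⊠ S       ≈⟨ ⊠-assoc (w i) χ S ⟩
        w i ⊠ (χ ⊠ S)     ≈⟨ ⊠-congˡ (*-distribˡ-sum {p} χ (λ j → I φ (tilt (phase α F) e i j) u)) ⟩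
        w i ⊠ sum (λ j → χ ⊠ I φ (tilt (phase α F) e i j) u)
          ≈⟨ ⊠-congˡ (sum-cong-≋ {p} (λ j → ⊠-congˡ {χ} (I-congʳ φ (tilt (phase α F) e i j) (phase (tilt α e i j) F) wave
               (λ x → ≡⇒≡ₚ (lem (α x) (⟦ j ⟧ ℤ.* (⟦ lookup x e ⟧ ℤ.- ⟦ i ⟧)) (Ψ F x)))))) ⟩
        w i ⊠ sum (λ j → summand φ (tilt α e i j) u F) ∎
        where
        S = sum (λ j → I φ (tilt (phase α F) e i j) u)

  -- If some light F₀ makes α + Ψ F₀ sparse, then translating the sum over F by F₀ replaces α by that sparse
  -- form; if there is none, then every summand vanishes.
  null-suc : ∀ {k φ} → Junta k φ → suc (k + k) ≤ g → Null k φ → Null (suc k) φ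
  null-suc {k} {φ} J 2k<g N {α} (mkAffine a c light form) {u} wave
    with searchVec rows (λ F → light? F ×-dec weight (λ e → a e ℤ.+ δ F e) ≤? k)
  ... | no none = ΣV-zero rows (λ F → bitR-zero (light? F) (λ le →
          junta-phase {a = a} {c} J form wave F (≰⇒> (λ sparse → none (F , le , sparse)))))
  ... | yes (F₀ , F₀-light , F₀-sparse) = begin
    𝓛 φ α u                                       ≈⟨ ΣV-translate translation rows F₀ (summand φ α u) ⟩
    ΣV rows (λ F → summand φ α u (F₀ ⊕ᵛ F))       ≈⟨ ΣV-cong rows termwise ⟩
    𝓛 φ (phase α F₀) u                            ≈⟨ N (mkAffine a₀ (c ℤ.+ ρ F₀) F₀-sparse (phase-affine α a c form F₀)) wave ⟩
    0#                                            ∎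
    where
    a₀ : Fin m → ℤ
    a₀ e = a e ℤ.+ δ F₀ e

    shift : ∀ F x → phase α (F₀ ⊕ᵛ F) x ≡ₚ phase (phase α F₀) F x
    shift F x = ≡ₚ-trans (≡ₚ-+ (≡⇒≡ₚ {α x} refl) (dot-⊕ (λ q → ℓ q x) F₀ F))
                         (≡⇒≡ₚ (sym (ℤₚ.+-assoc (α x) (Ψ F₀ x) (Ψ F x))))

    termwise : ∀ F → summand φ α u (F₀ ⊕ᵛ F) ≈ summand φ (phase α F₀) u F
    termwise F = bitR-transfer (light? (F₀ ⊕ᵛ F)) (light? F) same alternative
      where
      same : I φ (phase α (F₀ ⊕ᵛ F)) u ≈ I φ (phase (phase α F₀) F) u
      same = I-congʳ φ (phase α (F₀ ⊕ᵛ F)) (phase (phase α F₀) F) wave (shift F)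

      lem : ∀ a b c → (a ℤ.+ b) ℤ.+ c ≡ a ℤ.+ (b ℤ.+ c)
      lem = ℤ-solve-∀

      -- Either the whole form has more than k variables and φ annihilates it, or `F` and `F₀ ⊕ᵛ F`
      -- are both sparse and the gap makes them light together.
      alternative : I φ (phase α (F₀ ⊕ᵛ F)) u ≈ 0# ⊎
                    ((wt (F₀ ⊕ᵛ F) ≤ s → wt F ≤ s) × (wt F ≤ s → wt (F₀ ⊕ᵛ F) ≤ s))
      alternative with weight (λ e → a₀ e ℤ.+ δ F e) ≤? k
      ... | no dense = inj₁ (transᴿ same (junta-phase {a = a₀} {c ℤ.+ ρ F₀} J (phase-affine α a c form F₀) wave F (≰⇒> dense)))
      ... | yes sparse = inj₂
        ( (λ le → <⇒≤ (light-if F sparse₁ (≤-trans (wt-⊕⁻ F₀ F) (+-mono-≤ F₀-light le))))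
        , (λ le → <⇒≤ (light-if (F₀ ⊕ᵛ F) sparse₂ (≤-trans (wt-⊕ F₀ F) (+-mono-≤ F₀-light le)))))
        where
        sparse₁ : weight (δ F) ≤ g
        sparse₁ = ≤-trans (weight-cancel a₀ (δ F)) (≤-trans (+-mono-≤ sparse F₀-sparse) (≤-trans (n≤1+n _) 2k<g))
        -- The whole form has at most k variables and `a` at most k+1, which is where the bound 2k+1
        -- on `g` comes from.
        sparse₂ : weight (δ (F₀ ⊕ᵛ F)) ≤ g
        sparse₂ = ≤-trans (weight-cong (δ-⊕ F₀ F)) (≤-trans (weight-cancel a (λ e → δ F₀ e ℤ.+ δ F e))
          (≤-trans (+-mono-≤ (≤-trans (weight-cong (λ e → ≡⇒≡ₚ (sym (lem (a e) (δ F₀ e) (δ F e))))) sparse) light)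
                   (≤-trans (≤-reflexive (+-suc k k)) 2k<g)))

  -- Resampling the multiplier of the row v sums u along a progression with step ℓ v x.
  null-violated : ∀ {k l φ} v → Junta l φ → l + k ≤ g → (∀ x → φ x ≈ 0# ⊎ ¬ P ℤ∣.∣ ℓ v x) → Null k φ
  null-violated {k} {l} {φ} v J l+k≤g violated {α} (mkAffine a c light form) {u} wave = replicate-cancel (suc p′) (begin
    sum {p} (λ _ → 𝓛 φ α u)
      ≈⟨ resample rows v (summand φ α u) ⟩
    ΣV rows (λ F → sum (λ j → summand φ α u (F [ v ]≔ j)))
      ≈⟨ ΣV-cong rows (λ F → transᴿ (sum-cong-≋ {p} (same F))
           (symᴿ (*-distribˡ-sum {p} (bitR (light? F)) (λ j → I φ (phase α (F [ v ]≔ j)) u)))) ⟩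
    ΣV rows (λ F → bitR (light? F) ⊠ sum (λ j → I φ (phase α (F [ v ]≔ j)) u))
      ≈⟨ ΣV-zero rows (λ F → transᴿ (⊠-congˡ (cancels F)) (⊠-zeroʳ _)) ⟩
    0# ∎)
    where
    same : ∀ F j → summand φ α u (F [ v ]≔ j) ≈ bitR (light? F) ⊠ I φ (phase α (F [ v ]≔ j)) u
    same F j = bitR-transfer (light? F′) (light? F) reflᴿ alternative
      where
      F′ = F [ v ]≔ j
      F≡ : F ≡ F′ [ v ]≔ lookup F v
      F≡ = sym (trans (Vecₚ.[]≔-idempotent F v) (Vecₚ.[]≔-lookup F v))

      alternative : I φ (phase α F′) u ≈ 0# ⊎ ((wt F′ ≤ s → wt F ≤ s) × (wt F ≤ s → wt F′ ≤ s))
      alternative with weight (λ e → a e ℤ.+ δ F′ e) ≤? l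
      ... | no dense = inj₁ (junta-phase {a = a} {c} J form wave F′ (≰⇒> dense))
      ... | yes sparse = inj₂ (down , up)
        where
        sparse′ : weight (δ F′) ≤ g
        sparse′ = ≤-trans (weight-cancel a (δ F′)) (≤-trans (+-mono-≤ sparse light) l+k≤g)
        up : wt F ≤ s → wt F′ ≤ s
        up le = <⇒≤ (light-if F′ sparse′ (≤-trans (wt-update F v j) (≤-trans (s≤s le) (+-monoˡ-≤ s 1≤s))))
        -- `F` arises from `F′` by one more update, which costs one; the strict bound on `wt F′`
        -- pays for it.
        down : wt F′ ≤ s → wt F ≤ s
        down le = ≤-trans (subst (λ E → wt E ≤ suc (wt F′)) (sym F≡) (wt-update F′ v (lookup F v)))
          (light-if F′ sparse′ (≤-trans le (m≤m+n s s)))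

    cancels : ∀ F → sum (λ j → I φ (phase α (F [ v ]≔ j)) u) ≈ 0#
    cancels F = begin
      sum (λ j → I φ (phase α (F [ v ]≔ j)) u)
        ≈⟨ ΣV-sum m {p} (λ j x → φ x ⊠ u (phase α (F [ v ]≔ j) x)) ⟨
      ΣV m (λ x → sum (λ j → φ x ⊠ u (phase α (F [ v ]≔ j) x)))
        ≈⟨ ΣV-zero m (λ x → transᴿ (symᴿ (*-distribˡ-sum {p} (φ x) (λ j → u (phase α (F [ v ]≔ j) x)))) (zero-at x)) ⟩
      0# ∎
      where
      zero-at : ∀ x → φ x ⊠ sum (λ j → u (phase α (F [ v ]≔ j) x)) ≈ 0#
      zero-at x with violated x
      ... | inj₁ φ≈0 = transᴿ (⊠-congʳ φ≈0) (⊠-zeroˡ _)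
      ... | inj₂ ∤   = transᴿ (⊠-congˡ (transᴿ (sum-cong-≋ {p} (λ j → Wave.cong-u wave
                         (trans (cong (λ z → α x ℤ.+ z) (dot-update (λ q → ℓ q x) F v j))
                                (sym (ℤₚ.+-assoc (α x) (Ψ (F [ v ]≔ zero) x) (⟦ j ⟧ ℤ.* ℓ v x))))))
                         (Wave.progression-sum wave (phase α (F [ v ]≔ zero) x) ∤))) (⊠-zeroʳ _)

  -- Test with the form 0 and `pulse`. The constant 1 annihilates every F whose `δ F` is nonzero
  -- modulo p, and by rigidity the only light F left is 0. Its term is the number of points, which
  -- is at least 1.
  not-null-one : ∀ {k} → ¬ Null k (λ _ → 1#)
  not-null-one {k} N = ≥1⇒≉0 (ΣV≥1 (suc p′) m (λ _ → 1#) (λ _ → RealField.≤-refl R reflᴿ)) (begin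
    ΣV m (λ _ → 1#)
      ≈⟨ ΣV-cong m (λ x → transᴿ (symᴿ pulse-0) (transᴿ (Wave.cong-u pulse-wave (sym (trans (ℤₚ.+-identityˡ _) (dot-zero (λ q → ℓ q x)))))
           (symᴿ (⊠-identityˡ _)))) ⟩
    I (λ _ → 1#) (phase α₀ F₀) pulse                ≈⟨ ⊠-identityˡ _ ⟨
    1# ⊠ I (λ _ → 1#) (phase α₀ F₀) pulse           ≈⟨ ⊠-congʳ (bitR-yes (light? F₀) wt-zero) ⟨
    summand (λ _ → 1#) α₀ pulse F₀                  ≈⟨ ΣV-only-zero (suc p′) rows (summand (λ _ → 1#) α₀ pulse) others ⟨
    𝓛 (λ _ → 1#) α₀ pulse                           ≈⟨ N (mkAffine (λ _ → 0ℤ) 0ℤ weight-0 α₀-form) pulse-wave ⟩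
    0#                                              ∎)
    where
    F₀ : Vec (Fin p) rows
    F₀ = replicate rows zero
    α₀ : Vec (Fin p) m → ℤ
    α₀ _ = 0ℤ
    α₀-form : ∀ x → 0ℤ ≡ affine (λ _ → 0ℤ) 0ℤ x
    α₀-form x = sym (trans (ℤₚ.+-identityʳ _) (dot-zeroˡ x))
    weight-0 : weight {m} (λ _ → 0ℤ) ≤ k
    weight-0 = ≤-trans (weight-zero m) z≤n
    others : ∀ F → F ≢ F₀ → summand (λ _ → 1#) α₀ pulse F ≈ 0#
    others F F≢F₀ = bitR-zero (light? F) (λ le → junta-phase {α = α₀} {λ _ → 0ℤ} {0ℤ} junta-one α₀-form pulse-wave F (≰⇒> (λ sparse →
      F≢F₀ (rigid F le (≤-trans (weight-cong (λ e → ≡⇒≡ₚ (sym (ℤₚ.+-identityˡ (δ F e))))) sparse)))))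

  module Refutation (N : ℕ) (edge : Fin N → Fin m) (w : Fin N → Fin p → Carrier) where
    open Evaluation R
    open Functional N
    open Poly R N

    val : Vec (Fin p) m → Fin N → Carrier
    val x i = w i (lookup x (edge i))

    evalAt : Polynomial → Vec (Fin p) m → Carrier
    evalAt Q x = lin (evalMono (val x)) Q

    I-lin : ∀ Q θ u → I (evalAt Q) θ u ≈ lin (λ μ → I (λ x → evalMono (val x) μ) θ u) Q
    I-lin []            θ u = I-zero θ u (λ _ → reflᴿ)
    I-lin ((a , μ) ∷ Q) θ u = transᴿ (I-⊞ (λ x → a ⊠ evalMono (val x) μ) (evalAt Q) θ u)
      (⊞-cong (I-⊠ a (λ x → evalMono (val x) μ) θ u) (I-lin Q θ u))

    junta-evalAt : ∀ {d Q} → DegLe d Q → Junta d (evalAt Q)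
    junta-evalAt {d} {Q} degLe a c {u} wave d<a = transᴿ (I-lin Q (affine a c) u)
      (lin-vanish (λ μ → I (λ x → evalMono (val x) μ) (affine a c) u) Q vanishing)
      where
      vanishing : ∀ μ → coeff Q μ ≈ 0# ⊎ I (λ x → evalMono (val x) μ) (affine a c) u ≈ 0#
      vanishing μ with deg μ ≤? d
      ... | yes le = inj₂ (junta-evalMono edge w μ a c wave (≤-<-trans le d<a))
      ... | no ≰   = inj₁ (degLe μ (≰⇒> ≰))

    module _ {Ax : Polynomial → Set} {d : ℕ} (2d<g : suc (d + d) ≤ g)
             (sound : ∀ {Q} → Ax Q → Null d (evalAt Q)) where

      -- The invariant of derivations. A multiplication by a variable costs one level of `Null`;
      -- beforehand `null-suc` gains one, which the degree bound on the premise makes possible.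
      derivable-null : ∀ {Q} → Deriv Ax d Q → Null d (evalAt Q)
      derivable-degLe : ∀ {Q} → Deriv Ax d Q → DegLe d Q

      derivable-degLe (axiom _ le)   = le
      derivable-degLe (add _ _ le)   = le
      derivable-degLe (mulC _ _ le)  = le
      derivable-degLe (mulY _ _ le)  = le

      derivable-null (axiom ax _)         = sound ax
      derivable-null (add {P = Q} {Q′} D E _) = null-cong (λ x → symᴿ (lin-++ (evalMono (val x)) Q Q′))
        (null-⊞ (derivable-null D) (derivable-null E))
      derivable-null (mulC {P = Q} a D _) = null-cong (λ x → symᴿ (lin-scale (evalMono (val x)) a Q))
        (null-⊠ a (derivable-null D))
      derivable-null (mulY {P = Q} i D _) = null-cong times
        (null-table (edge i) (w i) (null-suc {φ = evalAt Q} (junta-evalAt {Q = Q} (derivable-degLe D)) 2d<g (derivable-null D)))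
        where
        times : ∀ x → val x i ⊠ evalAt Q x ≈ evalAt (mulVar i Q) x
        times x = begin
          val x i ⊠ evalAt Q x                                   ≈⟨ lin-⊠ (val x i) (evalMono (val x)) Q ⟨
          lin (λ μ → val x i ⊠ evalMono (val x) μ) Q             ≈⟨ lin-cong Q (evalMono-unit (val x) i) ⟨
          lin (λ μ → evalMono (val x) (unitMono i ·ₘ μ)) Q       ≡⟨ lin-mulVar (evalMono (val x)) i Q ⟨
          evalAt (mulVar i Q) x                                  ∎

      no-refutation : ¬ RefutationOfDeg Ax d
      no-refutation (Q , D , isOne) = not-null-one (null-cong
        (λ x → transᴿ (lin-one (evalMono (val x)) Q isOne) (evalMono-one N (val x))) (derivable-null D))

-- The instances

module Torsion (G : FinAbGroup) where
  open FinAbGroup G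

  commutativeMonoid : CommutativeMonoid lzero lzero
  commutativeMonoid = record { isCommutativeMonoid = IsAbelianGroup.isCommutativeMonoid isAbelianGroup }

  open CommutativeMonoid commutativeMonoid public using ()
    renaming (assoc to ∙-assoc; comm to ∙-comm; identityˡ to ∙-identityˡ; identityʳ to ∙-identityʳ)

  natMul-+ : ∀ a b g → natMul (a + b) g ≡ natMul a g ∙ natMul b g
  natMul-+ zero    b g = sym (∙-identityˡ _)
  natMul-+ (suc a) b g = trans (cong (g ∙_) (natMul-+ a b g)) (sym (∙-assoc g _ _))

  natMul-ε : ∀ a → natMul a ε ≡ ε
  natMul-ε zero    = refl
  natMul-ε (suc a) = trans (∙-identityˡ _) (natMul-ε a)

  natMul-* : ∀ a b g → natMul (a * b) g ≡ natMul a (natMul b g)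
  natMul-* zero    b g = refl
  natMul-* (suc a) b g = trans (natMul-+ b (a * b) g) (cong (natMul b g ∙_) (natMul-* a b g))

  Torsion : ℕ → Set
  Torsion k = 1 ≤ k × ∃ λ g → g ≢ ε × natMul k g ≡ ε

  torsion? : ∀ k → Dec (Torsion k)
  torsion? k = 1 ≤? k ×-dec Finₚ.any? (λ g → ¬? (g Finₚ.≟ ε) ×-dec natMul k g Finₚ.≟ ε)

  cancel : ∀ g h → g ∙ h ≡ g → h ≡ ε
  cancel g h eq = trans (sym (∙-identityˡ h)) (trans (cong (_∙ h) (sym inverse))
    (trans (∙-assoc (g ⁻¹) g h) (trans (cong ((g ⁻¹) ∙_) eq) inverse)))
    where
    inverse : (g ⁻¹) ∙ g ≡ ε
    inverse = IsAbelianGroup.inverseˡ isAbelianGroup g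

  torsion-exists : NonTrivial G → ∃ Torsion
  torsion-exists 2≤order with non-identity 2≤order
    where
    distinct : ∀ {n} → 2 ≤ n → (e : Fin n) → ∃ λ (g : Fin n) → g ≢ e
    distinct (s≤s (s≤s _)) zero    = suc zero , λ ()
    distinct (s≤s (s≤s _)) (suc e) = zero , λ ()
    non-identity : NonTrivial G → ∃ λ g → g ≢ ε
    non-identity 2≤order = distinct 2≤order ε
  ... | g , g≢ε with Finₚ.pigeonhole (n<1+n order) (λ i → natMul (toℕ i) g)
  ...   | i , j , i<j , eq = toℕ j ∸ toℕ i , m<n⇒0<n∸m i<j , g , g≢ε , cancel (natMul (toℕ i) g) _
          (trans (sym (natMul-+ (toℕ i) (toℕ j ∸ toℕ i) g))
            (trans (cong (λ k → natMul k g) (m+[n∸m]≡n (<⇒≤ i<j))) (sym eq)))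

  least-below : ∀ n → (∃ λ k → Torsion k × (∀ j → j < k → ¬ Torsion j)) ⊎ (∀ j → j < n → ¬ Torsion j)
  least-below zero    = inj₂ (λ j ())
  least-below (suc n) with least-below n
  ... | inj₁ found = inj₁ found
  ... | inj₂ none with torsion? n
  ...   | yes t = inj₁ (n , t , none)
  ...   | no ¬t = inj₂ (λ j j<1+n t → none j (≤∧≢⇒< (s≤s⁻¹ j<1+n) (λ { refl → ¬t t })) t)

  least : NonTrivial G → ∃ λ k → Torsion k × (∀ j → j < k → ¬ Torsion j)
  least nt with torsion-exists nt
  ... | k , t with least-below (suc k)
  ...   | inj₁ found = found
  ...   | inj₂ none  = ⊥-elim (none k ≤-refl t)

  -- The least torsion exponent is prime: if k g = 0 and d divides k properly, then d g ≠ 0 is killed by k / d.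
  prime-torsion : NonTrivial G → Σ ℕ λ p′ → Prime (suc (suc p′)) × Σ (Fin order) λ h → h ≢ ε × natMul (suc (suc p′)) h ≡ ε
  prime-torsion nt with least nt
  ... | suc zero     , (_ , g , g≢ε , eq) , _ = contradiction (trans (sym (∙-identityʳ g)) eq) g≢ε
  ... | suc (suc p′) , (_ , g , g≢ε , eq) , minimal = p′ , prime ¬composite , g , g≢ε , eq
    where
    k = suc (suc p′)
    ¬composite : ¬ Composite k
    ¬composite (composite {d} d<k (ℕ∣.divides q k≡qd)) with natMul d g Finₚ.≟ ε
    ... | yes dg≡ε = minimal d d<k (<⇒≤ (nonTrivial⇒n>1 d) , g , g≢ε , dg≡ε)
    ... | no dg≢ε  = minimal q q<k (q≥1 , natMul d g , dg≢ε , trans (sym (natMul-* q d g))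
                       (trans (cong (λ j → natMul j g) (sym k≡qd)) eq))
      where
      q≥1 : 1 ≤ q
      q≥1 = n≢0⇒n>0 (λ { refl → 1+n≢0 k≡qd })
      q<k : q < k
      q<k = subst (q <_) (sym k≡qd) (m<m*n q d {{>-nonZero q≥1}} (nonTrivial⇒n>1 d))

  module Multiples (p′ : ℕ) (pr : Prime (suc (suc p′))) (h : Fin order) (ph≡ε : natMul (suc (suc p′)) h ≡ ε) where
    open Residue p′ pr

    natMul-cong-≤ : ∀ a b → b ≤ a → P ℤ∣.∣ + a ℤ.- + b → natMul a h ≡ natMul b h
    natMul-cong-≤ a b b≤a d with subst (p ℕ∣.∣_) (cong ℤ.∣_∣ (trans (ℤₚ.m-n≡m⊖n a b) (ℤₚ.⊖-≥ b≤a))) (ℤ∣.∣⇒∣ᵤ d)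
    ... | ℕ∣.divides q a∸b≡qp = trans (cong (λ j → natMul j h) (sym (trans (cong (_+ b) (sym a∸b≡qp)) (m∸n+n≡m b≤a))))
      (trans (natMul-+ (q * p) b h) (trans (cong (_∙ natMul b h)
        (trans (natMul-* q p h) (trans (cong (natMul q) ph≡ε) (natMul-ε q)))) (∙-identityˡ _)))

    natMul-cong : ∀ {a b} → + a ≡ₚ + b → natMul a h ≡ natMul b h
    natMul-cong {a} {b} a≡b with ≤-total b a
    ... | inj₁ b≤a = natMul-cong-≤ a b b≤a (_≡ₚ_.dividesDifference a≡b)
    ... | inj₂ a≤b = sym (natMul-cong-≤ b a a≤b (_≡ₚ_.dividesDifference (≡ₚ-sym a≡b)))

-- The Tseitin forms modulo p

module ΣZ⁺ = CombineSum ℤₚ.+-0-commutativeMonoid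

count-fibre : ∀ {k n} (f : Fin k → Fin n) → (∀ {i j} → f i ≡ f j → i ≡ j) → ∀ v →
              ΣN.sum (λ i → bit (f i Finₚ.≟ v)) ≤ 1
count-fibre {zero}  f inj v = z≤n
count-fibre {suc k} f inj v with f zero Finₚ.≟ v
... | no _   = count-fibre (f ∘ suc) (Finₚ.suc-injective ∘ inj) v
... | yes eq = s≤s (≤-trans (sum-mono-≤ (λ i → ≤-reflexive (bit-no (f (suc i) Finₚ.≟ v) (λ eq′ →
                 case inj (trans eq (sym eq′)) of λ ())))) (≤-reflexive (trans (sum-const k 0) (*-zeroʳ k))))

indicator : ∀ {n} → Fin n → ℕ
indicator zero    = 1
indicator (suc _) = 0

module Tseitin (σ D′ : ℕ) (1≤σ : 1 ≤ σ) (π : Fin (suc D′) → Permutation′ (16 * σ))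
  (expands : ∀ (S T : Fin (16 * σ) → Bool) → σ ≤ # S → # T ≤ 15 * σ →
             ¬ (∀ i v → S v ≡ true → T (π i ⟨$⟩ʳ v) ≡ true))
  (p′ : ℕ) (pr : Prime (suc (suc p′))) where

  open Graph σ D′ 1≤σ π expands
  open Residue p′ pr

  -- The variables are the edges (i , q) from the out-vertex q to the in-vertex τ i q.
  var : Fin 3 → Fin L → Fin (3 * L)
  var i q = combine i q

  Vertex : Set
  Vertex = Fin L ⊎ Fin L

  incident : Vertex → Fin 3 → Fin (3 * L)
  incident (inj₁ q) i = var i q
  incident (inj₂ r) i = var i (τ i ⟨$⟩ˡ r)

  charge : Vertex → ℕ
  charge (inj₁ q) = indicator q
  charge (inj₂ r) = 0

  -- With opposite signs at its two ends, an edge has the difference of their multipliers as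
  -- coefficient. So F acts as a colouring, and the weight of `δ F` counts the edges whose ends
  -- differ.
  sign : Vertex → ℤ
  sign (inj₁ q) = 1ℤ
  sign (inj₂ r) = ℤ.- 1ℤ

  form : Vertex → Vec (Fin p) (3 * L) → ℤ
  form v x = sign v ℤ.* (ΣZ.sum (λ i → ⟦ lookup x (incident v i) ⟧) ℤ.- + charge v)

  vertex : Fin (L + L) → Vertex
  vertex = splitAt L

  out into : Vec (Fin p) (L + L) → Fin L → Fin p
  out  F q = lookup F (q ↑ˡ L)
  into F r = lookup F (L ↑ʳ r)

  difference : Vec (Fin p) (L + L) → Fin 3 → Fin L → ℤ
  difference F i q = ⟦ out F q ⟧ ℤ.- ⟦ into F (τ i ⟨$⟩ʳ q) ⟧

  δ : Vec (Fin p) (L + L) → Fin (3 * L) → ℤ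
  δ F e = uncurry (difference F) (remQuot {3} L e)

  δ-var : ∀ F i q → δ F (var i q) ≡ difference F i q
  δ-var F i q = cong (uncurry (difference F)) (Finₚ.remQuot-combine {3} {L} i q)

  ρ : Vec (Fin p) (L + L) → ℤ
  ρ F = ΣZ.sum (λ q → ℤ.- (+ indicator q) ℤ.* ⟦ out F q ⟧)

  ∑ : ∀ {n} → (Fin n → ℤ) → ℤ
  ∑ = ΣZ.sum

  ∑-neg : ∀ {n} (f : Fin n → ℤ) → ∑ (λ i → ℤ.- f i) ≡ ℤ.- ∑ f
  ∑-neg {zero}  f = refl
  ∑-neg {suc n} f = trans (cong (λ z → ℤ.- f zero ℤ.+ z) (∑-neg (f ∘ suc))) (sym (ℤₚ.neg-distrib-+ (f zero) _))

  module _ (F : Vec (Fin p) (L + L)) (x : Vec (Fin p) (3 * L)) where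
    private
      y : Fin 3 → Fin L → ℤ
      y i q = ⟦ lookup x (var i q) ⟧
      a b : Fin L → ℤ
      a q = ⟦ out F q ⟧
      b r = ⟦ into F r ⟧

      outPart inPart : ℤ
      outPart = ∑ (λ i → ∑ (λ q → y i q ℤ.* a q))
      inPart  = ∑ (λ i → ∑ (λ q → y i q ℤ.* b (τ i ⟨$⟩ʳ q)))

    out-rows : ∑ (λ q → form (inj₁ q) x ℤ.* a q) ≡ outPart ℤ.+ ρ F
    out-rows = begin
      ∑ (λ q → form (inj₁ q) x ℤ.* a q)
        ≡⟨ ΣZ.sum-cong-≗ {L} (λ q → lem (∑ (λ i → y i q)) (+ indicator q) (a q)) ⟩
      ∑ (λ q → ∑ (λ i → y i q) ℤ.* a q ℤ.+ ℤ.- (+ indicator q) ℤ.* a q)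
        ≡⟨ ΣZ.∑-distrib-+ {L} (λ q → ∑ (λ i → y i q) ℤ.* a q) (λ q → ℤ.- (+ indicator q) ℤ.* a q) ⟩
      ∑ (λ q → ∑ (λ i → y i q) ℤ.* a q) ℤ.+ ρ F
        ≡⟨ cong (ℤ._+ ρ F) (trans (ΣZ.sum-cong-≗ {L} (λ q → ΣZ.*-distribʳ-sum {3} (a q) (λ i → y i q)))
             (ΣZ.∑-comm {L} {3} (λ q i → y i q ℤ.* a q))) ⟩
      outPart ℤ.+ ρ F ∎
      where
      open ≡-Reasoning
      lem : ∀ s c a → 1ℤ ℤ.* (s ℤ.- c) ℤ.* a ≡ s ℤ.* a ℤ.+ ℤ.- c ℤ.* a
      lem = ℤ-solve-∀

    in-rows : ∑ (λ r → form (inj₂ r) x ℤ.* b r) ≡ ℤ.- inPart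
    in-rows = begin
      ∑ (λ r → form (inj₂ r) x ℤ.* b r)
        ≡⟨ ΣZ.sum-cong-≗ {L} (λ r → lem (∑ (λ i → y i (τ i ⟨$⟩ˡ r))) (b r)) ⟩
      ∑ (λ r → ℤ.- (∑ (λ i → y i (τ i ⟨$⟩ˡ r)) ℤ.* b r))
        ≡⟨ ∑-neg {L} (λ r → ∑ (λ i → y i (τ i ⟨$⟩ˡ r)) ℤ.* b r) ⟩
      ℤ.- ∑ (λ r → ∑ (λ i → y i (τ i ⟨$⟩ˡ r)) ℤ.* b r)
        ≡⟨ cong ℤ.-_ (trans (ΣZ.sum-cong-≗ {L} (λ r → ΣZ.*-distribʳ-sum {3} (b r) (λ i → y i (τ i ⟨$⟩ˡ r))))
             (ΣZ.∑-comm {L} {3} (λ r i → y i (τ i ⟨$⟩ˡ r) ℤ.* b r))) ⟩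
      ℤ.- ∑ (λ i → ∑ (λ r → y i (τ i ⟨$⟩ˡ r) ℤ.* b r))
        ≡⟨ cong ℤ.-_ (ΣZ.sum-cong-≗ {3} (λ i → trans (ΣZ.∑-permute (λ r → y i (τ i ⟨$⟩ˡ r) ℤ.* b r) (τ i))
             (ΣZ.sum-cong-≗ {L} (λ q → cong (λ q′ → y i q′ ℤ.* b (τ i ⟨$⟩ʳ q)) (Perm.inverseˡ (τ i)))))) ⟩
      ℤ.- inPart ∎
      where
      open ≡-Reasoning
      lem : ∀ s b → ℤ.- 1ℤ ℤ.* (s ℤ.- 0ℤ) ℤ.* b ≡ ℤ.- (s ℤ.* b)
      lem = ℤ-solve-∀

    -- Summation by parts: the sum over vertices is regrouped by edges, with the in-vertices
    -- reindexed along each `τ i`. The charges are collected in `ρ F`.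
    adjoint : dot (λ v → form (vertex v) x) F ≡ affine (δ F) (ρ F) x
    adjoint = begin
      ∑ (λ v → form (vertex v) x ℤ.* ⟦ lookup F v ⟧)
        ≡⟨ ΣZ⁺.sum-↑ L L (λ v → form (vertex v) x ℤ.* ⟦ lookup F v ⟧) ⟩
      ∑ (λ q → form (vertex (q ↑ˡ L)) x ℤ.* a q) ℤ.+ ∑ (λ r → form (vertex (L ↑ʳ r)) x ℤ.* b r)
        ≡⟨ cong₂ ℤ._+_ (ΣZ.sum-cong-≗ {L} (λ q → cong (λ v → form v x ℤ.* a q) (Finₚ.splitAt-↑ˡ L q L)))
                       (ΣZ.sum-cong-≗ {L} (λ r → cong (λ v → form v x ℤ.* b r) (Finₚ.splitAt-↑ʳ L L r))) ⟩
      ∑ (λ q → form (inj₁ q) x ℤ.* a q) ℤ.+ ∑ (λ r → form (inj₂ r) x ℤ.* b r)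
        ≡⟨ cong₂ ℤ._+_ out-rows in-rows ⟩
      outPart ℤ.+ ρ F ℤ.+ ℤ.- inPart
        ≡⟨ swap outPart (ρ F) (ℤ.- inPart) ⟩
      outPart ℤ.+ ℤ.- inPart ℤ.+ ρ F
        ≡⟨ cong (ℤ._+ ρ F) (sym edges) ⟩
      dot (δ F) x ℤ.+ ρ F ∎
      where
      open ≡-Reasoning
      swap : ∀ a b c → a ℤ.+ b ℤ.+ c ≡ a ℤ.+ c ℤ.+ b
      swap = ℤ-solve-∀
      distrib : ∀ a b y → (a ℤ.- b) ℤ.* y ≡ y ℤ.* a ℤ.+ ℤ.- (y ℤ.* b)
      distrib = ℤ-solve-∀
      edges : dot (δ F) x ≡ outPart ℤ.+ ℤ.- inPart
      edges = begin
        ∑ (λ e → δ F e ℤ.* ⟦ lookup x e ⟧)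
          ≡⟨ ΣZ⁺.sum-combine 3 L (λ e → δ F e ℤ.* ⟦ lookup x e ⟧) ⟩
        ∑ (λ i → ∑ (λ q → δ F (var i q) ℤ.* y i q))
          ≡⟨ ΣZ.sum-cong-≗ {3} (λ i → trans
               (ΣZ.sum-cong-≗ {L} (λ q → trans (cong (ℤ._* y i q) (δ-var F i q)) (distrib (a q) (b (τ i ⟨$⟩ʳ q)) (y i q))))
               (trans (ΣZ.∑-distrib-+ {L} (λ q → y i q ℤ.* a q) (λ q → ℤ.- (y i q ℤ.* b (τ i ⟨$⟩ʳ q))))
                 (cong (λ z → ∑ (λ q → y i q ℤ.* a q) ℤ.+ z) (∑-neg {L} (λ q → y i q ℤ.* b (τ i ⟨$⟩ʳ q)))))) ⟩
        ∑ (λ i → ∑ (λ q → y i q ℤ.* a q) ℤ.+ ℤ.- ∑ (λ q → y i q ℤ.* b (τ i ⟨$⟩ʳ q)))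
          ≡⟨ ΣZ.∑-distrib-+ {3} (λ i → ∑ (λ q → y i q ℤ.* a q)) (λ i → ℤ.- ∑ (λ q → y i q ℤ.* b (τ i ⟨$⟩ʳ q))) ⟩
        outPart ℤ.+ ∑ (λ i → ℤ.- ∑ (λ q → y i q ℤ.* b (τ i ⟨$⟩ʳ q)))
          ≡⟨ cong (λ z → outPart ℤ.+ z) (∑-neg {3} (λ i → ∑ (λ q → y i q ℤ.* b (τ i ⟨$⟩ʳ q)))) ⟩
        outPart ℤ.+ ℤ.- inPart ∎

  δ-⊕ : ∀ F G e → δ (F ⊕ᵛ G) e ≡ₚ δ F e ℤ.+ δ G e
  δ-⊕ F G e = go (remQuot {3} L e)
    where
    at : ∀ v → ⟦ lookup (F ⊕ᵛ G) v ⟧ ≡ₚ ⟦ lookup F v ⟧ ℤ.+ ⟦ lookup G v ⟧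
    at v = subst (λ j → ⟦ j ⟧ ≡ₚ ⟦ lookup F v ⟧ ℤ.+ ⟦ lookup G v ⟧) (sym (Vecₚ.lookup-zipWith _⊕ₚ_ v F G)) (⊕ₚ-≡ₚ (lookup F v) (lookup G v))
    lem₁ : ∀ a b → a ℤ.- b ≡ a ℤ.+ b ℤ.* ℤ.- 1ℤ
    lem₁ = ℤ-solve-∀
    lem₂ : ∀ a a′ b b′ → (a ℤ.+ a′) ℤ.+ (b ℤ.+ b′) ℤ.* ℤ.- 1ℤ ≡ (a ℤ.- b) ℤ.+ (a′ ℤ.- b′)
    lem₂ = ℤ-solve-∀
    go : ∀ iq → uncurry (difference (F ⊕ᵛ G)) iq ≡ₚ uncurry (difference F) iq ℤ.+ uncurry (difference G) iq
    go (i , q) = ≡ₚ-trans (≡⇒≡ₚ (lem₁ ⟦ out (F ⊕ᵛ G) q ⟧ ⟦ into (F ⊕ᵛ G) r ⟧))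
      (≡ₚ-trans (≡ₚ-+ (at (q ↑ˡ L)) (≡ₚ-*ʳ (ℤ.- 1ℤ) (at (L ↑ʳ r))))
                (≡⇒≡ₚ (lem₂ ⟦ out F q ⟧ ⟦ out G q ⟧ ⟦ into F r ⟧ ⟦ into G r ⟧)))
      where
      r = τ i ⟨$⟩ʳ q

  -- One representative per block, because the expander speaks of blocks; one changed multiplier
  -- then changes the count by at most one.
  wt : Vec (Fin p) (L + L) → ℕ
  wt F = # (nonzero ∘ out F ∘ main)

  cut≤weight : ∀ F → Colouring.cut (out F) (into F) ≤ weight (δ F)
  cut≤weight F = ≤-trans (sum-mono-≤ {3} (λ i → sum-mono-≤ {L} (λ q →
      bit-mono (¬? (out F q Finₚ.≟ into F (τ i ⟨$⟩ʳ q))) (p∤? (δ F (var i q)))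
        (λ apart d → apart (⟦⟧-injective (mod (subst (P ℤ∣.∣_) (δ-var F i q) d)))))))
    (≤-reflexive (sym (ΣN⁺.sum-combine 3 L (λ e → bit (p∤? (δ F e))))))

  main-injective : ∀ {u v} → main u ↑ˡ L ≡ main v ↑ˡ L → u ≡ v
  main-injective {u} {v} eq = Finₚ.combine-injectiveˡ u zero v zero (Finₚ.↑ˡ-injective L (main u) (main v) eq)

  wt-update : ∀ F v j → wt (F [ v ]≔ j) ≤ suc (wt F)
  wt-update F v j = begin
    wt (F [ v ]≔ j)
      ≤⟨ sum-mono-≤ {k} pointwise ⟩
    ΣN.sum (λ u → bit (main u ↑ˡ L Finₚ.≟ v) + ind (nonzero (out F (main u))))
      ≡⟨ ΣN.∑-distrib-+ {k} (λ u → bit (main u ↑ˡ L Finₚ.≟ v)) (λ u → ind (nonzero (out F (main u)))) ⟩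
    ΣN.sum (λ u → bit (main u ↑ˡ L Finₚ.≟ v)) + wt F
      ≤⟨ +-monoˡ-≤ (wt F) (count-fibre (λ u → main u ↑ˡ L) main-injective v) ⟩
    suc (wt F) ∎
    where
    open ≤-Reasoning
    pointwise : ∀ u → ind (nonzero (out (F [ v ]≔ j) (main u))) ≤
                      bit (main u ↑ˡ L Finₚ.≟ v) + ind (nonzero (out F (main u)))
    pointwise u with main u ↑ˡ L Finₚ.≟ v
    ... | yes _ = ≤-trans (ind≤1 _) (m≤m+n 1 _)
    ... | no u≢v = ≤-reflexive (cong (ind ∘ nonzero) (Vecₚ.lookup∘update′ u≢v F j))

  nonzero-⊕ : ∀ i j → ind (nonzero (i ⊕ₚ j)) ≤ ind (nonzero i) + ind (nonzero j)
  nonzero-⊕ (suc i) j       = ≤-trans (ind≤1 _) (m≤m+n 1 _)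
  nonzero-⊕ zero    (suc j) = ind≤1 _
  nonzero-⊕ zero    zero    = ≤-reflexive (cong (ind ∘ nonzero) (⟦⟧-injective {zero ⊕ₚ zero} {zero} (⊕ₚ-≡ₚ zero zero)))

  nonzero-⊕⁻ : ∀ i j → ind (nonzero j) ≤ ind (nonzero i) + ind (nonzero (i ⊕ₚ j))
  nonzero-⊕⁻ (suc i) j = ≤-trans (ind≤1 _) (m≤m+n 1 _)
  nonzero-⊕⁻ zero    j = ≤-reflexive (cong (ind ∘ nonzero)
    (sym (⟦⟧-injective {zero ⊕ₚ j} {j} (≡ₚ-trans (⊕ₚ-≡ₚ zero j) (≡⇒≡ₚ (ℤₚ.+-identityˡ ⟦ j ⟧))))))

  wt-⊕ : ∀ F G → wt (F ⊕ᵛ G) ≤ wt F + wt G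
  wt-⊕ F G = ≤-trans (sum-mono-≤ {k} (λ u → ≤-trans
      (≤-reflexive (cong (ind ∘ nonzero) (Vecₚ.lookup-zipWith _⊕ₚ_ (main u ↑ˡ L) F G)))
      (nonzero-⊕ (out F (main u)) (out G (main u)))))
    (≤-reflexive (ΣN.∑-distrib-+ {k} (ind ∘ nonzero ∘ out F ∘ main) (ind ∘ nonzero ∘ out G ∘ main)))

  wt-⊕⁻ : ∀ F G → wt G ≤ wt F + wt (F ⊕ᵛ G)
  wt-⊕⁻ F G = ≤-trans (sum-mono-≤ {k} (λ u → ≤-trans (nonzero-⊕⁻ (out F (main u)) (out G (main u)))
      (+-monoʳ-≤ (ind (nonzero (out F (main u))))
        (≤-reflexive (cong (ind ∘ nonzero) (sym (Vecₚ.lookup-zipWith _⊕ₚ_ (main u ↑ˡ L) F G)))))))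
    (≤-reflexive (ΣN.∑-distrib-+ {k} (ind ∘ nonzero ∘ out F ∘ main) (ind ∘ nonzero ∘ out (F ⊕ᵛ G) ∘ main)))

  wt-zero : wt (replicate (L + L) zero) ≤ suc (4 * σ)
  wt-zero = ≤-trans (sum-mono-≤ {k} (λ u → ≤-reflexive (cong (ind ∘ nonzero) (Vecₚ.lookup-replicate (main u ↑ˡ L) zero))))
    (≤-trans (≤-reflexive (trans (sum-const k 0) (*-zeroʳ k))) z≤n)

  -- The threshold is 4σ+1 and not 4σ, to make the lower alternative strict; even so 2(4σ+1) < 12σ
  -- because σ ≥ 1.
  wt-gap : ∀ F → weight (δ F) ≤ σ → suc (wt F) ≤ suc (4 * σ) ⊎ suc (4 * σ) + suc (4 * σ) < wt F
  wt-gap F sparse = widen (Colouring.Small.gap (out F) (into F) (≤-trans (cut≤weight F) sparse))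
    where
    open ≤-Reasoning
    lem : ∀ σ → suc (suc (4 * σ) + suc (4 * σ)) ≡ 3 + 8 * σ
    lem = solve-∀
    lem′ : ∀ σ → 4 * σ + 8 * σ ≡ 3 * (4 * σ)
    lem′ = solve-∀
    widen : ∀ {w} → w ≤ 4 * σ ⊎ 3 * (4 * σ) ≤ w → suc w ≤ suc (4 * σ) ⊎ suc (4 * σ) + suc (4 * σ) < w
    widen (inj₁ le) = inj₁ (s≤s le)
    widen {w} (inj₂ ge) = inj₂ (begin
      suc (suc (4 * σ) + suc (4 * σ))  ≡⟨ lem σ ⟩
      3 + 8 * σ                        ≤⟨ +-monoˡ-≤ (8 * σ) (≤-trans (*-monoʳ-≤ 3 1≤σ) (*-monoˡ-≤ σ (n≤1+n 3))) ⟩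
      4 * σ + 8 * σ                    ≡⟨ lem′ σ ⟩
      3 * (4 * σ)                      ≤⟨ ge ⟩
      w                                ∎)

  all-zero : ∀ {n} (F : Vec (Fin p) n) → (∀ v → nonzero (lookup F v) ≡ false) → F ≡ replicate n zero
  all-zero []          h = refl
  all-zero (zero ∷ F)  h = cong (zero ∷_) (all-zero F (h ∘ suc))
  all-zero (suc _ ∷ F) h = case h zero of λ ()

  -- Weight 0 means that no edge is cut, so F is constant along the cycle. A nonzero constant would
  -- be seen by all 16σ blocks, more than 4σ+1.
  wt-rigid : ∀ F → wt F ≤ suc (4 * σ) → weight (δ F) ≤ 0 → F ≡ replicate (L + L) zero
  wt-rigid F light sparse = all-zero F zeros
    where
    open Colouring.Uncut (out F) (into F) (≤-trans (cut≤weight F) sparse) light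
    zeros : ∀ v → nonzero (lookup F v) ≡ false
    zeros v with splitAt L v in eq
    ... | inj₁ q = subst (λ v → nonzero (lookup F v) ≡ false) (Finₚ.splitAt⁻¹-↑ˡ eq) (F-zero q)
    ... | inj₂ r = subst (λ v → nonzero (lookup F v) ≡ false) (Finₚ.splitAt⁻¹-↑ʳ {L} eq) (G-zero r)

  system : System
  system = record
    { m = 3 * L ; rows = L + L ; ℓ = λ v → form (vertex v) ; δ = δ ; ρ = ρ ; adjoint = adjoint ; δ-⊕ = δ-⊕
    ; wt = wt ; s = suc (4 * σ) ; g = σ ; 1≤s = s≤s z≤n ; gap = wt-gap
    ; wt-update = wt-update ; wt-⊕ = wt-⊕ ; wt-⊕⁻ = wt-⊕⁻ ; wt-zero = wt-zero ; rigid = wt-rigid }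

-- Equations over the group and soundness of the axioms

module Equations (G : FinAbGroup) (σ D′ : ℕ) (1≤σ : 1 ≤ σ) (π : Fin (suc D′) → Permutation′ (16 * σ))
  (expands : ∀ (S T : Fin (16 * σ) → Bool) → σ ≤ # S → # T ≤ 15 * σ →
             ¬ (∀ i v → S v ≡ true → T (π i ⟨$⟩ʳ v) ≡ true))
  (p′ : ℕ) (pr : Prime (suc (suc p′)))
  (h : Fin (FinAbGroup.order G)) (h≢ε : h ≢ FinAbGroup.ε G)
  (ph≡ε : FinAbGroup.natMul G (suc (suc p′)) h ≡ FinAbGroup.ε G) where

  open FinAbGroup G
  open Torsion G
  open Multiples p′ pr h ph≡ε
  open Graph σ D′ 1≤σ π expands
  open Residue p′ pr
  open Tseitin σ D′ 1≤σ π expands p′ pr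
  module ΣG = MonoidSum commutativeMonoid

  -- The first two edges of an in-vertex are listed in the other order, so that no equation is repeated.
  slot : Vertex → Fin 3 → Fin (3 * L)
  slot (inj₁ q) i             = incident (inj₁ q) i
  slot (inj₂ r) zero          = incident (inj₂ r) (suc zero)
  slot (inj₂ r) (suc zero)    = incident (inj₂ r) zero
  slot (inj₂ r) (suc (suc i)) = incident (inj₂ r) (suc (suc i))

  equation : Vertex → Constraint G (3 * L)
  equation v = constraint 1ℤ 1ℤ 1ℤ (natMul (charge v) h) (slot v zero) (slot v (suc zero)) (slot v (suc (suc zero)))

  tseitin : Instance G
  tseitin = record { vars = 3 * L ; eqs = List.tabulate (equation ∘ vertex) }

  total : (Fin (3 * L) → Fin order) → Vertex → Fin order
  total η v = ΣG.sum (λ i → η (incident v i))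

  lhs : Fin order → Fin order → Fin order → Fin order
  lhs a b c = (zMul 1ℤ a ∙ zMul 1ℤ b) ∙ zMul 1ℤ c

  -- `zMul 1ℤ a` unfolds to `a ∙ ε`; the last `ε` stays, being the end of a sum over three edges.
  lhs-sum : ∀ a b c → lhs a b c ≡ a ∙ (b ∙ (c ∙ ε))
  lhs-sum a b c = trans (cong₂ (λ a b → (a ∙ b) ∙ (c ∙ ε)) (∙-identityʳ a) (∙-identityʳ b)) (∙-assoc a b (c ∙ ε))

  lhs-swap : ∀ a b c → lhs a b c ≡ b ∙ (a ∙ (c ∙ ε))
  lhs-swap a b c = trans (cong (_∙ zMul 1ℤ c) (∙-comm (zMul 1ℤ a) (zMul 1ℤ b))) (lhs-sum b a c)

  lhs-total : ∀ η v → lhs (η (slot v zero)) (η (slot v (suc zero))) (η (slot v (suc (suc zero)))) ≡ total η v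
  lhs-total η (inj₁ q) = lhs-sum _ _ _
  lhs-total η (inj₂ r) = lhs-swap _ _ _

  vertex-injective : ∀ {u v} → vertex u ≡ vertex v → u ≡ v
  vertex-injective {u} {v} eq = trans (sym (Finₚ.join-splitAt L L u)) (trans (cong (Fin.join L L) eq) (Finₚ.join-splitAt L L v))

  equation-injective : ∀ v v′ → SameAtom G (equation v) (equation v′) → v ≡ v′
  equation-injective (inj₁ q) (inj₁ q′) (eq , _)     = cong inj₁ (Finₚ.combine-injectiveʳ {3} {L} zero q zero q′ eq)
  equation-injective (inj₂ r) (inj₂ r′) (_ , eq , _) = cong inj₂ (Finₚ.combine-injectiveʳ {3} {L} zero r zero r′ eq)
  equation-injective (inj₁ q) (inj₂ r)  (eq , _)     =
    case Finₚ.combine-injectiveˡ {3} {L} zero q (suc zero) (τ (suc zero) ⟨$⟩ˡ r) eq of λ ()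
  equation-injective (inj₂ r) (inj₁ q)  (eq , _)     =
    case Finₚ.combine-injectiveˡ {3} {L} (suc zero) (τ (suc zero) ⟨$⟩ˡ r) zero q eq of λ ()

  irredundant : Irredundant G tseitin
  irredundant = AllPairsₚ.tabulate⁺ (λ {u} {v} u≢v same → u≢v (vertex-injective (equation-injective (vertex u) (vertex v) same)))

  charges : ∀ n → 0 < n → ΣG.sum {n} (λ q → natMul (indicator q) h) ≡ h
  charges (suc n) _ = trans (cong₂ _∙_ (∙-identityʳ h) (ΣG.sum-replicate-zero n)) (∙-identityʳ h)

  0<L : 0 < L
  0<L = *-mono-≤ {1} {k} {1} {D} (*-mono-≤ {1} {16} {1} {σ} (s≤s z≤n) 1≤σ) (s≤s z≤n)

  unsatisfiable : Unsatisfiable G tseitin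
  unsatisfiable (η , satisfied) = h≢ε (begin
    h                                              ≡⟨ charges L 0<L ⟨
    ΣG.sum {L} (λ q → natMul (indicator q) h)      ≡⟨ ΣG.sum-cong-≗ {L} (λ q → sym (at (inj₁ q) (q ↑ˡ L) (Finₚ.splitAt-↑ˡ L q L))) ⟩
    ΣG.sum {L} (λ q → ΣG.sum {3} (λ i → η (var i q))) ≡⟨ ΣG.∑-comm {L} {3} (λ q i → η (var i q)) ⟩
    ΣG.sum {3} (λ i → ΣG.sum {L} (λ q → η (var i q)))
      ≡⟨ ΣG.sum-cong-≗ {3} (λ i → ΣG.∑-permute {L} {L} (λ q → η (var i q)) (Perm.flip (τ i))) ⟩
    ΣG.sum {3} (λ i → ΣG.sum {L} (λ r → η (var i (τ i ⟨$⟩ˡ r)))) ≡⟨ ΣG.∑-comm {L} {3} (λ r i → η (var i (τ i ⟨$⟩ˡ r))) ⟨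
    ΣG.sum {L} (λ r → ΣG.sum {3} (λ i → η (var i (τ i ⟨$⟩ˡ r))))
      ≡⟨ ΣG.sum-cong-≗ {L} (λ r → at (inj₂ r) (L ↑ʳ r) (Finₚ.splitAt-↑ʳ L L r)) ⟩
    ΣG.sum {L} (λ r → ε)                           ≡⟨ ΣG.sum-replicate-zero L ⟩
    ε                                              ∎)
    where
    open ≡-Reasoning
    at : ∀ v i → vertex i ≡ v → total η v ≡ natMul (charge v) h
    at v i refl = trans (sym (lhs-total η v)) (Allₚ.tabulate⁻ {f = equation ∘ vertex} satisfied i)

  numEqs-tseitin : numEqs G tseitin ≡ L + L
  numEqs-tseitin = Listₚ.length-tabulate (equation ∘ vertex)

  value : Vec (Fin p) (3 * L) → Fin (3 * L) → Fin order
  value x e = natMul (toℕ (lookup x e)) h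

  total-value : ∀ v x → total (value x) v ≡ natMul (ΣN.sum (λ i → toℕ (lookup x (incident v i)))) h
  total-value v x = go 3 (λ i → toℕ (lookup x (incident v i)))
    where
    go : ∀ n (f : Fin n → ℕ) → ΣG.sum (λ i → natMul (f i) h) ≡ natMul (ΣN.sum f) h
    go zero    f = refl
    go (suc n) f = trans (cong (natMul (f zero) h ∙_) (go n (f ∘ suc))) (sym (natMul-+ (f zero) _ h))

  pos-sum : ∀ n (f : Fin n → ℕ) → + ΣN.sum f ≡ ΣZ.sum (λ i → + f i)
  pos-sum zero    f = refl
  pos-sum (suc n) f = trans (ℤₚ.pos-+ (f zero) _) (cong (λ z → + f zero ℤ.+ z) (pos-sum n (f ∘ suc)))

  form-holds : ∀ v x → P ℤ∣.∣ form v x → total (value x) v ≡ natMul (charge v) h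
  form-holds v x d = trans (total-value v x) (natMul-cong {ΣN.sum (λ i → toℕ (lookup x (incident v i)))} {charge v} (mod (subst (P ℤ∣.∣_)
    (cong (ℤ._- + charge v) (sym (pos-sum 3 (λ i → toℕ (lookup x (incident v i)))))) (unsigned v _ d))))
    where
    lem : ∀ s → ℤ.- 1ℤ ℤ.* s ≡ ℤ.- s
    lem = ℤ-solve-∀
    unsigned : ∀ v s → P ℤ∣.∣ sign v ℤ.* s → P ℤ∣.∣ s
    unsigned (inj₁ q) s d = subst (P ℤ∣.∣_) (ℤₚ.*-identityˡ s) d
    unsigned (inj₂ r) s d = subst (P ℤ∣.∣_) (trans (cong ℤ.-_ (lem s)) (ℤₚ.neg-involutive s)) (ℤ∣.∣m⇒∣-m d)

  module Hardness (R : RealField lzero lzero) (d : ℕ) (2d<σ : suc (d + d) ≤ σ) (3+d≤σ : 3 + d ≤ σ) where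
    open Field R
    open Kernel R p′ pr
    open LowerBound R p′ pr system
    open Evaluation R

    N : ℕ
    N = ((3 * L) * order) * 2

    literal : {A : Set} → Fin 2 → Dec A → Carrier
    literal zero    A? = bitR A?
    literal (suc _) A? = 1# ⊞ ⊟ bitR A?

    decode : Fin N → (Fin (3 * L) × Fin order) × Fin 2
    decode i = remQuot {3 * L} order (proj₁ (remQuot {(3 * L) * order} 2 i)) , proj₂ (remQuot {(3 * L) * order} 2 i)

    decode-combine : ∀ a b t → decode (combine (combine a b) t) ≡ ((a , b) , t)
    decode-combine a b t = trans
      (cong (λ (ab , t) → remQuot {3 * L} order ab , t) (Finₚ.remQuot-combine {(3 * L) * order} {2} (combine a b) t))
      (cong (_, t) (Finₚ.remQuot-combine {3 * L} {order} a b))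

    edge : Fin N → Fin (3 * L)
    edge i = proj₁ (proj₁ (decode i))

    -- Every variable of the calculus, twin or not, reads a single coordinate of x; this is why
    -- degree bounds Fourier degree.
    w : Fin N → Fin p → Carrier
    w i j = literal (proj₂ (decode i)) (natMul (toℕ j) h Finₚ.≟ proj₂ (proj₁ (decode i)))

    open Functional N
    open Poly R N
    open Refutation N edge w

    val-combine : ∀ x (a : Fin (3 * L)) (b : Fin order) t →
                  val x (combine (combine a b) t) ≡ literal t (value x a Finₚ.≟ b)
    val-combine x a b t = cong (λ ((a , b) , t) → literal t (value x a Finₚ.≟ b)) (decode-combine a b t)

    prodMono′ : List (Fin N) → Mono
    prodMono′ = prodMono R G tseitin

    product : (Fin N → Carrier) → List (Fin N) → Carrier
    product v []       = 1#
    product v (i ∷ is) = v i ⊠ product v is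

    evalMono-prod : ∀ v is → evalMono v (prodMono′ is) ≈ product v is
    evalMono-prod v []       = evalMono-one N v
    evalMono-prod v (i ∷ is) = transᴿ (evalMono-unit v i (prodMono′ is)) (⊠-congˡ (evalMono-prod v is))

    evalAt-monomial : ∀ is x → evalAt (monomial (prodMono′ is)) x ≈ product (val x) is
    evalAt-monomial is x = transᴿ (⊞-identityʳ _) (transᴿ (⊠-identityˡ _) (evalMono-prod (val x) is))

    product-zero : ∀ v {i} is → i ∈ is → v i ≈ 0# → product v is ≈ 0#
    product-zero v (i ∷ is) (here refl) eq = transᴿ (⊠-congʳ eq) (⊠-zeroˡ _)
    product-zero v (i ∷ is) (there i∈)  eq = transᴿ (⊠-congˡ (product-zero v is i∈ eq)) (⊠-zeroʳ _)

    junta-product : ∀ is → Junta (length is) (λ x → product (val x) is)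
    junta-product []       = junta-one
    junta-product (i ∷ is) = junta-table {k = length is} (edge i) (w i) (junta-product is)

    X′ X̄′ : Fin (3 * L) → Fin order → Fin N
    X′ = X R G tseitin
    X̄′ = X̄ R G tseitin

    val-X-no : ∀ x a b → value x a ≢ b → val x (X′ a b) ≈ 0#
    val-X-no x a b ≢b = transᴿ (reflexive (val-combine x a b zero)) (bitR-no (value x a Finₚ.≟ b) ≢b)

    idempotent : ∀ t {A : Set} (A? : Dec A) → literal t A? ⊠ literal t A? ≈ literal t A?
    idempotent zero    (yes _) = ⊠-identityˡ 1#
    idempotent zero    (no _)  = ⊠-zeroˡ 0#
    idempotent (suc _) (yes _) = transᴿ (⊠-congʳ (⊟-inverseʳ 1#)) (transᴿ (⊠-zeroˡ _) (symᴿ (⊟-inverseʳ 1#)))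
    idempotent (suc _) (no _)  = transᴿ (⊠-congʳ one) (⊠-identityˡ _)
      where
      one : 1# ⊞ ⊟ 0# ≈ 1#
      one = transᴿ (⊞-congˡ ⊟-zero) (⊞-identityʳ 1#)

    neg-one : ∀ {a b} → a ≈ b → a ⊞ (⊟ 1# ⊠ b ⊞ 0#) ≈ 0#
    neg-one {a} {b} a≈b = begin
      a ⊞ (⊟ 1# ⊠ b ⊞ 0#)   ≈⟨ ⊞-cong a≈b (⊞-identityʳ _) ⟩
      b ⊞ ⊟ 1# ⊠ b          ≈⟨ ⊞-congˡ (⊟-distribˡ-⊠ 1# b) ⟨
      b ⊞ ⊟ (1# ⊠ b)        ≈⟨ ⊞-congˡ (⊟-cong (⊠-identityˡ b)) ⟩
      b ⊞ ⊟ b               ≈⟨ ⊟-inverseʳ b ⟩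
      0#                    ∎

    evalMono-unit-one : ∀ v i → evalMono v (unitMono i) ≈ v i
    evalMono-unit-one v i = transᴿ (reflexive (cong (evalMono v) (sym (Vecₚ.zipWith-identityʳ +-identityʳ (unitMono i)))))
      (transᴿ (evalMono-unit v i oneMono) (transᴿ (⊠-congˡ (evalMono-one N v)) (⊠-identityʳ (v i))))

    -- All axioms but the relation axioms vanish at every point. The monomial of a relation axiom is
    -- nonzero only where its row fails, so `null-violated` applies; as a product of three literals
    -- it requires 3 + d ≤ σ.
    sound : ∀ {Q} → EQAx R G tseitin Q → Null d (evalAt Q)
    sound (twinProd a) = null-zero (λ x → transᴿ (evalAt-monomial (List.map (X̄ R G tseitin a) (List.allFin order)) x)
      (product-zero (val x) _ (∈-map⁺ (X̄ R G tseitin a) (∈-allFin (value x a)))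
        (transᴿ (reflexive (val-combine x a (value x a) (suc zero)))
          (transᴿ (⊞-congˡ (⊟-cong (bitR-yes (value x a Finₚ.≟ value x a) refl))) (⊟-inverseʳ 1#)))))
    sound (atMostOne a b₀ b₁ b₀≢b₁) = null-zero (λ x → transᴿ (evalAt-monomial (X′ a b₀ ∷ X′ a b₁ ∷ []) x) (vanish x))
      where
      vanish : ∀ x → product (val x) (X′ a b₀ ∷ X′ a b₁ ∷ []) ≈ 0#
      vanish x with value x a Finₚ.≟ b₀
      ... | no ≢b₀   = product-zero (val x) (X′ a b₀ ∷ X′ a b₁ ∷ []) (here refl) (val-X-no x a b₀ ≢b₀)
      ... | yes ≡b₀  = product-zero (val x) (X′ a b₀ ∷ X′ a b₁ ∷ []) (there (here refl))
                         (val-X-no x a b₁ (λ ≡b₁ → b₀≢b₁ (trans (sym ≡b₀) ≡b₁)))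
    sound (relation c c∈eqs b₁ b₂ b₃ ¬holds) with ∈-tabulate⁻ {f = equation ∘ vertex} c∈eqs
    ... | v , refl = null-cong (λ x → symᴿ (evalAt-monomial is x))
      (null-violated v (junta-product is) 3+d≤σ violated)
      where
      e : Fin 3 → Fin (3 * L)
      e = slot (vertex v)
      is : List (Fin N)
      is = X′ (e zero) b₁ ∷ X′ (e (suc zero)) b₂ ∷ X′ (e (suc (suc zero))) b₃ ∷ []
      violated : ∀ x → product (val x) is ≈ 0# ⊎ ¬ P ℤ∣.∣ form (vertex v) x
      violated x with value x (e zero) Finₚ.≟ b₁ | value x (e (suc zero)) Finₚ.≟ b₂ | value x (e (suc (suc zero))) Finₚ.≟ b₃
      ... | no ≢b    | _        | _        = inj₁ (product-zero (val x) is (here refl) (val-X-no x _ b₁ ≢b))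
      ... | yes _    | no ≢b    | _        = inj₁ (product-zero (val x) is (there (here refl)) (val-X-no x _ b₂ ≢b))
      ... | yes _    | yes _    | no ≢b    = inj₁ (product-zero (val x) is (there (there (here refl))) (val-X-no x _ b₃ ≢b))
      ... | yes refl | yes refl | yes refl = inj₂ (λ p∣ → ¬holds (trans (lhs-total (value x) (vertex v)) (form-holds (vertex v) x p∣)))
    sound (boolean i) = null-zero (λ x → transᴿ (⊞-cong (⊠-identityˡ _) reflᴿ) (neg-one (begin
      evalMono (val x) (prodMono′ (i ∷ i ∷ []))   ≈⟨ evalMono-prod (val x) (i ∷ i ∷ []) ⟩
      val x i ⊠ (val x i ⊠ 1#)                    ≈⟨ ⊠-congˡ (⊠-identityʳ _) ⟩
      val x i ⊠ val x i                           ≈⟨ idempotent (proj₂ (decode i)) (value x (edge i) Finₚ.≟ proj₂ (proj₁ (decode i))) ⟩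
      val x i                                     ≈⟨ evalMono-unit-one (val x) i ⟨
      evalMono (val x) (unitMono i)               ∎)))
    sound (twin a b) = null-zero (λ x → transᴿ (symᴿ (⊞-assoc _ _ _)) (neg-one (begin
      1# ⊠ evalMono (val x) (unitMono (X′ a b)) ⊞ 1# ⊠ evalMono (val x) (unitMono (X̄′ a b))
        ≈⟨ ⊞-cong (transᴿ (⊠-identityˡ _) (evalMono-unit-one (val x) (X′ a b)))
                  (transᴿ (⊠-identityˡ _) (evalMono-unit-one (val x) (X̄′ a b))) ⟩
      val x (X′ a b) ⊞ val x (X̄′ a b)
        ≈⟨ ⊞-cong (reflexive (val-combine x a b zero)) (reflexive (val-combine x a b (suc zero))) ⟩
      β x ⊞ (1# ⊞ ⊟ β x)             ≈⟨ ⊞-comm _ _ ⟩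
      1# ⊞ ⊟ β x ⊞ β x               ≈⟨ ⊞-assoc _ _ _ ⟩
      1# ⊞ (⊟ β x ⊞ β x)             ≈⟨ ⊞-congˡ (⊟-inverseˡ (β x)) ⟩
      1# ⊞ 0#                        ≈⟨ ⊞-identityʳ 1# ⟩
      1#                             ≈⟨ evalMono-one N (val x) ⟨
      evalMono (val x) oneMono       ∎)))
      where
      β : Vec (Fin p) (3 * L) → Carrier
      β x = bitR (value x a Finₚ.≟ b)

    not-refutable : ¬ PCRefutableInDeg R G tseitin d
    not-refutable = no-refutation 2d<σ sound

-- Choice of the parameters

module Family (G : FinAbGroup) (nonTrivial : NonTrivial G)
  (D′ : ℕ) (b : ℕ) (b≡2^16 : b ≡ 2 ^ 16) (large : (b * b) * 15 ^ suc D′ < 16 ^ suc D′) where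

  open Torsion G

  torsion = prime-torsion nonTrivial

  module At (n : ℕ) where
    open Expander (suc D′) (suc n) (s≤s z≤n) b b≡2^16 large using (expander)
    open Equations G (suc n) D′ (s≤s z≤n) (proj₁ expander) (proj₂ expander)
      (proj₁ torsion) (proj₁ (proj₂ torsion)) (proj₁ (proj₂ (proj₂ torsion)))
      (proj₁ (proj₂ (proj₂ (proj₂ torsion)))) (proj₂ (proj₂ (proj₂ (proj₂ torsion)))) public

  family : ℕ → Instance G
  -- A default value; the claims about the family start at 1.
  family zero    = record { vars = 0 ; eqs = [] }
  family (suc n) = At.tseitin n

  -- The number of variables per unit of n: σ = n gives 16 n D positions with three edges each. It
  -- also bounds the two equations per position.
  ratio : ℕ
  ratio = 3 * (16 * suc D′)

  1≤ratio : 1 ≤ ratio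
  1≤ratio = *-mono-≤ {1} {3} (s≤s z≤n) (*-mono-≤ {1} {16} (s≤s z≤n) (s≤s z≤n))

  block≡ : ∀ n → 16 * n * suc D′ ≡ (16 * suc D′) * n
  block≡ n = lem n (suc D′)
    where
    lem : ∀ n D → 16 * n * D ≡ (16 * D) * n
    lem = solve-∀

  n≤block : ∀ n → n ≤ 16 * n * suc D′
  n≤block n = ≤-trans (m≤n*m n 16) (m≤m*n (16 * n) (suc D′))

  vars≡ : ∀ n → numVars G (family (suc n)) ≡ ratio * suc n
  vars≡ n = trans (cong (3 *_) (block≡ (suc n))) (sym (*-assoc 3 (16 * suc D′) (suc n)))

  n≤Kn : ∀ n → n ≤ ratio * n
  n≤Kn n = subst (_≤ ratio * n) (*-identityˡ n) (*-monoˡ-≤ n 1≤ratio)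

  sizes : ∀ n → 1 ≤ n → (n ≤ ratio * numVars G (family n)) × (numVars G (family n) ≤ ratio * n) ×
                        (n ≤ ratio * numEqs G (family n)) × (numEqs G (family n) ≤ ratio * n)
  sizes (suc n) _ = ≤-trans (n≤Kn (suc n)) (*-monoʳ-≤ ratio (subst (suc n ≤_) (sym (vars≡ n)) (n≤Kn (suc n))))
                  , ≤-reflexive (vars≡ n)
                  , ≤-trans (n≤Kn (suc n)) (*-monoʳ-≤ ratio (subst (suc n ≤_) (sym (At.numEqs-tseitin n))
                      (≤-trans (n≤block (suc n)) (m≤m+n _ _))))
                  , subst (_≤ ratio * suc n) (sym (At.numEqs-tseitin n))
                      (≤-trans (+-monoʳ-≤ B (m≤m+n B (B + 0))) (≤-reflexive (vars≡ n)))
    where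
    B = 16 * suc n * suc D′

  hard : (R : RealField lzero lzero) → ∀ n → 3 ≤ n → ∀ d → 8 * d < n → ¬ PCRefutableInDeg R G (family n) d
  hard R (suc n) 3≤n d 8d<n = At.Hardness.not-refutable n R d (small₁ d 3≤n 8d<n) (small₂ d 3≤n 8d<n)
    where
    small₁ : ∀ {n} d → 3 ≤ n → 8 * d < n → suc (d + d) ≤ n
    small₁ d _ lt = ≤-trans (s≤s (≤-trans (≤-reflexive (lem d)) (*-monoˡ-≤ d (s≤s (s≤s (z≤n {6})))))) lt
      where
      lem : ∀ d → d + d ≡ 2 * d
      lem = solve-∀
    small₂ : ∀ {n} d → 3 ≤ n → 8 * d < n → 3 + d ≤ n
    -- For d = 0 the hypothesis gives only n ≥ 1, so the three literals of a relation axiom need the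
    -- explicit bound 3 ≤ n.
    small₂ zero    3≤n _  = 3≤n
    small₂ (suc d) _   lt = ≤-trans (≤-trans (m≤m+n (3 + suc d) (5 + 7 * d)) (≤-reflexive (lem d))) lt
      where
      lem : ∀ d → 3 + suc d + (5 + 7 * d) ≡ suc (8 * suc d)
      lem = solve-∀

-- The union bound runs over 2^(32σ) pairs, so D must exceed 32 ln 2 / ln(16/15), about 343.7; 400
-- is a round value above it.
degree-large : (2 ^ 16 * 2 ^ 16) * 15 ^ 400 < 16 ^ 400
degree-large = toWitness {a? = (2 ^ 16 * 2 ^ 16) * 15 ^ 400 <? 16 ^ 400} _

theorem6p10 : (R : RealField lzero lzero) (G : FinAbGroup) → NonTrivial G →
    Σ ℕ λ D → (1 ≤ D) × Σ ℕ λ K → (1 ≤ K) × Σ (ℕ → Instance G) λ A →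
    (∀ n → 1 ≤ n → Unsatisfiable G (A n) × Irredundant G (A n)) ×
    (Σ ℕ λ n₀ → ∀ n → n₀ ≤ n →
    (n ≤ K * numVars G (A n)) × (numVars G (A n) ≤ K * n) ×
    (n ≤ K * numEqs G (A n)) × (numEqs G (A n) ≤ K * n)) ×
    (Σ ℕ λ n₁ → ∀ n → n₁ ≤ n → ∀ d → D * d < n → ¬ PCRefutableInDeg R G (A n) d)
theorem6p10 R G nt = 8 , s≤s z≤n , ratio , 1≤ratio , family
                   , (λ { (suc n) _ → At.unsatisfiable n , At.irredundant n }) , (1 , sizes) , (3 , hard R)
  where
  open Family G nt 399 (2 ^ 16) refl degree-large
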